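{- Let $P,Q\subset\mathbb R^3$ be lattice polytopes with $L(P)=L(Q)=1$, $L(P+Q)=2$, and $|P|=|Q|=5$. Then the pair $(P,Q)$ is equivalent to $(K_1,K_1)$, where $K_1=\operatorname{conv}\{e_1,e_2,e_3,-e_1-e_2-e_3\}$.
   Context: $|P|$ is the number of lattice points of $P$. The Minkowski length $L(P)$ is the largest $L$ such that $P$ contains a Minkowski sum of $L$ lattice polytopes each of positive dimension. Pairs $(P,Q)$, $(P',Q')$ are equivalent if there is an affine unimodular map $\varphi$ ($x\mapsto Ux+b$, $U\in\mathrm{GL}(3,\mathbb Z)$, $b\in\mathbb Z^3$) and lattice vectors $v,w$ with $P'=\varphi(P)+v$, $Q'=\varphi(Q)+w$. -}

module Defs where

open import Data.Nat using (ℕ; zero; suc; _≤_)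
open import Data.Integer as ℤ using (ℤ)
open import Data.Rational as ℚ using (ℚ; 0ℚ; 1ℚ)
open import Data.List using (List; []; _∷_; length; map; concatMap)
open import Data.List.NonEmpty using (List⁺) renaming (toList to toList⁺)
open import Data.Vec as V using (Vec)
open import Data.Product using (Σ; ∃; _×_; _,_; proj₁; proj₂)
open import Data.List.Relation.Unary.All using (All)
open import Data.List.Relation.Unary.Unique.Propositional using (Unique)
open import Data.List.Membership.Propositional using (_∈_)
open import Relation.Binary.PropositionalEquality using (_≡_; _≢_)
open import Function.Bundles using (_⇔_)

Pt : Set
Pt = Vec ℤ 3

QPt : Set
QPt = Vec ℚ 3

toQ : Pt → QPt
toQ = V.map (λ z → z ℚ./ 1)

_+ᵖ_ : Pt → Pt → Pt
_+ᵖ_ = V.zipWith ℤ._+_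

0ᵖ : Pt
0ᵖ = V.replicate 3 (ℤ.+ 0)

_+q_ : QPt → QPt → QPt
_+q_ = V.zipWith ℚ._+_

0q : QPt
0q = V.replicate 3 0ℚ

_·q_ : ℚ → QPt → QPt
c ·q x = V.map (c ℚ.*_) x

-- A lattice polytope is given by a finite list of lattice points
-- (generators); the polytope itself is their convex hull.
LPoly : Set
LPoly = List Pt

weights : List (ℚ × Pt) → ℚ
weights [] = 0ℚ
weights ((c , _) ∷ ws) = c ℚ.+ weights ws

combo : List (ℚ × Pt) → QPt
combo [] = 0q
combo ((c , p) ∷ ws) = (c ·q toQ p) +q combo ws

InConv : LPoly → QPt → Set
InConv P x = Σ (List (ℚ × Pt)) λ ws →
  All (λ w → (0ℚ ℚ.≤ proj₁ w) × (proj₂ w ∈ P)) ws ×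
  weights ws ≡ 1ℚ × combo ws ≡ x

NumLatticePts : LPoly → ℕ → Set
NumLatticePts P n = Σ (List Pt) λ xs →
  length xs ≡ n × Unique xs × ((x : Pt) → (x ∈ xs) ⇔ InConv P (toQ x))

_⊕_ : LPoly → LPoly → LPoly
P ⊕ Q = concatMap (λ p → map (p +ᵖ_) Q) P

sumAll : List LPoly → LPoly
sumAll [] = 0ᵖ ∷ []
sumAll (Q ∷ Qs) = Q ⊕ sumAll Qs

-- positive dimension: conv(Q) has two distinct points, i.e. two distinct generators
PosDim : LPoly → Set
PosDim Q = Σ Pt λ p → Σ Pt λ q → p ∈ Q × q ∈ Q × p ≢ q

Subset : LPoly → LPoly → Set
Subset Q P = (x : QPt) → InConv Q x → InConv P x

ContainsSumOf : LPoly → ℕ → Set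
ContainsSumOf P L = Σ (List LPoly) λ Qs →
  length Qs ≡ L × All PosDim Qs × Subset (sumAll Qs) P

MinkowskiLength : LPoly → ℕ → Set
MinkowskiLength P L = ContainsSumOf P L × ((m : ℕ) → ContainsSumOf P m → m ≤ L)

Mat : Set
Mat = Vec (Vec ℤ 3) 3

dotℤ : Vec ℤ 3 → Vec ℤ 3 → ℤ
dotℤ u v = V.foldr _ ℤ._+_ (ℤ.+ 0) (V.zipWith ℤ._*_ u v)

_*ᴹ_ : Mat → Mat → Mat
A *ᴹ B = V.map (λ row → V.map (λ col → dotℤ row col) (V.transpose B)) A

Iᴹ : Mat
Iᴹ = (ℤ.+ 1 V.∷ ℤ.+ 0 V.∷ ℤ.+ 0 V.∷ V.[]) V.∷
     (ℤ.+ 0 V.∷ ℤ.+ 1 V.∷ ℤ.+ 0 V.∷ V.[]) V.∷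
     (ℤ.+ 0 V.∷ ℤ.+ 0 V.∷ ℤ.+ 1 V.∷ V.[]) V.∷ V.[]

InGL3Z : Mat → Set
InGL3Z U = Σ Mat λ W → (U *ᴹ W ≡ Iᴹ) × (W *ᴹ U ≡ Iᴹ)

dotℚ : Vec ℚ 3 → Vec ℚ 3 → ℚ
dotℚ u v = V.foldr _ ℚ._+_ 0ℚ (V.zipWith ℚ._*_ u v)

actQ : Mat → QPt → QPt
actQ U x = V.map (λ row → dotℚ (V.map (λ z → z ℚ./ 1) row) x) U

ImageEq : Mat → Pt → Pt → LPoly → LPoly → Set
ImageEq U b t P P' = (x : QPt) →
  InConv P' x ⇔ (Σ QPt λ y → InConv P y × x ≡ (actQ U y +q toQ b) +q toQ t)

EquivPair : LPoly → LPoly → LPoly → LPoly → Set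
EquivPair P Q P' Q' = Σ Mat λ U → InGL3Z U × Σ Pt λ b → Σ Pt λ v → Σ Pt λ w →
  ImageEq U b v P P' × ImageEq U b w Q Q'

e₁ e₂ e₃ e₄ : Pt
e₁ = ℤ.+ 1 V.∷ ℤ.+ 0 V.∷ ℤ.+ 0 V.∷ V.[]
e₂ = ℤ.+ 0 V.∷ ℤ.+ 1 V.∷ ℤ.+ 0 V.∷ V.[]
e₃ = ℤ.+ 0 V.∷ ℤ.+ 0 V.∷ ℤ.+ 1 V.∷ V.[]
e₄ = ℤ.-[1+ 0 ] V.∷ ℤ.-[1+ 0 ] V.∷ ℤ.-[1+ 0 ] V.∷ V.[]

K₁ : LPoly
K₁ = e₁ ∷ e₂ ∷ e₃ ∷ e₄ ∷ []

{-# OPTIONS --safe #-}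
-- P + Q contains no sum of three segments, hence no lattice segment of length three, so distinct lattice points
-- of P + Q have distinct residues modulo 3.  Let A and B be the lattice points of P and Q.  In F₃³ there is no room
-- for 25 different sums a + b, so P and Q have a common edge vector u; translate both such that 0 and u are common
-- points.  Then A ∪ B contains no parallelogram, because with u it would span a sum of three segments, and
-- the only coincidences among the sums a + b are the forced ones between common points.  Searching F₃³
-- once more excludes exactly two, three or four common points, so that A = B.
--
-- Modulo 2, four of the five points form a plane; let 0 be the fifth and f₁, ..., f₄ the four.  Their half sum lies in
-- P + Q and is congruent to 0 or to some fᵢ modulo 3, hence equal to it; fᵢ is impossible since the other three
-- would span a parallelepiped.  So f₁ + f₂ + f₃ + f₄ = 0.  A lattice point z is congruent modulo 2 to some ρ among
-- 0, fᵢ, fᵢ + fⱼ, and replacing z by (z + ρ) / 2 moves it into P, where only 0 and the fᵢ are available, or gets stuck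
-- in 2 P with ρ = fᵢ + fⱼ.  In the latter case z, (z + ρ) / 2 and (z - ρ) / 2 all lie in P + Q, and residues modulo 3
-- show that one of them is a sum of two points of A.  Hence the fᵢ generate the lattice.
module Submission where

open import Defs
open import Data.Bool using (Bool; true; false; _∧_; _∨_; not; T; _xor_; if_then_else_)
open import Data.Bool.Properties using (T-∧; T-∨)
open import Data.Empty using (⊥; ⊥-elim)
open import Data.Fin using (Fin; zero; suc; #_)
open import Data.Fin.Properties using (all?)
open import Data.Integer as ℤ using (ℤ; +_; -[1+_]; ∣_∣; _+_; _*_; _-_; -_)
import Data.Integer.Properties as ℤₚ
open import Data.Integer.DivMod using (_%ℕ_; _/ℕ_; n%ℕd<d; a≡a%ℕn+[a/ℕn]*n)
open import Data.Integer.Tactic.RingSolver using (solve-∀)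
open import Data.List using (List; []; _∷_; _++_; map; length)
import Data.List.Properties as Listₚ
open import Data.List.Membership.Propositional using (_∈_; _∉_; find)
import Data.List.Membership.Propositional.Properties as ∈ₚ
open import Data.List.Relation.Unary.All as All using (All; []; _∷_)
import Data.List.Relation.Unary.All.Properties as Allₚ
open import Data.List.Relation.Unary.Any as Any using (Any; here; there)
open import Data.List.Relation.Unary.AllPairs as AllPairs using (AllPairs; []; _∷_)
open import Data.List.Relation.Unary.Unique.Propositional using (Unique)
import Data.List.Relation.Unary.Unique.Propositional.Properties as Uniqueₚ
open import Data.List.Relation.Binary.Permutation.Propositional
  using (_↭_; ↭-refl; ↭-sym; ↭-trans; ↭-reflexive; ↭⇒↭ₛ; prep)
import Data.List.Relation.Binary.Permutation.Propositional.Properties as ↭ₚ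
import Data.List.Relation.Binary.Permutation.Setoid.Properties as ↭ₛₚ
open import Data.Nat as ℕ using (ℕ; zero; suc; s≤s; z≤n)
import Data.Nat.Properties as ℕₚ
open import Data.Product using (Σ; ∃; _×_; _,_; proj₁; proj₂; map₂)
open import Data.Rational as ℚ using (ℚ; 0ℚ; 1ℚ)
import Data.Rational.Properties as ℚₚ
import Data.Rational.Unnormalised as ℚᵘ
import Data.Rational.Unnormalised.Properties as ℚᵘₚ
open import Data.Sum as Sum using (_⊎_; inj₁; inj₂)
open import Data.Unit using (tt)
open import Data.Vec as V using (Vec; []; _∷_)
import Data.Vec.Properties as Vecₚ
open import Function using (_∘_; case_of_; _⇔_; mk⇔; Equivalence)
open import Relation.Binary.Definitions using (DecidableEquality)
open import Relation.Binary.PropositionalEquality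
open import Relation.Nullary using (¬_; Dec; yes; no; ¬?)
open import Relation.Nullary.Decidable using (_×-dec_; decidable-stable; toWitness)

-- The modulus 3 fits because a lattice segment of length three is itself a sum of three segments.
-- All sums must then fit into the 27 elements of F₃³, and each claim about coincidences becomes a
-- finite search. To keep it small, two independent vectors are first moved to `e₁ᵛ`, `e₂ᵛ` by an
-- automorphism, which preserves coincidences, and a partial configuration is dropped at its first
-- repeated sum. The geometry therefore has to be recast as distinctness of a list of labelled sums;
-- the label says in which of the two sets a point may be used. Halving needs a quantity that
-- decreases strictly. The facet functionals of the tetrahedron, cleared of denominators, provide
-- it: a point bounded by `N + 1` and a representative bounded by `N` have a midpoint bounded by
-- `N`, by integrality. For `ρ = fᵢ + fⱼ` this stops at the doubled tetrahedron; there `- ρ` is the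
-- sum of the other two vertices, so both halves of `z + ρ` and `z - ρ` stay in `P + Q`. The
-- determinant is never evaluated: oddness makes it nonzero, and the integral inverse comes from
-- generation.

pointwise : ∀ {A : Set} {a b c a′ b′ c′ : A} → a ≡ a′ → b ≡ b′ → c ≡ c′ →
            _≡_ {A = Vec A 3} (a ∷ b ∷ c ∷ []) (a′ ∷ b′ ∷ c′ ∷ [])
pointwise refl refl refl = refl

-- Residues modulo an integer

module Residue {F : Set} (ι : F → ℤ) (m : ℤ) (_⊕_ _⊗_ : F → F → F)
  (ι-inj : ∀ r s q → ι r ≡ ι s + q * m → r ≡ s)
  (⊕-homo : ∀ r s → Σ ℤ λ q → ι r + ι s ≡ ι (r ⊕ s) + q * m)
  (⊗-homo : ∀ r s → Σ ℤ λ q → ι r * ι s ≡ ι (r ⊗ s) + q * m)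
  (divide : ∀ z → Σ F λ r → Σ ℤ λ q → z ≡ ι r + q * m) where

  res : ℤ → F
  res z = proj₁ (divide z)

  -- Two representatives of the same integer differ by a multiple of `m`, so `ι-inj` identifies
  -- them. The homomorphism laws below therefore only have to exhibit a quotient.
  res-unique : ∀ {z} r q → z ≡ ι r + q * m → res z ≡ r
  res-unique {z} r q eq with divide z
  ... | s , p , eq′ = ι-inj s r (q - p) (begin
      ι s ≡⟨ shuffle (ι s) (p * m) ⟩
      (ι s + p * m) - p * m ≡⟨ cong (_- p * m) (trans (sym eq′) eq) ⟩
      (ι r + q * m) - p * m ≡⟨ collect (ι r) q p m ⟩
      ι r + (q - p) * m ∎)
    where
    open ≡-Reasoning
    shuffle : ∀ x y → x ≡ (x + y) - y
    shuffle = solve-∀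
    collect : ∀ x q p m → (x + q * m) - p * m ≡ x + (q - p) * m
    collect = solve-∀

  res-+ : ∀ y z → res (y + z) ≡ res y ⊕ res z
  res-+ y z with divide y | divide z
  ... | r , p , refl | s , q , refl with ⊕-homo r s
  ... | t , eq = res-unique (r ⊕ s) (t + (p + q)) (begin
      (ι r + p * m) + (ι s + q * m) ≡⟨ regroup (ι r) p (ι s) q m ⟩
      (ι r + ι s) + (p + q) * m ≡⟨ cong (_+ (p + q) * m) eq ⟩
      (ι (r ⊕ s) + t * m) + (p + q) * m ≡⟨ collect (ι (r ⊕ s)) t (p + q) m ⟩
      ι (r ⊕ s) + (t + (p + q)) * m ∎)
    where
    open ≡-Reasoning
    regroup : ∀ x p y q m → (x + p * m) + (y + q * m) ≡ (x + y) + (p + q) * m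
    regroup = solve-∀
    collect : ∀ x t s m → (x + t * m) + s * m ≡ x + (t + s) * m
    collect = solve-∀

  res-* : ∀ y z → res (y * z) ≡ res y ⊗ res z
  res-* y z with divide y | divide z
  ... | r , p , refl | s , q , refl with ⊗-homo r s
  ... | t , eq = res-unique (r ⊗ s) (t + u) (begin
      (ι r + p * m) * (ι s + q * m) ≡⟨ regroup (ι r) p (ι s) q m ⟩
      ι r * ι s + u * m ≡⟨ cong (_+ u * m) eq ⟩
      (ι (r ⊗ s) + t * m) + u * m ≡⟨ collect (ι (r ⊗ s)) t u m ⟩
      ι (r ⊗ s) + (t + u) * m ∎)
    where
    open ≡-Reasoning
    u = ι r * q + p * ι s + p * m * q
    regroup : ∀ x p y q m → (x + p * m) * (y + q * m)
                          ≡ x * y + (x * q + p * y + p * m * q) * m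
    regroup = solve-∀
    collect : ∀ x t s m → (x + t * m) + s * m ≡ x + (t + s) * m
    collect = solve-∀

  res-≡ : ∀ y z → res y ≡ res z → Σ ℤ λ w → y ≡ z + w * m
  res-≡ y z eq with divide y | divide z
  res-≡ y z refl | r , p , refl | .r , q , refl = p - q , collect (ι r) p q m
    where
    collect : ∀ x p q m → x + p * m ≡ (x + q * m) + (p - q) * m
    collect = solve-∀

  resᵖ : Pt → Vec F 3
  resᵖ = V.map res

  resᵖ-+ : ∀ x y → resᵖ (x +ᵖ y) ≡ V.zipWith _⊕_ (resᵖ x) (resᵖ y)
  resᵖ-+ (a ∷ b ∷ c ∷ []) (a′ ∷ b′ ∷ c′ ∷ [])
    rewrite res-+ a a′ | res-+ b b′ | res-+ c c′ = refl

  resᵖ-≡ : ∀ x y → resᵖ x ≡ resᵖ y → Σ Pt λ w → x ≡ y +ᵖ V.map (_* m) w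
  resᵖ-≡ (a ∷ b ∷ c ∷ []) (a′ ∷ b′ ∷ c′ ∷ []) eq
    with res-≡ a a′ (cong V.head eq) | res-≡ b b′ (cong (V.head ∘ V.tail) eq)
       | res-≡ c c′ (cong (V.head ∘ V.tail ∘ V.tail) eq)
  ... | p , e | q , f | r , g = p ∷ q ∷ r ∷ [] , pointwise e f g

-- A nonzero multiple of `m` has absolute value at least `∣ m ∣`. The case `∣ q ∣ = 0` is refuted by
-- the missing clause, as a successor would equal 0.
incongruent : ∀ x y m {k} → ∣ x - y ∣ ≡ suc k → suc k ℕ.< ∣ m ∣ → ∀ q → x ≢ y + q * m
incongruent x y m {k} d≡k k<m q eq with ∣ q ∣ | trans (sym d≡k) (begin
    ∣ x - y ∣ ≡⟨ cong (λ x → ∣ x - y ∣) eq ⟩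
    ∣ (y + q * m) - y ∣ ≡⟨ cong ∣_∣ (cancel y (q * m)) ⟩
    ∣ q * m ∣ ≡⟨ ℤₚ.abs-* q m ⟩
    ∣ q ∣ ℕ.* ∣ m ∣ ∎)
  where
  open ≡-Reasoning
  cancel : ∀ y z → (y + z) - y ≡ z
  cancel = solve-∀
... | suc n | k≡ = ℕₚ.<⇒≱ k<m (subst (∣ m ∣ ℕ.≤_) (sym k≡) (ℕₚ.m≤m+n ∣ m ∣ _))

-- The residue rings modulo 3 and modulo 2

data F₃ : Set where
  0₃ 1₃ 2₃ : F₃

ι₃ : F₃ → ℤ
ι₃ 0₃ = + 0
ι₃ 1₃ = + 1
ι₃ 2₃ = + 2

_⊕₃_ _⊗₃_ : F₃ → F₃ → F₃
0₃ ⊕₃ y = y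
1₃ ⊕₃ 0₃ = 1₃
1₃ ⊕₃ 1₃ = 2₃
1₃ ⊕₃ 2₃ = 0₃
2₃ ⊕₃ 0₃ = 2₃
2₃ ⊕₃ 1₃ = 0₃
2₃ ⊕₃ 2₃ = 1₃
0₃ ⊗₃ y = 0₃
1₃ ⊗₃ y = y
2₃ ⊗₃ y = y ⊕₃ y

ι₃-inj : ∀ r s q → ι₃ r ≡ ι₃ s + q * + 3 → r ≡ s
ι₃-inj 0₃ 0₃ q eq = refl
ι₃-inj 0₃ 1₃ q eq = ⊥-elim (incongruent (+ 0) (+ 1) (+ 3) refl (s≤s (s≤s z≤n)) q eq)
ι₃-inj 0₃ 2₃ q eq = ⊥-elim (incongruent (+ 0) (+ 2) (+ 3) refl (s≤s (s≤s (s≤s z≤n))) q eq)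
ι₃-inj 1₃ 0₃ q eq = ⊥-elim (incongruent (+ 1) (+ 0) (+ 3) refl (s≤s (s≤s z≤n)) q eq)
ι₃-inj 1₃ 1₃ q eq = refl
ι₃-inj 1₃ 2₃ q eq = ⊥-elim (incongruent (+ 1) (+ 2) (+ 3) refl (s≤s (s≤s z≤n)) q eq)
ι₃-inj 2₃ 0₃ q eq = ⊥-elim (incongruent (+ 2) (+ 0) (+ 3) refl (s≤s (s≤s (s≤s z≤n))) q eq)
ι₃-inj 2₃ 1₃ q eq = ⊥-elim (incongruent (+ 2) (+ 1) (+ 3) refl (s≤s (s≤s z≤n)) q eq)
ι₃-inj 2₃ 2₃ q eq = refl

⊕₃-homo : ∀ r s → Σ ℤ λ q → ι₃ r + ι₃ s ≡ ι₃ (r ⊕₃ s) + q * + 3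
⊕₃-homo 0₃ 0₃ = + 0 , refl
⊕₃-homo 0₃ 1₃ = + 0 , refl
⊕₃-homo 0₃ 2₃ = + 0 , refl
⊕₃-homo 1₃ 0₃ = + 0 , refl
⊕₃-homo 1₃ 1₃ = + 0 , refl
⊕₃-homo 1₃ 2₃ = + 1 , refl
⊕₃-homo 2₃ 0₃ = + 0 , refl
⊕₃-homo 2₃ 1₃ = + 1 , refl
⊕₃-homo 2₃ 2₃ = + 1 , refl

⊗₃-homo : ∀ r s → Σ ℤ λ q → ι₃ r * ι₃ s ≡ ι₃ (r ⊗₃ s) + q * + 3
⊗₃-homo 0₃ 0₃ = + 0 , refl
⊗₃-homo 0₃ 1₃ = + 0 , refl
⊗₃-homo 0₃ 2₃ = + 0 , refl
⊗₃-homo 1₃ 0₃ = + 0 , refl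
⊗₃-homo 1₃ 1₃ = + 0 , refl
⊗₃-homo 1₃ 2₃ = + 0 , refl
⊗₃-homo 2₃ 0₃ = + 0 , refl
⊗₃-homo 2₃ 1₃ = + 0 , refl
⊗₃-homo 2₃ 2₃ = + 1 , refl

divide₃ : ∀ z → Σ F₃ λ r → Σ ℤ λ q → z ≡ ι₃ r + q * + 3
divide₃ z with z %ℕ 3 | n%ℕd<d z 3 | a≡a%ℕn+[a/ℕn]*n z 3
... | 0 | _ | eq = 0₃ , z /ℕ 3 , eq
... | 1 | _ | eq = 1₃ , z /ℕ 3 , eq
... | 2 | _ | eq = 2₃ , z /ℕ 3 , eq
... | suc (suc (suc _)) | s≤s (s≤s (s≤s ())) | eq

open Residue ι₃ (+ 3) _⊕₃_ _⊗₃_ ι₃-inj ⊕₃-homo ⊗₃-homo divide₃ public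
  using () renaming (resᵖ to res₃; resᵖ-+ to res₃-+; resᵖ-≡ to res₃-≡)

ι₂ : Bool → ℤ
ι₂ false = + 0
ι₂ true  = + 1

ι₂-inj : ∀ r s q → ι₂ r ≡ ι₂ s + q * + 2 → r ≡ s
ι₂-inj false false q eq = refl
ι₂-inj true  true  q eq = refl
ι₂-inj false true  q eq = ⊥-elim (incongruent (+ 0) (+ 1) (+ 2) refl (s≤s (s≤s z≤n)) q eq)
ι₂-inj true  false q eq = ⊥-elim (incongruent (+ 1) (+ 0) (+ 2) refl (s≤s (s≤s z≤n)) q eq)

xor-homo : ∀ r s → Σ ℤ λ q → ι₂ r + ι₂ s ≡ ι₂ (r xor s) + q * + 2
xor-homo false false = + 0 , refl
xor-homo false true  = + 0 , refl
xor-homo true  false = + 0 , refl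
xor-homo true  true  = + 1 , refl

∧-homo : ∀ r s → Σ ℤ λ q → ι₂ r * ι₂ s ≡ ι₂ (r ∧ s) + q * + 2
∧-homo false false = + 0 , refl
∧-homo false true  = + 0 , refl
∧-homo true  false = + 0 , refl
∧-homo true  true  = + 0 , refl

divide₂ : ∀ z → Σ Bool λ r → Σ ℤ λ q → z ≡ ι₂ r + q * + 2
divide₂ z with z %ℕ 2 | n%ℕd<d z 2 | a≡a%ℕn+[a/ℕn]*n z 2
... | 0 | _ | eq = false , z /ℕ 2 , eq
... | 1 | _ | eq = true  , z /ℕ 2 , eq
... | suc (suc _) | s≤s (s≤s ()) | eq

open Residue ι₂ (+ 2) _xor_ _∧_ ι₂-inj xor-homo ∧-homo divide₂ public
  using () renaming (res to parity; res-+ to parity-+; res-* to parity-*;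
                     resᵖ to res₂; resᵖ-+ to res₂-+; resᵖ-≡ to res₂-≡)

-- Boolean quantifiers over F₃³

T-∧₁ : ∀ {x y} → T (x ∧ y) → T x × T y
T-∧₁ = Equivalence.to T-∧

T-∨₁ : ∀ {x y} → T (x ∨ y) → T x ⊎ T y
T-∨₁ {x} = Equivalence.to (T-∨ {x})

T-true : ∀ {b} → b ≡ true → T b
T-true refl = tt

V₃ : Set
V₃ = Vec F₃ 3

_+₃_ : V₃ → V₃ → V₃
_+₃_ = V.zipWith _⊕₃_

_==₃_ : F₃ → F₃ → Bool
0₃ ==₃ 0₃ = true
1₃ ==₃ 1₃ = true
2₃ ==₃ 2₃ = true
_  ==₃ _  = false

==₃-sound : ∀ x y → T (x ==₃ y) → x ≡ y
==₃-sound 0₃ 0₃ _ = refl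
==₃-sound 1₃ 1₃ _ = refl
==₃-sound 2₃ 2₃ _ = refl

_==ᵛ_ : V₃ → V₃ → Bool
(a ∷ b ∷ c ∷ []) ==ᵛ (a′ ∷ b′ ∷ c′ ∷ []) = (a ==₃ a′) ∧ ((b ==₃ b′) ∧ (c ==₃ c′))

==ᵛ-sound : ∀ x y → T (x ==ᵛ y) → x ≡ y
==ᵛ-sound (a ∷ b ∷ c ∷ []) (a′ ∷ b′ ∷ c′ ∷ []) t with T-∧₁ {a ==₃ a′} t
... | t₁ , t₂ with T-∧₁ {b ==₃ b′} t₂
... | t₃ , t₄ = pointwise (==₃-sound a a′ t₁) (==₃-sound b b′ t₃) (==₃-sound c c′ t₄)

all₃ : (F₃ → Bool) → Bool
all₃ p = p 0₃ ∧ (p 1₃ ∧ p 2₃)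

all₃-sound : ∀ p → T (all₃ p) → ∀ x → T (p x)
all₃-sound p t 0₃ = proj₁ (T-∧₁ {p 0₃} t)
all₃-sound p t 1₃ = proj₁ (T-∧₁ {p 1₃} (proj₂ (T-∧₁ {p 0₃} t)))
all₃-sound p t 2₃ = proj₂ (T-∧₁ {p 1₃} (proj₂ (T-∧₁ {p 0₃} t)))

allᵛ : (V₃ → Bool) → Bool
allᵛ p = all₃ λ a → all₃ λ b → all₃ λ c → p (a ∷ b ∷ c ∷ [])

allᵛ-sound : ∀ p → T (allᵛ p) → ∀ x → T (p x)
allᵛ-sound p t (a ∷ b ∷ c ∷ []) =
  all₃-sound (λ c → p (a ∷ b ∷ c ∷ []))
    (all₃-sound (λ b → all₃ λ c → p (a ∷ b ∷ c ∷ []))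
      (all₃-sound (λ a → all₃ λ b → all₃ λ c → p (a ∷ b ∷ c ∷ [])) t a) b) c

any₃ : (F₃ → Bool) → Bool
any₃ p = p 0₃ ∨ (p 1₃ ∨ p 2₃)

any₃-sound : ∀ p → T (any₃ p) → ∃ λ x → T (p x)
any₃-sound p t with T-∨₁ {p 0₃} t
... | inj₁ t₀ = 0₃ , t₀
... | inj₂ t′ with T-∨₁ {p 1₃} t′
... | inj₁ t₁ = 1₃ , t₁
... | inj₂ t₂ = 2₃ , t₂

anyᵛ : (V₃ → Bool) → Bool
anyᵛ p = any₃ λ a → any₃ λ b → any₃ λ c → p (a ∷ b ∷ c ∷ [])

anyᵛ-sound : ∀ p → T (anyᵛ p) → ∃ λ x → T (p x)
anyᵛ-sound p t with any₃-sound (λ a → any₃ λ b → any₃ λ c → p (a ∷ b ∷ c ∷ [])) t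
... | a , ta with any₃-sound (λ b → any₃ λ c → p (a ∷ b ∷ c ∷ [])) ta
... | b , tb with any₃-sound (λ c → p (a ∷ b ∷ c ∷ [])) tb
... | c , tc = a ∷ b ∷ c ∷ [] , tc

elemᵛ : V₃ → List V₃ → Bool
elemᵛ x []       = false
elemᵛ x (y ∷ ys) = (x ==ᵛ y) ∨ elemᵛ x ys

elemᵛ-sound : ∀ x ys → T (elemᵛ x ys) → x ∈ ys
elemᵛ-sound x (y ∷ ys) t with T-∨₁ {x ==ᵛ y} t
... | inj₁ t₁ = here (==ᵛ-sound x y t₁)
... | inj₂ t₂ = there (elemᵛ-sound x ys t₂)

zeroᵛ e₁ᵛ e₂ᵛ : V₃
zeroᵛ = 0₃ ∷ 0₃ ∷ 0₃ ∷ []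
e₁ᵛ = 1₃ ∷ 0₃ ∷ 0₃ ∷ []
e₂ᵛ = 0₃ ∷ 1₃ ∷ 0₃ ∷ []

-- Linear changes of coordinates

-- Additivity is linearity over F₃, where every scalar multiple is a repeated sum. Injectivity
-- carries distinctness of sums forward and membership in lists back.
record Linear (f : V₃ → V₃) : Set where
  field
    homo : ∀ x y → f (x +₃ y) ≡ f x +₃ f y
    inj  : ∀ {x y} → f x ≡ f y → x ≡ y

⊕₃-selfdouble : ∀ x → x ≡ x ⊕₃ x → x ≡ 0₃
⊕₃-selfdouble 0₃ _ = refl

idempotent⇒zero : ∀ x → x ≡ x +₃ x → x ≡ zeroᵛ
idempotent⇒zero (a ∷ b ∷ c ∷ []) eq =
  pointwise (⊕₃-selfdouble a (cong V.head eq)) (⊕₃-selfdouble b (cong (V.head ∘ V.tail) eq)) (⊕₃-selfdouble c (cong (V.head ∘ V.tail ∘ V.tail) eq))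

Linear-zero : ∀ {f} → Linear f → f zeroᵛ ≡ zeroᵛ
Linear-zero {f} L = idempotent⇒zero (f zeroᵛ) (Linear.homo L zeroᵛ zeroᵛ)

dot₃ : V₃ → V₃ → F₃
dot₃ (a ∷ b ∷ c ∷ []) (x ∷ y ∷ z ∷ []) = (a ⊗₃ x) ⊕₃ ((b ⊗₃ y) ⊕₃ (c ⊗₃ z))

rows : V₃ → V₃ → V₃ → V₃ → V₃
rows p q r x = dot₃ p x ∷ dot₃ q x ∷ dot₃ r x ∷ []

⊕₃-interchange : ∀ a b c d → (a ⊕₃ b) ⊕₃ (c ⊕₃ d) ≡ (a ⊕₃ c) ⊕₃ (b ⊕₃ d)
⊕₃-interchange a b c d = ==₃-sound _ _
  (all₃-sound (law a b c) (all₃-sound (λ c → all₃ (law a b c)) (all₃-sound (λ b → all₃ λ c → all₃ (law a b c))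
    (all₃-sound (λ a → all₃ λ b → all₃ λ c → all₃ (law a b c)) tt a) b) c) d)
  where
  law : F₃ → F₃ → F₃ → F₃ → Bool
  law a b c d = ((a ⊕₃ b) ⊕₃ (c ⊕₃ d)) ==₃ ((a ⊕₃ c) ⊕₃ (b ⊕₃ d))

⊗₃-distribˡ : ∀ a b c → a ⊗₃ (b ⊕₃ c) ≡ (a ⊗₃ b) ⊕₃ (a ⊗₃ c)
⊗₃-distribˡ a b c = ==₃-sound _ _
  (all₃-sound (law a b) (all₃-sound (λ b → all₃ (law a b)) (all₃-sound (λ a → all₃ λ b → all₃ (law a b)) tt a) b) c)
  where
  law : F₃ → F₃ → F₃ → Bool
  law a b c = (a ⊗₃ (b ⊕₃ c)) ==₃ ((a ⊗₃ b) ⊕₃ (a ⊗₃ c))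

dot₃-homo : ∀ p x y → dot₃ p (x +₃ y) ≡ dot₃ p x ⊕₃ dot₃ p y
dot₃-homo (a ∷ b ∷ c ∷ []) (x ∷ y ∷ z ∷ []) (x′ ∷ y′ ∷ z′ ∷ [])
  rewrite ⊗₃-distribˡ a x x′ | ⊗₃-distribˡ b y y′ | ⊗₃-distribˡ c z z′
        | ⊕₃-interchange (b ⊗₃ y) (b ⊗₃ y′) (c ⊗₃ z) (c ⊗₃ z′)
  = ⊕₃-interchange (a ⊗₃ x) (a ⊗₃ x′) ((b ⊗₃ y) ⊕₃ (c ⊗₃ z)) ((b ⊗₃ y′) ⊕₃ (c ⊗₃ z′))

rows-homo : ∀ p q r x y → rows p q r (x +₃ y) ≡ rows p q r x +₃ rows p q r y
rows-homo p q r x y = pointwise (dot₃-homo p x y) (dot₃-homo q x y) (dot₃-homo r x y)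

kernelTrivialAt : V₃ → V₃ → V₃ → V₃ → Bool
kernelTrivialAt p q r x = not (rows p q r x ==ᵛ zeroᵛ) ∨ (x ==ᵛ zeroᵛ)

injectiveRows : V₃ → V₃ → V₃ → Bool
injectiveRows p q r = allᵛ (kernelTrivialAt p q r)

T-⇒ : ∀ {x y} → T (not x ∨ y) → T x → T y
T-⇒ {true} t _ = t

-- Adding `y` twice subtracts it, so the hypothesis reads `x - y = 0`. In this form a trivial kernel
-- yields injectivity in `rows-linear`.
+₃-cancel : ∀ x y → x +₃ (y +₃ y) ≡ zeroᵛ → x ≡ y
+₃-cancel x y eq = ==ᵛ-sound x y (T-⇒ {(x +₃ (y +₃ y)) ==ᵛ zeroᵛ}
  (allᵛ-sound (law x) (allᵛ-sound (λ x → allᵛ (law x)) tt x) y)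
  (subst (λ z → T (z ==ᵛ zeroᵛ)) (sym eq) tt))
  where
  law : V₃ → V₃ → Bool
  law x y = not ((x +₃ (y +₃ y)) ==ᵛ zeroᵛ) ∨ (x ==ᵛ y)

+₃-triple : ∀ x → x +₃ (x +₃ x) ≡ zeroᵛ
+₃-triple x = ==ᵛ-sound _ _ (allᵛ-sound (λ x → (x +₃ (x +₃ x)) ==ᵛ zeroᵛ) tt x)

rows-linear : ∀ p q r → T (injectiveRows p q r) → Linear (rows p q r)
rows-linear p q r t = record
  { homo = rows-homo p q r
  ; inj  = λ {x} {y} eq → +₃-cancel x y (kernel (x +₃ (y +₃ y)) (begin
      f (x +₃ (y +₃ y)) ≡⟨ trans (rows-homo p q r x (y +₃ y)) (cong (f x +₃_) (rows-homo p q r y y)) ⟩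
      f x +₃ (f y +₃ f y) ≡⟨ cong (_+₃ (f y +₃ f y)) eq ⟩
      f y +₃ (f y +₃ f y) ≡⟨ +₃-triple (f y) ⟩
      zeroᵛ ∎)) }
  where
  open ≡-Reasoning
  f = rows p q r
  kernel : ∀ x → f x ≡ zeroᵛ → x ≡ zeroᵛ
  kernel x eq = ==ᵛ-sound x zeroᵛ (T-⇒ {f x ==ᵛ zeroᵛ} (allᵛ-sound (kernelTrivialAt p q r) t x)
    (subst (λ z → T (z ==ᵛ zeroᵛ)) (sym eq) tt))

-- Linear independence over F₃: the nonzero scalars are 1 and -1, so it suffices that `u`, `v`,
-- `u - v` and `u + v` are all nonzero.
independent : V₃ → V₃ → Bool
independent u v = not (elemᵛ u (zeroᵛ ∷ v ∷ [])) ∧ not (elemᵛ zeroᵛ (v ∷ (u +₃ v) ∷ []))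

sends : V₃ → V₃ → F₃ → V₃ → F₃ → Bool
sends p u a v b = (dot₃ p u ==₃ a) ∧ (dot₃ p v ==₃ b)

-- The rows of a matrix taking `u`, `v` to `e₁ᵛ`, `e₂ᵛ` are sought one at a time. Each is tested
-- against its prescribed values before the next is chosen, which keeps the check over all pairs
-- small.
row₃ : V₃ → V₃ → V₃ → V₃ → V₃ → Bool
row₃ u v p q r = sends r u 0₃ v 0₃ ∧ injectiveRows p q r

row₂ : V₃ → V₃ → V₃ → V₃ → Bool
row₂ u v p q = sends q u 0₃ v 1₃ ∧ anyᵛ (row₃ u v p q)

row₁ : V₃ → V₃ → V₃ → Bool
row₁ u v p = sends p u 1₃ v 0₃ ∧ anyᵛ (row₂ u v p)

normalisable₁ : V₃ → V₃ → Bool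
normalisable₁ u v = not (independent u v) ∨ anyᵛ (row₁ u v)

normalisable : V₃ → Bool
normalisable u = allᵛ (normalisable₁ u)

-- Stated with _≡ true because T is much slower to evaluate.
all-normalisable : allᵛ normalisable ≡ true
all-normalisable = refl

abstract
  -- An independent pair extends to a basis, and the automorphism is found by search over its rows.
  -- The block is abstract so that this search never unfolds in later goals.
  normalise : ∀ u v → T (independent u v) → Σ (V₃ → V₃) λ f → Linear f × f u ≡ e₁ᵛ × f v ≡ e₂ᵛ
  normalise u v ind = first (anyᵛ-sound (row₁ u v) (T-⇒ {independent u v}
      (allᵛ-sound (normalisable₁ u) (allᵛ-sound normalisable (T-true all-normalisable) u) v) ind))
    where
    Goal : Set
    Goal = Σ (V₃ → V₃) λ f → Linear f × f u ≡ e₁ᵛ × f v ≡ e₂ᵛ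

    sent : ∀ p a b → T (sends p u a v b) → dot₃ p u ≡ a × dot₃ p v ≡ b
    sent p a b t = ==₃-sound _ _ (proj₁ (T-∧₁ {dot₃ p u ==₃ a} t)) , ==₃-sound _ _ (proj₂ (T-∧₁ {dot₃ p u ==₃ a} t))

    finish : ∀ p q r → T (injectiveRows p q r) → dot₃ p u ≡ 1₃ × dot₃ p v ≡ 0₃ →
             dot₃ q u ≡ 0₃ × dot₃ q v ≡ 1₃ → dot₃ r u ≡ 0₃ × dot₃ r v ≡ 0₃ → Goal
    finish p q r inj (pu , pv) (qu , qv) (ru , rv) = rows p q r , rows-linear p q r inj
      , pointwise pu qu ru
      , pointwise pv qv rv

    third-point : ∀ p q → dot₃ p u ≡ 1₃ × dot₃ p v ≡ 0₃ → dot₃ q u ≡ 0₃ × dot₃ q v ≡ 1₃ →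
            (∃ λ r → T (row₃ u v p q r)) → Goal
    third-point p q p-ok q-ok (r , t) = finish p q r (proj₂ (T-∧₁ {sends r u 0₃ v 0₃} t)) p-ok q-ok
      (sent r 0₃ 0₃ (proj₁ (T-∧₁ {sends r u 0₃ v 0₃} t)))

    second : ∀ p → dot₃ p u ≡ 1₃ × dot₃ p v ≡ 0₃ → (∃ λ q → T (row₂ u v p q)) → Goal
    second p p-ok (q , t) = third-point p q p-ok (sent q 0₃ 1₃ (proj₁ (T-∧₁ {sends q u 0₃ v 1₃} t)))
      (anyᵛ-sound (row₃ u v p q) (proj₂ (T-∧₁ {sends q u 0₃ v 1₃} t)))

    first : (∃ λ p → T (row₁ u v p)) → Goal
    first (p , t) = second p (sent p 1₃ 0₃ (proj₁ (T-∧₁ {sends p u 1₃ v 0₃} t)))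
      (anyᵛ-sound (row₂ u v p) (proj₂ (T-∧₁ {sends p u 1₃ v 0₃} t)))

-- A summand is taken from the first set, from the second one, or belongs to both.
data Side : Set where
  left right both : Side

compatible : Side → Side → Bool
compatible both  _     = true
compatible _     both  = true
compatible left  right = true
compatible right left  = true
compatible _     _     = false

-- Lists of labelled sums and the exhaustive search

module _ {E S : Set} (_∙_ : E → E → S) where

  addSums : Side → E → List (Side × E) → List S → List S
  addSums k x [] seen = seen
  addSums k x ((l , y) ∷ ys) seen with compatible k l
  ... | true  = addSums k x ys ((x ∙ y) ∷ seen)
  ... | false = addSums k x ys seen

  -- Each point is paired with the earlier ones and with itself, so every unordered pair is met
  -- once; `compatible` admits a double only for a point labelled `both`.
  sums : List (Side × E) → List (Side × E) → List S → List S
  sums [] old seen = seen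
  sums ((k , x) ∷ new) old seen = sums new ((k , x) ∷ old) (addSums k x ((k , x) ∷ old) seen)

module _ {E S E′ S′ : Set} {_∙_ : E → E → S} {_∙′_ : E′ → E′ → S′} (f : E → E′) (g : S → S′)
         (homo : ∀ x y → g (x ∙ y) ≡ f x ∙′ f y) where

  addSums-natural : ∀ k x ys seen →
    map g (addSums _∙_ k x ys seen) ≡ addSums _∙′_ k (f x) (map (map₂ f) ys) (map g seen)
  addSums-natural k x [] seen = refl
  addSums-natural k x ((l , y) ∷ ys) seen with compatible k l
  ... | true  = trans (addSums-natural k x ys (x ∙ y ∷ seen))
                  (cong (λ s → addSums _∙′_ k (f x) (map (map₂ f) ys) (s ∷ map g seen)) (homo x y))
  ... | false = addSums-natural k x ys seen

  -- Which pairs are added depends on the labels alone. This serves both for reduction modulo 3 and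
  -- for changes of coordinates.
  sums-natural : ∀ new old seen →
    map g (sums _∙_ new old seen) ≡ sums _∙′_ (map (map₂ f) new) (map (map₂ f) old) (map g seen)
  sums-natural [] old seen = refl
  sums-natural ((k , x) ∷ new) old seen =
    trans (sums-natural new ((k , x) ∷ old) (addSums _∙_ k x ((k , x) ∷ old) seen))
      (cong (sums _∙′_ (map (map₂ f) new) (map (map₂ f) ((k , x) ∷ old)))
        (addSums-natural k x ((k , x) ∷ old) seen))

module _ {E S : Set} {_∙_ : E → E → S} {P : S → Set} {M : Side → E → Set}
         (closed : ∀ {k x l y} → M k x → M l y → T (compatible k l) → P (x ∙ y)) where

  addSums-All : ∀ {k x ys seen} → M k x → All (λ (l , y) → M l y) ys → All P seen →
                All P (addSums _∙_ k x ys seen)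
  addSums-All mx [] ps = ps
  addSums-All {k} {x} {(l , y) ∷ ys} mx (my ∷ mys) ps with compatible k l | closed {k} {x} {l} {y} mx my
  ... | true  | c = addSums-All mx mys (c tt ∷ ps)
  ... | false | _ = addSums-All mx mys ps

  sums-All : ∀ {new old seen} → All (λ (l , y) → M l y) new → All (λ (l , y) → M l y) old → All P seen →
             All P (sums _∙_ new old seen)
  sums-All [] mo ps = ps
  sums-All (mx ∷ mn) mo ps = sums-All mn (mx ∷ mo) (addSums-All mx (mx ∷ mo) ps)

mutual
  -- true if every choice of the remaining summands makes two of the sums coincide
  search : List Side → List (Side × V₃) → List V₃ → Bool
  search [] old seen = false
  search (k ∷ ks) old seen = allᵛ (λ x → extend ks k x ((k , x) ∷ old) ((k , x) ∷ old) seen)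

  -- Follows `addSums`, but stops at the first repeated sum, so that a bad partial choice is not
  -- extended further.
  extend : List Side → Side → V₃ → List (Side × V₃) → List (Side × V₃) → List V₃ → Bool
  extend ks k x old [] seen = search ks old seen
  extend ks k x old ((l , y) ∷ ys) seen =
    if compatible k l then extendBy ks k x old ys seen (x +₃ y) else extend ks k x old ys seen

  extendBy : List Side → Side → V₃ → List (Side × V₃) → List (Side × V₃) → List V₃ → V₃ → Bool
  extendBy ks k x old ys seen s = elemᵛ s seen ∨ extend ks k x old ys (s ∷ seen)

addSums-seen : ∀ k x ys seen → Unique (addSums _+₃_ k x ys seen) → Unique seen
addSums-seen k x [] seen u = u
addSums-seen k x ((l , y) ∷ ys) seen u with compatible k l
... | true with addSums-seen k x ys _ u
...   | _ ∷ u′ = u′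
addSums-seen k x ((l , y) ∷ ys) seen u | false = addSums-seen k x ys seen u

sums-seen : ∀ new old seen → Unique (sums _+₃_ new old seen) → Unique seen
sums-seen [] old seen u = u
sums-seen ((k , x) ∷ new) old seen u =
  addSums-seen k x ((k , x) ∷ old) seen (sums-seen new ((k , x) ∷ old) _ u)

mutual
  -- Sums are only ever prepended to `seen`, so a repetition met on the way persists in the complete
  -- list.
  search-sound : ∀ new old seen → T (search (map proj₁ new) old seen) → ¬ Unique (sums _+₃_ new old seen)
  search-sound ((k , x) ∷ new) old seen t u =
    extend-sound k x new ((k , x) ∷ old) ((k , x) ∷ old) seen
      (allᵛ-sound (λ x → extend (map proj₁ new) k x ((k , x) ∷ old) ((k , x) ∷ old) seen) t x) u

  extend-sound : ∀ k x new old ys seen → T (extend (map proj₁ new) k x old ys seen) →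
                 ¬ Unique (sums _+₃_ new old (addSums _+₃_ k x ys seen))
  extend-sound k x new old [] seen t u = search-sound new old seen t u
  extend-sound k x new old ((l , y) ∷ ys) seen t u with compatible k l
  ... | false = extend-sound k x new old ys seen t u
  ... | true  = extendBy-sound k x new old ys seen (x +₃ y) t u

  extendBy-sound : ∀ k x new old ys seen s → T (extendBy (map proj₁ new) k x old ys seen s) →
                   ¬ Unique (sums _+₃_ new old (addSums _+₃_ k x ys (s ∷ seen)))
  extendBy-sound k x new old ys seen s t u = split (T-∨₁ {elemᵛ s seen} t)
    where
    split : T (elemᵛ s seen) ⊎ T (extend (map proj₁ new) k x old ys (s ∷ seen)) → ⊥
    split (inj₂ t₂) = extend-sound k x new old ys (s ∷ seen) t₂ u
    split (inj₁ t₁) with addSums-seen k x ys (s ∷ seen) (sums-seen new old _ u)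
    ... | s∉seen ∷ _ = All.lookup s∉seen (elemᵛ-sound s seen t₁) refl

-- The searches excluding fewer than five common points

Unique-map : ∀ {f : V₃ → V₃} → Linear f → ∀ {xs} → Unique xs → Unique (map f xs)
Unique-map L = Uniqueₚ.map⁺ (Linear.inj L)

-- The collisions of sums survive a change of coordinates, so it is enough to search
-- through configurations containing e₁ and e₂.
no-configuration : ∀ ks (prefix : V₃ → V₃ → List (Side × V₃)) →
  (∀ {f} → Linear f → ∀ u v → map (map₂ f) (prefix u v) ≡ prefix (f u) (f v)) →
  (∀ new → map proj₁ new ≡ ks → ¬ Unique (sums _+₃_ (prefix e₁ᵛ e₂ᵛ ++ new) [] [])) →
  ∀ u v new → T (independent u v) → map proj₁ new ≡ ks → ¬ Unique (sums _+₃_ (prefix u v ++ new) [] [])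
no-configuration ks prefix prefix-natural closed u v new ind new-kinds uniq = go (normalise u v ind)
  where
  open ≡-Reasoning
  go : (Σ (V₃ → V₃) λ f → Linear f × f u ≡ e₁ᵛ × f v ≡ e₂ᵛ) → ⊥
  go (f , L , fu , fv) = closed new′ (trans kinds new-kinds) (subst Unique (begin
      map f (sums _+₃_ (prefix u v ++ new) [] []) ≡⟨ sums-natural f f (Linear.homo L) (prefix u v ++ new) [] [] ⟩
      sums _+₃_ (map (map₂ f) (prefix u v ++ new)) [] [] ≡⟨ cong (λ l → sums _+₃_ l [] []) (Listₚ.map-++ (map₂ f) (prefix u v) new) ⟩
      sums _+₃_ (map (map₂ f) (prefix u v) ++ new′) [] [] ≡⟨ cong (λ l → sums _+₃_ (l ++ new′) [] []) (prefix-natural L u v) ⟩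
      sums _+₃_ (prefix (f u) (f v) ++ new′) [] [] ≡⟨ cong₂ (λ u v → sums _+₃_ (prefix u v ++ new′) [] []) fu fv ⟩
      sums _+₃_ (prefix e₁ᵛ e₂ᵛ ++ new′) [] [] ∎)
      (Unique-map L uniq))
    where
    new′ = map (map₂ f) new
    kinds : map proj₁ new′ ≡ map proj₁ new
    kinds = trans (sym (Listₚ.map-∘ new)) (Listₚ.map-cong (λ _ → refl) new)

-- In `disjointPrefix` the two zeros are different labelled points, because the two sets are
-- translated independently of each other. In the other two prefixes the points labelled `both` are
-- genuinely common.
disjointPrefix twoPrefix commonPrefix : V₃ → V₃ → List (Side × V₃)
disjointPrefix u v = (left , zeroᵛ) ∷ (right , zeroᵛ) ∷ (left , u) ∷ (right , v) ∷ []
twoPrefix      u v = (both , zeroᵛ) ∷ (both , u) ∷ (left , v) ∷ []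
commonPrefix   u v = (both , zeroᵛ) ∷ (both , u) ∷ (both , v) ∷ []

-- The labels that complete the prefix to five points on either side; the index counts the common
-- points. Alternating the sides in `kinds₀` makes cross sums, and hence collisions, appear early.
kinds₀ kinds₂ kinds₃ kinds₄ : List Side
kinds₀ = left ∷ right ∷ left ∷ right ∷ left ∷ right ∷ []
kinds₂ = left ∷ left ∷ right ∷ right ∷ right ∷ []
kinds₃ = left ∷ left ∷ right ∷ right ∷ []
kinds₄ = both ∷ left ∷ right ∷ []

-- The normalised prefixes in the order in which `sums` leaves them, latest point first.
old₀ old₂ old₃ : List (Side × V₃)
old₀ = (right , e₂ᵛ) ∷ (left , e₁ᵛ) ∷ (right , zeroᵛ) ∷ (left , zeroᵛ) ∷ []
old₂ = (left , e₂ᵛ) ∷ (both , e₁ᵛ) ∷ (both , zeroᵛ) ∷ []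
old₃ = (both , e₂ᵛ) ∷ (both , e₁ᵛ) ∷ (both , zeroᵛ) ∷ []

seen₀ seen₂ seen₃ : List V₃
seen₀ = sums _+₃_ (disjointPrefix e₁ᵛ e₂ᵛ) [] []
seen₂ = sums _+₃_ (twoPrefix e₁ᵛ e₂ᵛ) [] []
seen₃ = sums _+₃_ (commonPrefix e₁ᵛ e₂ᵛ) [] []

search₀ : search kinds₀ old₀ seen₀ ≡ true
search₀ = refl

search₂ : search kinds₂ old₂ seen₂ ≡ true
search₂ = refl

search₃ : search kinds₃ old₃ seen₃ ≡ true
search₃ = refl

search₄ : search kinds₄ old₃ seen₃ ≡ true
search₄ = refl

exhausted : ∀ ks old seen → search ks old seen ≡ true → ∀ new → map proj₁ new ≡ ks → ¬ Unique (sums _+₃_ new old seen)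
exhausted ks old seen eq new refl = search-sound new old seen (T-true eq)

no-coincidence-free : ∀ u v new → T (independent u v) → map proj₁ new ≡ kinds₀ →
              ¬ Unique (sums _+₃_ (disjointPrefix u v ++ new) [] [])
no-coincidence-free = no-configuration kinds₀ disjointPrefix
  (λ {f} L u v → cong (λ z → (left , z) ∷ (right , z) ∷ (left , f u) ∷ (right , f v) ∷ []) (Linear-zero L))
  (exhausted kinds₀ old₀ seen₀ search₀)

no-two-common : ∀ u v new → T (independent u v) → map proj₁ new ≡ kinds₂ →
         ¬ Unique (sums _+₃_ (twoPrefix u v ++ new) [] [])
no-two-common = no-configuration kinds₂ twoPrefix
  (λ {f} L u v → cong (λ z → (both , z) ∷ (both , f u) ∷ (left , f v) ∷ []) (Linear-zero L))
  (exhausted kinds₂ old₂ seen₂ search₂)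

common-natural : ∀ {f} → Linear f → ∀ u v → map (map₂ f) (commonPrefix u v) ≡ commonPrefix (f u) (f v)
common-natural {f} L u v = cong (λ z → (both , z) ∷ (both , f u) ∷ (both , f v) ∷ []) (Linear-zero L)

no-three-common : ∀ u v new → T (independent u v) → map proj₁ new ≡ kinds₃ →
           ¬ Unique (sums _+₃_ (commonPrefix u v ++ new) [] [])
no-three-common = no-configuration kinds₃ commonPrefix common-natural (exhausted kinds₃ old₃ seen₃ search₃)

no-four-common : ∀ u v new → T (independent u v) → map proj₁ new ≡ kinds₄ →
          ¬ Unique (sums _+₃_ (commonPrefix u v ++ new) [] [])
no-four-common = no-configuration kinds₄ commonPrefix common-natural (exhausted kinds₄ old₃ seen₃ search₄)

-- Pair sums of five points in F₃³

repeats : List V₃ → Bool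
repeats []       = false
repeats (x ∷ xs) = elemᵛ x xs ∨ repeats xs

repeats-sound : ∀ xs → T (repeats xs) → ¬ Unique xs
repeats-sound (x ∷ xs) t (x∉ ∷ u) with T-∨₁ {elemᵛ x xs} t
... | inj₁ t₁ = All.lookup x∉ (elemᵛ-sound x xs t₁) refl
... | inj₂ t₂ = repeats-sound xs t₂ u

∈-map-inj : ∀ {f : V₃ → V₃} → Linear f → ∀ {x xs} → f x ∈ map f xs → x ∈ xs
∈-map-inj {f} L {xs = xs} p with ∈ₚ.∈-map⁻ f p
... | y , y∈ , eq = subst (_∈ xs) (sym (Linear.inj L eq)) y∈

simplex : {E : Set} → E → E → E → E → E → List (Side × E)
simplex z u v w x = (both , z) ∷ (both , u) ∷ (both , v) ∷ (both , w) ∷ (both , x) ∷ []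

-- Every label is `both`, so these are the fifteen sums of two of the five points, doubles included.
simplexSums : V₃ → V₃ → V₃ → V₃ → List V₃
simplexSums u v w x = sums _+₃_ (simplex zeroᵛ u v w x) [] []

map-simplexSums : ∀ {f} → Linear f → ∀ u v w x → map f (simplexSums u v w x) ≡ simplexSums (f u) (f v) (f w) (f x)
map-simplexSums {f} L u v w x = trans (sums-natural {_∙_ = _+₃_} {_∙′_ = _+₃_} f f (Linear.homo L) (simplex zeroᵛ u v w x) [] [])
  (cong (λ z → sums _+₃_ (simplex z (f u) (f v) (f w) (f x)) [] []) (Linear-zero L))

Unique-simplexSums : ∀ {f} → Linear f → ∀ {u v w x} → Unique (simplexSums u v w x) →
                     Unique (simplexSums (f u) (f v) (f w) (f x))
Unique-simplexSums L {u} {v} {w} {x} uniq = subst Unique (map-simplexSums L u v w x) (Unique-map L uniq)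

-- half of u + v + w + x, since 2 is its own inverse modulo 3
centre : V₃ → V₃ → V₃ → V₃ → V₃
centre u v w x = (u +₃ (v +₃ (w +₃ x))) +₃ (u +₃ (v +₃ (w +₃ x)))

centreOK : V₃ → V₃ → Bool
centreOK w x = repeats (simplexSums e₁ᵛ e₂ᵛ w x) ∨ elemᵛ (centre e₁ᵛ e₂ᵛ w x) (zeroᵛ ∷ e₁ᵛ ∷ e₂ᵛ ∷ w ∷ x ∷ [])

centresOK : V₃ → Bool
centresOK w = allᵛ (centreOK w)

all-centresOK : allᵛ centresOK ≡ true
all-centresOK = refl

centre-homo : ∀ {f} → Linear f → ∀ u v w x → f (centre u v w x) ≡ centre (f u) (f v) (f w) (f x)
centre-homo {f} L u v w x = trans (homo _ _) (cong (λ z → z +₃ z)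
  (trans (homo _ _) (cong (f u +₃_) (trans (homo _ _) (cong (f v +₃_) (homo w x))))))
  where open Linear L

abstract
  -- The table covers `u = e₁ᵛ`, `v = e₂ᵛ` and arbitrary `w`, `x`. Its alternative, a repeated sum,
  -- contradicts `uniq`; the membership is pulled back through the injective map `f`.
  centre-residue : ∀ u v w x → T (independent u v) → Unique (simplexSums u v w x) →
                   centre u v w x ∈ zeroᵛ ∷ u ∷ v ∷ w ∷ x ∷ []
  centre-residue u v w x ind uniq = go (normalise u v ind)
    where
    go : (Σ (V₃ → V₃) λ f → Linear f × f u ≡ e₁ᵛ × f v ≡ e₂ᵛ) → centre u v w x ∈ zeroᵛ ∷ u ∷ v ∷ w ∷ x ∷ []
    go (f , L , fu , fv) = ∈-map-inj L (subst₂ _∈_ (sym (trans (centre-homo L u v w x) fuv)) list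
                             (pick (T-∨₁ {repeats (simplexSums e₁ᵛ e₂ᵛ (f w) (f x))}
                               (allᵛ-sound (centreOK (f w)) (allᵛ-sound centresOK (T-true all-centresOK) (f w)) (f x)))))
      where
      fuv : centre (f u) (f v) (f w) (f x) ≡ centre e₁ᵛ e₂ᵛ (f w) (f x)
      fuv = cong₂ (λ u v → centre u v (f w) (f x)) fu fv
      list : zeroᵛ ∷ e₁ᵛ ∷ e₂ᵛ ∷ f w ∷ f x ∷ [] ≡ map f (zeroᵛ ∷ u ∷ v ∷ w ∷ x ∷ [])
      list = cong₂ _∷_ (sym (Linear-zero L)) (cong₂ _∷_ (sym fu) (cong (_∷ f w ∷ f x ∷ []) (sym fv)))
      pick : T (repeats (simplexSums e₁ᵛ e₂ᵛ (f w) (f x))) ⊎ T (elemᵛ (centre e₁ᵛ e₂ᵛ (f w) (f x)) (zeroᵛ ∷ e₁ᵛ ∷ e₂ᵛ ∷ f w ∷ f x ∷ [])) →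
             centre e₁ᵛ e₂ᵛ (f w) (f x) ∈ zeroᵛ ∷ e₁ᵛ ∷ e₂ᵛ ∷ f w ∷ f x ∷ []
      pick (inj₁ t) = ⊥-elim (repeats-sound _ t (subst Unique
        (cong₂ (λ u v → simplexSums u v (f w) (f x)) fu fv) (Unique-simplexSums L uniq)))
      pick (inj₂ t) = elemᵛ-sound _ _ t

-- minus u + v + w, since 2 = - 1 modulo 3
opposite : V₃ → V₃ → V₃ → V₃
opposite u v w = (u +₃ (v +₃ w)) +₃ (u +₃ (v +₃ w))

opposite-homo : ∀ {f} → Linear f → ∀ u v w → f (opposite u v w) ≡ opposite (f u) (f v) (f w)
opposite-homo {f} L u v w = trans (homo _ _) (cong (λ z → z +₃ z) (trans (homo _ _) (cong (f u +₃_) (homo v w))))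
  where open Linear L

-- The pair sums of a simplex whose fourth vertex is forced by the condition that the vertices sum
-- to 0.
balancedSums : V₃ → V₃ → V₃ → List V₃
balancedSums u v w = simplexSums u v w (opposite u v w)

-- one of y, y - p and 2 y - p lies in L, where - p = 2 p modulo 3
Meets : List V₃ → V₃ → V₃ → Set
Meets L y p = y ∈ L ⊎ (y +₃ (p +₃ p)) ∈ L ⊎ ((y +₃ y) +₃ (p +₃ p)) ∈ L

meets : List V₃ → V₃ → V₃ → Bool
meets L y p = elemᵛ y L ∨ (elemᵛ (y +₃ (p +₃ p)) L ∨ elemᵛ ((y +₃ y) +₃ (p +₃ p)) L)

meets-sound : ∀ L y p → T (meets L y p) → Meets L y p
meets-sound L y p t with T-∨₁ {elemᵛ y L} t
... | inj₁ t₁ = inj₁ (elemᵛ-sound _ _ t₁)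
... | inj₂ t₂ with T-∨₁ {elemᵛ (y +₃ (p +₃ p)) L} t₂
... | inj₁ t₃ = inj₂ (inj₁ (elemᵛ-sound _ _ t₃))
... | inj₂ t₄ = inj₂ (inj₂ (elemᵛ-sound _ _ t₄))

Meets-reflect : ∀ {f} → Linear f → ∀ {L y p} → Meets (map f L) (f y) (f p) → Meets L y p
Meets-reflect {f} H {L} {y} {p} = Sum.map (∈-map-inj H) (Sum.map
  (λ m → ∈-map-inj H (subst (_∈ map f L) (sym (trans (homo y (p +₃ p)) (cong (f y +₃_) (homo p p)))) m))
  (λ m → ∈-map-inj H (subst (_∈ map f L) (sym (trans (homo (y +₃ y) (p +₃ p)) (cong₂ _+₃_ (homo y y) (homo p p)))) m)))
  where open Linear H

meetsAll : V₃ → V₃ → V₃ → V₃ → Bool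
meetsAll u v w y = meets (balancedSums u v w) y (u +₃ v) ∧ (meets (balancedSums u v w) y (u +₃ w)
                 ∧ meets (balancedSums u v w) y (v +₃ w))

balancedOK : V₃ → V₃ → Bool
balancedOK w y = repeats (balancedSums e₁ᵛ e₂ᵛ w) ∨ meetsAll e₁ᵛ e₂ᵛ w y

allBalancedOK : V₃ → Bool
allBalancedOK w = allᵛ (balancedOK w)

all-balancedOK : allᵛ allBalancedOK ≡ true
all-balancedOK = refl

MeetsAll : V₃ → V₃ → V₃ → V₃ → Set
MeetsAll u v w y = Meets (balancedSums u v w) y (u +₃ v) × Meets (balancedSums u v w) y (u +₃ w)
                 × Meets (balancedSums u v w) y (v +₃ w)

meetsAll-sound : ∀ u v w y → T (meetsAll u v w y) → MeetsAll u v w y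
meetsAll-sound u v w y t with T-∧₁ {meets (balancedSums u v w) y (u +₃ v)} t
... | t₁ , t₂₃ with T-∧₁ {meets (balancedSums u v w) y (u +₃ w)} t₂₃
... | t₂ , t₃ = meets-sound _ y (u +₃ v) t₁ , meets-sound _ y (u +₃ w) t₂ , meets-sound _ y (v +₃ w) t₃

abstract
  -- Read off from a table after normalising `u` and `v`. A pair containing the fourth vertex is
  -- minus the complementary pair and so has the same class modulo 2; the three pairs among `u`,
  -- `v`, `w` represent all such classes.
  meets-balanced : ∀ u v w y → T (independent u v) → Unique (balancedSums u v w) → MeetsAll u v w y
  meets-balanced u v w y ind uniq = go (normalise u v ind)
    where
    go : (Σ (V₃ → V₃) λ f → Linear f × f u ≡ e₁ᵛ × f v ≡ e₂ᵛ) → MeetsAll u v w y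
    go (f , L , fu , fv) = back (pick (T-∨₁ {repeats (balancedSums e₁ᵛ e₂ᵛ (f w))}
        (allᵛ-sound (balancedOK (f w)) (allᵛ-sound allBalancedOK (T-true all-balancedOK) (f w)) (f y))))
      where
      open Linear L
      images : map f (balancedSums u v w) ≡ balancedSums (f u) (f v) (f w)
      images = trans (map-simplexSums L u v w (opposite u v w))
                     (cong (simplexSums (f u) (f v) (f w)) (opposite-homo L u v w))
      pick : T (repeats (balancedSums e₁ᵛ e₂ᵛ (f w))) ⊎ T (meetsAll e₁ᵛ e₂ᵛ (f w) (f y)) → MeetsAll (f u) (f v) (f w) (f y)
      pick (inj₁ t) = ⊥-elim (repeats-sound _ t (subst Unique
        (trans images (cong₂ (λ u v → balancedSums u v (f w)) fu fv)) (Unique-map L uniq)))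
      pick (inj₂ t) = subst₂ (λ u v → MeetsAll u v (f w) (f y)) (sym fu) (sym fv) (meetsAll-sound _ _ _ _ t)
      reflect : ∀ a b → Meets (balancedSums (f u) (f v) (f w)) (f y) (f a +₃ f b) → Meets (balancedSums u v w) y (a +₃ b)
      reflect a b m = Meets-reflect L (subst₂ (λ l p → Meets l (f y) p) (sym images) (sym (homo a b)) m)
      back : MeetsAll (f u) (f v) (f w) (f y) → MeetsAll u v w y
      back (m₁ , m₂ , m₃) = reflect u v m₁ , reflect u w m₂ , reflect v w m₃

-- Residues modulo 2

V₂ : Set
V₂ = Vec Bool 3

_+₂_ : V₂ → V₂ → V₂
_+₂_ = V.zipWith _xor_

zero₂ : V₂
zero₂ = false ∷ false ∷ false ∷ []

_==ᵇ_ : Bool → Bool → Bool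
false ==ᵇ y = not y
true  ==ᵇ y = y

==ᵇ-sound : ∀ x y → T (x ==ᵇ y) → x ≡ y
==ᵇ-sound false false _ = refl
==ᵇ-sound true  true  _ = refl

_==₂_ : V₂ → V₂ → Bool
(a ∷ b ∷ c ∷ []) ==₂ (a′ ∷ b′ ∷ c′ ∷ []) = (a ==ᵇ a′) ∧ ((b ==ᵇ b′) ∧ (c ==ᵇ c′))

==₂-sound : ∀ x y → T (x ==₂ y) → x ≡ y
==₂-sound (a ∷ b ∷ c ∷ []) (a′ ∷ b′ ∷ c′ ∷ []) t with T-∧₁ {a ==ᵇ a′} t
... | t₁ , t₂ with T-∧₁ {b ==ᵇ b′} t₂
... | t₃ , t₄ = pointwise (==ᵇ-sound a a′ t₁) (==ᵇ-sound b b′ t₃) (==ᵇ-sound c c′ t₄)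

elem₂ : V₂ → List V₂ → Bool
elem₂ x []       = false
elem₂ x (y ∷ ys) = (x ==₂ y) ∨ elem₂ x ys

elem₂-sound : ∀ x ys → T (elem₂ x ys) → x ∈ ys
elem₂-sound x (y ∷ ys) t with T-∨₁ {x ==₂ y} t
... | inj₁ t₁ = here (==₂-sound x y t₁)
... | inj₂ t₂ = there (elem₂-sound x ys t₂)

allᵇ : (Bool → Bool) → Bool
allᵇ p = p false ∧ p true

allᵇ-sound : ∀ p → T (allᵇ p) → ∀ x → T (p x)
allᵇ-sound p t false = proj₁ (T-∧₁ {p false} t)
allᵇ-sound p t true  = proj₂ (T-∧₁ {p false} t)

all₂ : (V₂ → Bool) → Bool
all₂ p = allᵇ λ a → allᵇ λ b → allᵇ λ c → p (a ∷ b ∷ c ∷ [])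

all₂-sound : ∀ p → T (all₂ p) → ∀ x → T (p x)
all₂-sound p t (a ∷ b ∷ c ∷ []) =
  allᵇ-sound (λ c → p (a ∷ b ∷ c ∷ []))
    (allᵇ-sound (λ b → allᵇ λ c → p (a ∷ b ∷ c ∷ []))
      (allᵇ-sound (λ a → allᵇ λ b → allᵇ λ c → p (a ∷ b ∷ c ∷ [])) t a) b) c

-- Tuples with a repetition are passed over as soon as it occurs. The points accumulate in reverse,
-- which is why they are listed backwards where this test is applied.
allDistinct : ℕ → (List V₂ → Bool) → List V₂ → Bool
allDistinct zero    p xs = p xs
allDistinct (suc n) p xs = all₂ (λ x → elem₂ x xs ∨ allDistinct n p (x ∷ xs))

allDistinct-sound : ∀ p n xs → T (allDistinct n p xs) → ∀ (ys : Vec V₂ n) → Unique (V.foldl (λ _ → List V₂) (λ l y → y ∷ l) xs ys) →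
                    T (p (V.foldl (λ _ → List V₂) (λ l y → y ∷ l) xs ys))
allDistinct-sound p zero    xs t []       u = t
allDistinct-sound p (suc n) xs t (y ∷ ys) u = next (T-∨₁ {elem₂ y xs} (all₂-sound (λ x → elem₂ x xs ∨ allDistinct n p (x ∷ xs)) t y))
  where
  tail-unique : ∀ {n} zs (ys : Vec V₂ n) → Unique (V.foldl (λ _ → List V₂) (λ l y → y ∷ l) zs ys) → Unique zs
  tail-unique zs []       u = u
  tail-unique zs (y ∷ ys) u with tail-unique (y ∷ zs) ys u
  ... | _ ∷ u′ = u′
  next : T (elem₂ y xs) ⊎ T (allDistinct n p (y ∷ xs)) → T (p (V.foldl (λ _ → List V₂) (λ l y → y ∷ l) (y ∷ xs) ys))
  next (inj₂ t₂) = allDistinct-sound p n (y ∷ xs) t₂ ys u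
  next (inj₁ t₁) with tail-unique (y ∷ xs) ys u
  ... | y∉ ∷ _ = ⊥-elim (All.lookup y∉ (elem₂-sound y xs t₁) refl)

total₂ : List V₂ → V₂
total₂ []       = zero₂
total₂ (x ∷ xs) = x +₂ total₂ xs

totalInside : List V₂ → Bool
totalInside xs = elem₂ (total₂ xs) xs

all-totalInside : allDistinct 5 totalInside [] ≡ true
all-totalInside = refl

-- Five distinct residues are a plane and one more point; the plane sums to zero.
total-inside : ∀ a b c d e → Unique (a ∷ b ∷ c ∷ d ∷ e ∷ []) → total₂ (a ∷ b ∷ c ∷ d ∷ e ∷ []) ∈ a ∷ b ∷ c ∷ d ∷ e ∷ []
total-inside a b c d e u = elem₂-sound _ _
  (allDistinct-sound totalInside 5 [] (T-true all-totalInside) (e ∷ d ∷ c ∷ b ∷ a ∷ []) u)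

classes : V₂ → V₂ → V₂ → V₂ → List V₂
classes u v w x = zero₂ ∷ u ∷ v ∷ w ∷ x ∷ (u +₂ v) ∷ (u +₂ w) ∷ (v +₂ w) ∷ []

det₂ : V₂ → V₂ → V₂ → Bool
det₂ (a ∷ b ∷ c ∷ []) (a′ ∷ b′ ∷ c′ ∷ []) (a″ ∷ b″ ∷ c″ ∷ []) =
  (a ∧ ((b′ ∧ c″) xor (c′ ∧ b″))) xor ((b ∧ ((c′ ∧ a″) xor (a′ ∧ c″))) xor (c ∧ ((a′ ∧ b″) xor (b′ ∧ a″))))

planeOK : V₂ → V₂ → V₂ → V₂ → Bool
planeOK u v w x = not ((u +₂ (v +₂ (w +₂ x))) ==₂ zero₂) ∨ (det₂ u v w ∧ all₂ (λ y → elem₂ y (classes u v w x)))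

planeOK′ : List V₂ → Bool
planeOK′ (x ∷ w ∷ v ∷ u ∷ _ ∷ []) = planeOK u v w x
planeOK′ _ = false

all-planeOK : allDistinct 4 planeOK′ (zero₂ ∷ []) ≡ true
all-planeOK = refl

-- Four distinct nonzero residues with sum 0 form an affine plane that misses 0. So `u`, `v`, `w` is
-- a basis and `x = u + v + w`, which leaves exactly the three pair sums as remaining residues.
plane : ∀ u v w x → Unique (x ∷ w ∷ v ∷ u ∷ zero₂ ∷ []) → u +₂ (v +₂ (w +₂ x)) ≡ zero₂ →
        det₂ u v w ≡ true × (∀ y → y ∈ classes u v w x)
plane u v w x uniq eq = ok (T-⇒ {(u +₂ (v +₂ (w +₂ x))) ==₂ zero₂}
    (allDistinct-sound planeOK′ 4 (zero₂ ∷ []) (T-true all-planeOK) (u ∷ v ∷ w ∷ x ∷ []) uniq)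
    (subst (λ z → T (z ==₂ zero₂)) (sym eq) tt))
  where
  true-T : ∀ {b} → T b → b ≡ true
  true-T {true} _ = refl
  ok : T (det₂ u v w ∧ all₂ (λ y → elem₂ y (classes u v w x))) → det₂ u v w ≡ true × (∀ y → y ∈ classes u v w x)
  ok t = true-T (proj₁ (T-∧₁ {det₂ u v w} t))
       , λ y → elem₂-sound y _ (all₂-sound (λ y → elem₂ y (classes u v w x)) (proj₂ (T-∧₁ {det₂ u v w} t)) y)

-- The embedding of ℤ into ℚ

ratᵘ : ∀ z → ℚ.toℚᵘ (z ℚ./ 1) ℚᵘ.≃ ℚᵘ.mkℚᵘ z 0
ratᵘ z = ℚₚ.toℚᵘ-fromℚᵘ (ℚᵘ.mkℚᵘ z 0)

/1-+ : ∀ x y → (x + y) ℚ./ 1 ≡ (x ℚ./ 1) ℚ.+ (y ℚ./ 1)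
/1-+ x y = ℚₚ.toℚᵘ-injective (begin
    ℚ.toℚᵘ ((x + y) ℚ./ 1) ≈⟨ ratᵘ (x + y) ⟩
    ℚᵘ.mkℚᵘ (x + y) 0 ≈⟨ ℚᵘ.*≡* (expand x y) ⟩
    ℚᵘ.mkℚᵘ x 0 ℚᵘ.+ ℚᵘ.mkℚᵘ y 0 ≈⟨ ℚᵘₚ.+-cong (ratᵘ x) (ratᵘ y) ⟨
    ℚ.toℚᵘ (x ℚ./ 1) ℚᵘ.+ ℚ.toℚᵘ (y ℚ./ 1) ≈⟨ ℚₚ.toℚᵘ-homo-+ (x ℚ./ 1) (y ℚ./ 1) ⟨
    ℚ.toℚᵘ ((x ℚ./ 1) ℚ.+ (y ℚ./ 1)) ∎)
  where
  open ℚᵘₚ.≃-Reasoning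
  expand : ∀ x y → (x + y) * + 1 ≡ (x * + 1 + y * + 1) * + 1
  expand = solve-∀

/1-* : ∀ x y → (x * y) ℚ./ 1 ≡ (x ℚ./ 1) ℚ.* (y ℚ./ 1)
/1-* x y = ℚₚ.toℚᵘ-injective (begin
    ℚ.toℚᵘ ((x * y) ℚ./ 1) ≈⟨ ratᵘ (x * y) ⟩
    ℚᵘ.mkℚᵘ x 0 ℚᵘ.* ℚᵘ.mkℚᵘ y 0 ≈⟨ ℚᵘₚ.*-cong (ratᵘ x) (ratᵘ y) ⟨
    ℚ.toℚᵘ (x ℚ./ 1) ℚᵘ.* ℚ.toℚᵘ (y ℚ./ 1) ≈⟨ ℚₚ.toℚᵘ-homo-* (x ℚ./ 1) (y ℚ./ 1) ⟨
    ℚ.toℚᵘ ((x ℚ./ 1) ℚ.* (y ℚ./ 1)) ∎)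
  where open ℚᵘₚ.≃-Reasoning

reciprocal : ℕ → ℚ
reciprocal k = + 1 ℚ./ suc k

*-reciprocal : ∀ k → (+ suc k ℚ./ 1) ℚ.* reciprocal k ≡ 1ℚ
*-reciprocal k = ℚₚ.toℚᵘ-injective (begin
    ℚ.toℚᵘ ((+ suc k ℚ./ 1) ℚ.* reciprocal k) ≈⟨ ℚₚ.toℚᵘ-homo-* (+ suc k ℚ./ 1) (reciprocal k) ⟩
    ℚ.toℚᵘ (+ suc k ℚ./ 1) ℚᵘ.* ℚ.toℚᵘ (reciprocal k) ≈⟨ ℚᵘₚ.*-cong (ratᵘ (+ suc k)) (ℚₚ.toℚᵘ-fromℚᵘ (ℚᵘ.mkℚᵘ (+ 1) k)) ⟩
    ℚᵘ.mkℚᵘ (+ suc k) 0 ℚᵘ.* ℚᵘ.mkℚᵘ (+ 1) k ≈⟨ ℚᵘ.*≡* (cancel k) ⟩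
    ℚ.toℚᵘ 1ℚ ∎)
  where
  open ℚᵘₚ.≃-Reasoning
  cancel : ∀ k → (+ suc k * + 1) * + 1 ≡ + 1 * (+ suc (k ℕ.+ 0))
  cancel k = trans (ℤₚ.*-identityʳ _) (trans (ℤₚ.*-identityʳ _)
    (sym (trans (ℤₚ.*-identityˡ _) (cong (λ n → + suc n) (ℕₚ.+-identityʳ k)))))

_·ᵖ_ : ℤ → Pt → Pt
n ·ᵖ x = V.map (n *_) x

toQ-+ : ∀ x y → toQ (x +ᵖ y) ≡ toQ x +q toQ y
toQ-+ (a ∷ b ∷ c ∷ []) (a′ ∷ b′ ∷ c′ ∷ []) = pointwise (/1-+ a a′) (/1-+ b b′) (/1-+ c c′)

toQ-· : ∀ n x → toQ (n ·ᵖ x) ≡ (n ℚ./ 1) ·q toQ x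
toQ-· n (a ∷ b ∷ c ∷ []) = pointwise (/1-* n a) (/1-* n b) (/1-* n c)

+q-assoc : ∀ x y z → (x +q y) +q z ≡ x +q (y +q z)
+q-assoc (a ∷ b ∷ c ∷ []) (a′ ∷ b′ ∷ c′ ∷ []) (a″ ∷ b″ ∷ c″ ∷ []) =
  pointwise (ℚₚ.+-assoc a a′ a″) (ℚₚ.+-assoc b b′ b″) (ℚₚ.+-assoc c c′ c″)

+q-comm : ∀ x y → x +q y ≡ y +q x
+q-comm (a ∷ b ∷ c ∷ []) (a′ ∷ b′ ∷ c′ ∷ []) = pointwise (ℚₚ.+-comm a a′) (ℚₚ.+-comm b b′) (ℚₚ.+-comm c c′)

+q-identityˡ : ∀ x → 0q +q x ≡ x
+q-identityˡ (a ∷ b ∷ c ∷ []) = pointwise (ℚₚ.+-identityˡ a) (ℚₚ.+-identityˡ b) (ℚₚ.+-identityˡ c)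

+q-identityʳ : ∀ x → x +q 0q ≡ x
+q-identityʳ x = trans (+q-comm x 0q) (+q-identityˡ x)

+q-interchange : ∀ w x y z → (w +q x) +q (y +q z) ≡ (w +q y) +q (x +q z)
+q-interchange w x y z = begin
  (w +q x) +q (y +q z) ≡⟨ +q-assoc w x (y +q z) ⟩
  w +q (x +q (y +q z)) ≡⟨ cong (w +q_) (trans (sym (+q-assoc x y z)) (trans (cong (_+q z) (+q-comm x y)) (+q-assoc y x z))) ⟩
  w +q (y +q (x +q z)) ≡⟨ +q-assoc w y (x +q z) ⟨
  (w +q y) +q (x +q z) ∎
  where open ≡-Reasoning

·q-distribˡ : ∀ r x y → r ·q (x +q y) ≡ (r ·q x) +q (r ·q y)
·q-distribˡ r (a ∷ b ∷ c ∷ []) (a′ ∷ b′ ∷ c′ ∷ []) =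
  pointwise (ℚₚ.*-distribˡ-+ r a a′) (ℚₚ.*-distribˡ-+ r b b′) (ℚₚ.*-distribˡ-+ r c c′)

·q-distribʳ : ∀ x r s → (r ℚ.+ s) ·q x ≡ (r ·q x) +q (s ·q x)
·q-distribʳ (a ∷ b ∷ c ∷ []) r s =
  pointwise (ℚₚ.*-distribʳ-+ a r s) (ℚₚ.*-distribʳ-+ b r s) (ℚₚ.*-distribʳ-+ c r s)

·q-assoc : ∀ r s x → (r ℚ.* s) ·q x ≡ r ·q (s ·q x)
·q-assoc r s (a ∷ b ∷ c ∷ []) = pointwise (ℚₚ.*-assoc r s a) (ℚₚ.*-assoc r s b) (ℚₚ.*-assoc r s c)

·q-zeroˡ : ∀ x → 0ℚ ·q x ≡ 0q
·q-zeroˡ (a ∷ b ∷ c ∷ []) = pointwise (ℚₚ.*-zeroˡ a) (ℚₚ.*-zeroˡ b) (ℚₚ.*-zeroˡ c)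

·q-zeroʳ : ∀ r → r ·q 0q ≡ 0q
·q-zeroʳ r = pointwise (ℚₚ.*-zeroʳ r) (ℚₚ.*-zeroʳ r) (ℚₚ.*-zeroʳ r)

·q-identityˡ : ∀ x → 1ℚ ·q x ≡ x
·q-identityˡ (a ∷ b ∷ c ∷ []) = pointwise (ℚₚ.*-identityˡ a) (ℚₚ.*-identityˡ b) (ℚₚ.*-identityˡ c)

-- Convex combinations

Weights : LPoly → List (ℚ × Pt) → Set
Weights P = All (λ w → (0ℚ ℚ.≤ proj₁ w) × (proj₂ w ∈ P))

-- Replacing the points by their images under `g` lets one argument serve nested combinations,
-- translations and affine maps.
comboOf : (Pt → QPt) → List (ℚ × Pt) → QPt
comboOf g []             = 0q
comboOf g ((c , p) ∷ ws) = (c ·q g p) +q comboOf g ws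

comboOf-toQ : ∀ ws → comboOf toQ ws ≡ combo ws
comboOf-toQ []             = refl
comboOf-toQ ((c , p) ∷ ws) = cong ((c ·q toQ p) +q_) (comboOf-toQ ws)

comboOf-+ : ∀ g y ws → comboOf (λ p → g p +q y) ws ≡ comboOf g ws +q (weights ws ·q y)
comboOf-+ g y []             = trans (sym (+q-identityˡ 0q)) (cong (0q +q_) (sym (·q-zeroˡ y)))
comboOf-+ g y ((c , p) ∷ ws) = begin
  (c ·q (g p +q y)) +q comboOf (λ p → g p +q y) ws ≡⟨ cong₂ _+q_ (·q-distribˡ c (g p) y) (comboOf-+ g y ws) ⟩
  ((c ·q g p) +q (c ·q y)) +q (comboOf g ws +q (weights ws ·q y)) ≡⟨ +q-interchange _ _ _ _ ⟩
  ((c ·q g p) +q comboOf g ws) +q ((c ·q y) +q (weights ws ·q y)) ≡⟨ cong (_ +q_) (·q-distribʳ y c (weights ws)) ⟨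
  ((c ·q g p) +q comboOf g ws) +q ((c ℚ.+ weights ws) ·q y) ∎
  where open ≡-Reasoning

scale : ℚ → List (ℚ × Pt) → List (ℚ × Pt)
scale c = map (λ (d , p) → c ℚ.* d , p)

weights-++ : ∀ us vs → weights (us ++ vs) ≡ weights us ℚ.+ weights vs
weights-++ []             vs = sym (ℚₚ.+-identityˡ _)
weights-++ ((c , p) ∷ us) vs = trans (cong (c ℚ.+_) (weights-++ us vs)) (sym (ℚₚ.+-assoc c (weights us) (weights vs)))

combo-++ : ∀ us vs → combo (us ++ vs) ≡ combo us +q combo vs
combo-++ []             vs = sym (+q-identityˡ _)
combo-++ ((c , p) ∷ us) vs = trans (cong ((c ·q toQ p) +q_) (combo-++ us vs)) (sym (+q-assoc (c ·q toQ p) (combo us) (combo vs)))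

weights-scale : ∀ c ws → weights (scale c ws) ≡ c ℚ.* weights ws
weights-scale c []             = sym (ℚₚ.*-zeroʳ c)
weights-scale c ((d , p) ∷ ws) = trans (cong (c ℚ.* d ℚ.+_) (weights-scale c ws)) (sym (ℚₚ.*-distribˡ-+ c d (weights ws)))

combo-scale : ∀ c ws → combo (scale c ws) ≡ c ·q combo ws
combo-scale c []             = sym (·q-zeroʳ c)
combo-scale c ((d , p) ∷ ws) = trans (cong₂ _+q_ (·q-assoc c d (toQ p)) (combo-scale c ws))
                                 (sym (·q-distribˡ c (d ·q toQ p) (combo ws)))

0≤* : ∀ {c d} → 0ℚ ℚ.≤ c → 0ℚ ℚ.≤ d → 0ℚ ℚ.≤ c ℚ.* d
0≤* {c} {d} 0≤c 0≤d = ℚₚ.nonNegative⁻¹ (c ℚ.* d) {{ℚₚ.nonNeg*nonNeg⇒nonNeg c {{ℚ.nonNegative 0≤c}} d {{ℚ.nonNegative 0≤d}}}}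

Weights-scale : ∀ {P c ws} → 0ℚ ℚ.≤ c → Weights P ws → Weights P (scale c ws)
Weights-scale 0≤c ws = Allₚ.map⁺ (All.map (λ (0≤d , p∈) → 0≤* 0≤c 0≤d , p∈) ws)

-- A combination of combinations is a combination: weights multiply. The total weight is left
-- arbitrary so that the induction on `ws` goes through.
flatten : ∀ {S} (g : Pt → QPt) ws → All (λ w → (0ℚ ℚ.≤ proj₁ w) × InConv S (g (proj₂ w))) ws →
          Σ (List (ℚ × Pt)) λ vs → Weights S vs × weights vs ≡ weights ws × combo vs ≡ comboOf g ws
flatten g [] [] = [] , [] , refl , refl
flatten g ((c , p) ∷ ws) ((0≤c , us , us-ok , us-1 , us-p) ∷ hs) with flatten g ws hs
... | vs , vs-ok , vs-w , vs-c = scale c us ++ vs , Allₚ.++⁺ (Weights-scale 0≤c us-ok) vs-ok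
  , trans (weights-++ (scale c us) vs) (cong₂ ℚ._+_
      (trans (weights-scale c us) (trans (cong (c ℚ.*_) us-1) (ℚₚ.*-identityʳ c))) vs-w)
  , trans (combo-++ (scale c us) vs) (cong₂ _+q_ (trans (combo-scale c us) (cong (c ·q_) us-p)) vs-c)

InConv-comboOf : ∀ {P S} (g : Pt → QPt) ws → (∀ {p} → p ∈ P → InConv S (g p)) → Weights P ws →
                 weights ws ≡ 1ℚ → InConv S (comboOf g ws)
InConv-comboOf g ws inS ok one with flatten g ws (All.map (λ (0≤c , p∈) → 0≤c , inS p∈) ok)
... | vs , vs-ok , vs-w , vs-c = vs , vs-ok , trans vs-w one , vs-c

InConv-hull : ∀ {P S} → (∀ {p} → p ∈ P → InConv S (toQ p)) → ∀ {x} → InConv P x → InConv S x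
InConv-hull inS (ws , ok , one , refl) = subst (InConv _) (comboOf-toQ ws) (InConv-comboOf toQ ws inS ok one)

InConv-generator : ∀ {P p} → p ∈ P → InConv P (toQ p)
InConv-generator {p = p} p∈ = (1ℚ , p) ∷ [] , (ℚₚ.nonNegative⁻¹ 1ℚ , p∈) ∷ [] , refl
  , trans (+q-identityʳ _) (·q-identityˡ (toQ p))

∈-⊕ : ∀ {P Q p q} → p ∈ P → q ∈ Q → (p +ᵖ q) ∈ P ⊕ Q
∈-⊕ {Q = Q} {p} p∈ q∈ = ∈ₚ.∈-concatMap⁺ (λ p → map (p +ᵖ_) Q) (Any.map (λ { refl → ∈ₚ.∈-map⁺ (p +ᵖ_) q∈ }) p∈)

-- Done one summand at a time: for a fixed generator of `P` the other point runs through the hull of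
-- `Q`, and then the generator is averaged with `y` fixed.
InConv-⊕ : ∀ {P Q x y} → InConv P x → InConv Q y → InConv (P ⊕ Q) (x +q y)
InConv-⊕ {P} {Q} {x} {y} (ws , ws-ok , ws-1 , ws-x) y∈ =
  subst (InConv (P ⊕ Q)) (sum toQ ws ws-1 (trans (comboOf-toQ ws) ws-x) y)
    (InConv-comboOf (λ p → toQ p +q y) ws (λ p∈ → vertex p∈ y∈) ws-ok ws-1)
  where
  sum : ∀ g ws → weights ws ≡ 1ℚ → ∀ {x} → comboOf g ws ≡ x → ∀ y → comboOf (λ p → g p +q y) ws ≡ x +q y
  sum g ws one refl y = trans (comboOf-+ g y ws) (cong (comboOf g ws +q_) (trans (cong (_·q y) one) (·q-identityˡ y)))
  vertex : ∀ {p y} → p ∈ P → InConv Q y → InConv (P ⊕ Q) (toQ p +q y)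
  vertex {p} {y} p∈ (vs , vs-ok , vs-1 , vs-y) =
    subst (InConv (P ⊕ Q)) (trans (sum toQ vs vs-1 (trans (comboOf-toQ vs) vs-y) (toQ p)) (+q-comm y (toQ p)))
      (InConv-comboOf (λ q → toQ q +q toQ p) vs
        (λ {q} q∈ → subst (InConv (P ⊕ Q)) (trans (toQ-+ p q) (+q-comm (toQ p) (toQ q))) (InConv-generator (∈-⊕ p∈ q∈)))
        vs-ok vs-1)

InConv-⊕ᵖ : ∀ {P Q a b} → InConv P (toQ a) → InConv Q (toQ b) → InConv (P ⊕ Q) (toQ (a +ᵖ b))
InConv-⊕ᵖ {a = a} {b} a∈ b∈ = subst (InConv _) (sym (toQ-+ a b)) (InConv-⊕ a∈ b∈)

-- Sets of lattice points containing every lattice point of their convex hull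

natWeight : List (ℕ × Pt) → ℕ
natWeight []             = 0
natWeight ((n , _) ∷ ws) = n ℕ.+ natWeight ws

natCombo : List (ℕ × Pt) → Pt
natCombo []             = 0ᵖ
natCombo ((n , p) ∷ ws) = ((+ n) ·ᵖ p) +ᵖ natCombo ws

-- Convexity with denominators cleared: `x` is a mean with natural weights of total `k + 1`. The
-- arguments about lattice points thus stay within integer arithmetic.
Convex : (Pt → Set) → Set
Convex I = ∀ k ws x → All (λ w → I (proj₂ w)) ws → natWeight ws ≡ suc k → natCombo ws ≡ (+ suc k) ·ᵖ x → I x

divided : ℚ → List (ℕ × Pt) → List (ℚ × Pt)
divided c = map (λ (n , p) → (+ n ℚ./ 1) ℚ.* c , p)

weights-divided : ∀ c ws → weights (divided c ws) ≡ (+ natWeight ws ℚ./ 1) ℚ.* c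
weights-divided c []             = sym (ℚₚ.*-zeroˡ c)
weights-divided c ((n , p) ∷ ws) = begin
  (+ n ℚ./ 1) ℚ.* c ℚ.+ weights (divided c ws) ≡⟨ cong ((+ n ℚ./ 1) ℚ.* c ℚ.+_) (weights-divided c ws) ⟩
  (+ n ℚ./ 1) ℚ.* c ℚ.+ (+ natWeight ws ℚ./ 1) ℚ.* c ≡⟨ ℚₚ.*-distribʳ-+ c (+ n ℚ./ 1) _ ⟨
  ((+ n ℚ./ 1) ℚ.+ (+ natWeight ws ℚ./ 1)) ℚ.* c ≡⟨ cong (ℚ._* c) (/1-+ (+ n) (+ natWeight ws)) ⟨
  (+ (n ℕ.+ natWeight ws) ℚ./ 1) ℚ.* c ∎
  where open ≡-Reasoning

combo-divided : ∀ c ws → combo (divided c ws) ≡ c ·q toQ (natCombo ws)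
combo-divided c []             = sym (·q-zeroʳ c)
combo-divided c ((n , p) ∷ ws) = begin
  (((+ n ℚ./ 1) ℚ.* c) ·q toQ p) +q combo (divided c ws) ≡⟨ cong₂ _+q_ (trans (cong (_·q toQ p) (ℚₚ.*-comm (+ n ℚ./ 1) c)) (·q-assoc c (+ n ℚ./ 1) (toQ p))) (combo-divided c ws) ⟩
  (c ·q ((+ n ℚ./ 1) ·q toQ p)) +q (c ·q toQ (natCombo ws)) ≡⟨ ·q-distribˡ c _ _ ⟨
  c ·q (((+ n ℚ./ 1) ·q toQ p) +q toQ (natCombo ws)) ≡⟨ cong (c ·q_) (trans (toQ-+ ((+ n) ·ᵖ p) (natCombo ws)) (cong (_+q toQ (natCombo ws)) (toQ-· (+ n) p))) ⟨
  c ·q toQ (((+ n) ·ᵖ p) +ᵖ natCombo ws) ∎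
  where open ≡-Reasoning

0≤/1 : ∀ n → 0ℚ ℚ.≤ (+ n ℚ./ 1)
0≤/1 n = ℚₚ.nonNegative⁻¹ (+ n ℚ./ 1) {{ℚₚ.normalize-nonNeg n 1}}

0≤reciprocal : ∀ k → 0ℚ ℚ.≤ reciprocal k
0≤reciprocal k = ℚₚ.nonNegative⁻¹ (reciprocal k) {{ℚₚ.normalize-nonNeg 1 (suc k)}}

Convex-InConv : ∀ S → Convex (λ x → InConv S (toQ x))
Convex-InConv S k ws x inS total eq =
  subst (InConv S) (trans (comboOf-toQ (divided c ws)) value)
    (hull (divided c ws) (Allₚ.map⁺ (All.map (λ {w} s → 0≤* (0≤/1 (proj₁ w)) (0≤reciprocal k) , s) inS)) one)
  where
  c = reciprocal k
  one : weights (divided c ws) ≡ 1ℚ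
  one = trans (weights-divided c ws) (trans (cong (λ n → (+ n ℚ./ 1) ℚ.* c) total) (*-reciprocal k))
  value : combo (divided c ws) ≡ toQ x
  value = begin
    combo (divided c ws) ≡⟨ combo-divided c ws ⟩
    c ·q toQ (natCombo ws) ≡⟨ cong (λ y → c ·q toQ y) eq ⟩
    c ·q toQ ((+ suc k) ·ᵖ x) ≡⟨ cong (c ·q_) (toQ-· (+ suc k) x) ⟩
    c ·q ((+ suc k ℚ./ 1) ·q toQ x) ≡⟨ ·q-assoc c (+ suc k ℚ./ 1) (toQ x) ⟨
    (c ℚ.* (+ suc k ℚ./ 1)) ·q toQ x ≡⟨ cong (_·q toQ x) (trans (ℚₚ.*-comm c _) (*-reciprocal k)) ⟩
    1ℚ ·q toQ x ≡⟨ ·q-identityˡ (toQ x) ⟩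
    toQ x ∎
    where open ≡-Reasoning
  hull : ∀ vs → All (λ w → (0ℚ ℚ.≤ proj₁ w) × InConv S (toQ (proj₂ w))) vs → weights vs ≡ 1ℚ → InConv S (comboOf toQ vs)
  hull vs ok one with flatten toQ vs ok
  ... | us , us-ok , us-w , us-c = us , us-ok , trans us-w one , us-c

-- Lattice point sets without a sum of three segments

_≟ᵖ_ : DecidableEquality Pt
_≟ᵖ_ = Vecₚ.≡-dec ℤ._≟_

infixl 6 _-ᵖ_

_-ᵖ_ : Pt → Pt → Pt
_-ᵖ_ = V.zipWith _-_

+ᵖ-assoc : ∀ x y z → (x +ᵖ y) +ᵖ z ≡ x +ᵖ (y +ᵖ z)
+ᵖ-assoc (a ∷ b ∷ c ∷ []) (a′ ∷ b′ ∷ c′ ∷ []) (a″ ∷ b″ ∷ c″ ∷ []) =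
  pointwise (ℤₚ.+-assoc a a′ a″) (ℤₚ.+-assoc b b′ b″) (ℤₚ.+-assoc c c′ c″)

+ᵖ-comm : ∀ x y → x +ᵖ y ≡ y +ᵖ x
+ᵖ-comm (a ∷ b ∷ c ∷ []) (a′ ∷ b′ ∷ c′ ∷ []) = pointwise (ℤₚ.+-comm a a′) (ℤₚ.+-comm b b′) (ℤₚ.+-comm c c′)

+ᵖ-identityˡ : ∀ x → 0ᵖ +ᵖ x ≡ x
+ᵖ-identityˡ (a ∷ b ∷ c ∷ []) = pointwise (ℤₚ.+-identityˡ a) (ℤₚ.+-identityˡ b) (ℤₚ.+-identityˡ c)

+ᵖ-identityʳ : ∀ x → x +ᵖ 0ᵖ ≡ x
+ᵖ-identityʳ x = trans (+ᵖ-comm x 0ᵖ) (+ᵖ-identityˡ x)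

add-difference : ∀ x y → y +ᵖ (x -ᵖ y) ≡ x
add-difference (a ∷ b ∷ c ∷ []) (a′ ∷ b′ ∷ c′ ∷ []) = pointwise (h a a′) (h b b′) (h c c′)
  where
  h : ∀ x y → y + (x - y) ≡ x
  h = solve-∀

difference-add : ∀ x y → (x -ᵖ y) +ᵖ y ≡ x
difference-add x y = trans (+ᵖ-comm (x -ᵖ y) y) (add-difference x y)

add-subtract : ∀ x y → (y +ᵖ x) -ᵖ y ≡ x
add-subtract (a ∷ b ∷ c ∷ []) (a′ ∷ b′ ∷ c′ ∷ []) = pointwise (h a a′) (h b b′) (h c c′)
  where
  h : ∀ x y → (y + x) - y ≡ x
  h = solve-∀

difference-self : ∀ x → x -ᵖ x ≡ 0ᵖ
difference-self (a ∷ b ∷ c ∷ []) = pointwise (ℤₚ.+-inverseʳ a) (ℤₚ.+-inverseʳ b) (ℤₚ.+-inverseʳ c)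

+ᵖ-cancelˡ : ∀ x {y z} → x +ᵖ y ≡ x +ᵖ z → y ≡ z
+ᵖ-cancelˡ x {y} {z} eq = trans (sym (add-subtract y x)) (trans (cong (_-ᵖ x) eq) (add-subtract z x))

+ᵖ-cancelʳ : ∀ x {y z} → y +ᵖ x ≡ z +ᵖ x → y ≡ z
+ᵖ-cancelʳ x {y} {z} eq = +ᵖ-cancelˡ x (trans (+ᵖ-comm x y) (trans eq (+ᵖ-comm z x)))

difference-zero : ∀ {x y} → x -ᵖ y ≡ 0ᵖ → x ≡ y
difference-zero {x} {y} eq = trans (sym (difference-add x y)) (trans (cong (_+ᵖ y) eq) (+ᵖ-identityˡ y))

-- The directions may be dependent. In particular `x = y = z` is allowed, when the eight corners
-- collapse to four points of a segment.
record Cube (I : Pt → Set) (p x y z : Pt) : Set where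
  constructor cube
  field
    c₀ : I p
    cx : I (p +ᵖ x)
    cy : I (p +ᵖ y)
    cz : I (p +ᵖ z)
    cxy : I (p +ᵖ (x +ᵖ y))
    cxz : I (p +ᵖ (x +ᵖ z))
    cyz : I (p +ᵖ (y +ᵖ z))
    cxyz : I (p +ᵖ (x +ᵖ (y +ᵖ z)))

-- I models the set of lattice points of a polytope of Minkowski length at most two.
record Thin (I : Pt → Set) : Set where
  field
    convex : Convex I
    no-cube : ∀ p {x y z} → x ≢ 0ᵖ → y ≢ 0ᵖ → z ≢ 0ᵖ → ¬ Cube I p x y z

Thin-InConv : ∀ R → MinkowskiLength R 2 → Thin (λ x → InConv R (toQ x))
Thin-InConv R (_ , maximal) = record { convex = Convex-InConv R ; no-cube = no-cube }
  where
  no-cube : ∀ p {x y z} → x ≢ 0ᵖ → y ≢ 0ᵖ → z ≢ 0ᵖ → ¬ Cube (λ x → InConv R (toQ x)) p x y z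
  no-cube p {x} {y} {z} x≢0 y≢0 z≢0 (cube c₀ cx cy cz cxy cxz cyz cxyz)
    with maximal 3 (segments , refl , posDim , λ _ → InConv-hull λ {q} → All.lookup corners {q})
    where
    segments : List LPoly
    -- The base point goes into the first segment and the others start at 0. The trailing `0ᵖ` in
    -- the corners below stems from the empty case of `sumAll`.
    segments = (p ∷ (p +ᵖ x) ∷ []) ∷ (0ᵖ ∷ y ∷ []) ∷ (0ᵖ ∷ z ∷ []) ∷ []
    posDim : All PosDim segments
    posDim = (p , p +ᵖ x , here refl , there (here refl) , λ eq → x≢0 (sym (+ᵖ-cancelˡ p (trans (+ᵖ-identityʳ p) eq))))
           ∷ (0ᵖ , y , here refl , there (here refl) , λ eq → y≢0 (sym eq))
           ∷ (0ᵖ , z , here refl , there (here refl) , λ eq → z≢0 (sym eq)) ∷ []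
    at : ∀ {a b} → b ≡ a → InConv R (toQ a) → InConv R (toQ b)
    at refl h = h
    ₀z : 0ᵖ +ᵖ (z +ᵖ 0ᵖ) ≡ z
    ₀z = trans (+ᵖ-identityˡ _) (+ᵖ-identityʳ z)
    y₀ : y +ᵖ (0ᵖ +ᵖ 0ᵖ) ≡ y
    y₀ = +ᵖ-identityʳ y
    yz : y +ᵖ (z +ᵖ 0ᵖ) ≡ y +ᵖ z
    yz = cong (y +ᵖ_) (+ᵖ-identityʳ z)
    corners : All (λ q → InConv R (toQ q)) (sumAll segments)
    corners =
        at (+ᵖ-identityʳ p) c₀
      ∷ at (cong (p +ᵖ_) ₀z) cz
      ∷ at (cong (p +ᵖ_) y₀) cy
      ∷ at (cong (p +ᵖ_) yz) cyz
      ∷ at (+ᵖ-identityʳ (p +ᵖ x)) cx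
      ∷ at (trans (+ᵖ-assoc p x _) (cong (λ w → p +ᵖ (x +ᵖ w)) ₀z)) cxz
      ∷ at (trans (+ᵖ-assoc p x _) (cong (λ w → p +ᵖ (x +ᵖ w)) y₀)) cxy
      ∷ at (trans (+ᵖ-assoc p x _) (cong (λ w → p +ᵖ (x +ᵖ w)) yz)) cxyz
      ∷ []
  ... | s≤s (s≤s ())

shift : Pt → (Pt → Set) → Pt → Set
shift t I x = I (t +ᵖ x)

·ᵖ-distribˡ : ∀ n x y → n ·ᵖ (x +ᵖ y) ≡ (n ·ᵖ x) +ᵖ (n ·ᵖ y)
·ᵖ-distribˡ n (a ∷ b ∷ c ∷ []) (a′ ∷ b′ ∷ c′ ∷ []) =
  pointwise (ℤₚ.*-distribˡ-+ n a a′) (ℤₚ.*-distribˡ-+ n b b′) (ℤₚ.*-distribˡ-+ n c c′)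

·ᵖ-distribʳ : ∀ x m n → (m + n) ·ᵖ x ≡ (m ·ᵖ x) +ᵖ (n ·ᵖ x)
·ᵖ-distribʳ (a ∷ b ∷ c ∷ []) m n =
  pointwise (ℤₚ.*-distribʳ-+ a m n) (ℤₚ.*-distribʳ-+ b m n) (ℤₚ.*-distribʳ-+ c m n)

·ᵖ-zeroˡ : ∀ x → (+ 0) ·ᵖ x ≡ 0ᵖ
·ᵖ-zeroˡ (a ∷ b ∷ c ∷ []) = refl

+ᵖ-interchange : ∀ w x y z → (w +ᵖ x) +ᵖ (y +ᵖ z) ≡ (w +ᵖ y) +ᵖ (x +ᵖ z)
+ᵖ-interchange (a ∷ b ∷ c ∷ []) (a′ ∷ b′ ∷ c′ ∷ []) (a″ ∷ b″ ∷ c″ ∷ []) (a‴ ∷ b‴ ∷ c‴ ∷ []) =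
  pointwise (h a a′ a″ a‴) (h b b′ b″ b‴) (h c c′ c″ c‴)
  where
  h : ∀ w x y z → (w + x) + (y + z) ≡ (w + y) + (x + z)
  h = solve-∀

Convex-shift : ∀ {I} t → Convex I → Convex (shift t I)
Convex-shift t convex k ws x inI total eq =
  convex k (map (λ (n , p) → n , t +ᵖ p) ws) (t +ᵖ x) (Allₚ.map⁺ inI) (trans (weight ws) total) (begin
    natCombo (map (λ (n , p) → n , t +ᵖ p) ws) ≡⟨ combo′ ws ⟩
    ((+ natWeight ws) ·ᵖ t) +ᵖ natCombo ws ≡⟨ cong₂ (λ n y → ((+ n) ·ᵖ t) +ᵖ y) total eq ⟩
    ((+ suc k) ·ᵖ t) +ᵖ ((+ suc k) ·ᵖ x) ≡⟨ ·ᵖ-distribˡ (+ suc k) t x ⟨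
    (+ suc k) ·ᵖ (t +ᵖ x) ∎)
  where
  open ≡-Reasoning
  weight : ∀ ws → natWeight (map (λ (n , p) → n , t +ᵖ p) ws) ≡ natWeight ws
  weight []             = refl
  weight ((n , p) ∷ ws) = cong (n ℕ.+_) (weight ws)
  combo′ : ∀ ws → natCombo (map (λ (n , p) → n , t +ᵖ p) ws) ≡ ((+ natWeight ws) ·ᵖ t) +ᵖ natCombo ws
  combo′ []             = sym (trans (+ᵖ-identityʳ _) (·ᵖ-zeroˡ t))
  combo′ ((n , p) ∷ ws) = begin
    ((+ n) ·ᵖ (t +ᵖ p)) +ᵖ natCombo (map _ ws) ≡⟨ cong₂ _+ᵖ_ (·ᵖ-distribˡ (+ n) t p) (combo′ ws) ⟩
    (((+ n) ·ᵖ t) +ᵖ ((+ n) ·ᵖ p)) +ᵖ (((+ natWeight ws) ·ᵖ t) +ᵖ natCombo ws) ≡⟨ +ᵖ-interchange _ _ _ _ ⟩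
    (((+ n) ·ᵖ t) +ᵖ ((+ natWeight ws) ·ᵖ t)) +ᵖ (((+ n) ·ᵖ p) +ᵖ natCombo ws) ≡⟨ cong (_+ᵖ (((+ n) ·ᵖ p) +ᵖ natCombo ws)) (·ᵖ-distribʳ t (+ n) (+ natWeight ws)) ⟨
    ((+ (n ℕ.+ natWeight ws)) ·ᵖ t) +ᵖ (((+ n) ·ᵖ p) +ᵖ natCombo ws) ∎

Thin-shift : ∀ {I} t → Thin I → Thin (shift t I)
Thin-shift {I} t thin = record
  { convex  = Convex-shift t convex
  ; no-cube = λ p x≢0 y≢0 z≢0 (cube c₀ cx cy cz cxy cxz cyz cxyz) →
      no-cube (t +ᵖ p) x≢0 y≢0 z≢0 (cube c₀ (re cx) (re cy) (re cz) (re cxy) (re cxz) (re cyz) (re cxyz)) }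
  where
  open Thin thin
  re : ∀ {p x} → I (t +ᵖ (p +ᵖ x)) → I ((t +ᵖ p) +ᵖ x)
  re {p} {x} = subst I (sym (+ᵖ-assoc t p x))

module ThinProperties {I : Pt → Set} (thin : Thin I) where
  open Thin thin

  midpoint : ∀ {x y} z → I x → I y → z +ᵖ z ≡ x +ᵖ y → I z
  midpoint {x} {y} z ix iy eq = convex 1 ((1 , x) ∷ (1 , y) ∷ []) z (ix ∷ iy ∷ []) refl (begin
      ((+ 1) ·ᵖ x) +ᵖ (((+ 1) ·ᵖ y) +ᵖ 0ᵖ) ≡⟨ sumOf x y ⟩
      x +ᵖ y ≡⟨ eq ⟨
      z +ᵖ z ≡⟨ double z ⟨
      (+ 2) ·ᵖ z ∎)
    where
    open ≡-Reasoning
    sumOf : ∀ x y → ((+ 1) ·ᵖ x) +ᵖ (((+ 1) ·ᵖ y) +ᵖ 0ᵖ) ≡ x +ᵖ y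
    sumOf (a ∷ b ∷ c ∷ []) (a′ ∷ b′ ∷ c′ ∷ []) = pointwise (h a a′) (h b b′) (h c c′)
      where
      h : ∀ x y → (+ 1) * x + ((+ 1) * y + + 0) ≡ x + y
      h = solve-∀
    double : ∀ z → (+ 2) ·ᵖ z ≡ z +ᵖ z
    double (a ∷ b ∷ c ∷ []) = pointwise (h a) (h b) (h c)
      where
      h : ∀ z → (+ 2) * z ≡ z + z
      h = solve-∀

  third-point : ∀ {x y} z → I x → I y → (z +ᵖ (z +ᵖ z)) ≡ (x +ᵖ x) +ᵖ y → I z
  third-point {x} {y} z ix iy eq = convex 2 ((2 , x) ∷ (1 , y) ∷ []) z (ix ∷ iy ∷ []) refl (begin
      ((+ 2) ·ᵖ x) +ᵖ (((+ 1) ·ᵖ y) +ᵖ 0ᵖ) ≡⟨ sumOf x y ⟩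
      (x +ᵖ x) +ᵖ y ≡⟨ eq ⟨
      z +ᵖ (z +ᵖ z) ≡⟨ triple z ⟨
      (+ 3) ·ᵖ z ∎)
    where
    open ≡-Reasoning
    sumOf : ∀ x y → ((+ 2) ·ᵖ x) +ᵖ (((+ 1) ·ᵖ y) +ᵖ 0ᵖ) ≡ (x +ᵖ x) +ᵖ y
    sumOf (a ∷ b ∷ c ∷ []) (a′ ∷ b′ ∷ c′ ∷ []) = pointwise (h a a′) (h b b′) (h c c′)
      where
      h : ∀ x y → (+ 2) * x + ((+ 1) * y + + 0) ≡ (x + x) + y
      h = solve-∀
    triple : ∀ z → (+ 3) ·ᵖ z ≡ z +ᵖ (z +ᵖ z)
    triple (a ∷ b ∷ c ∷ []) = pointwise (h a) (h b) (h c)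
      where
      h : ∀ z → (+ 3) * z ≡ z + (z + z)
      h = solve-∀

  -- a lattice segment of length three is a sum of three segments
  no-triple : ∀ {y} w → I y → I (y +ᵖ (w +ᵖ (w +ᵖ w))) → w ≡ 0ᵖ
  no-triple {y} w iy iy₃ with w ≟ᵖ 0ᵖ
  ... | yes w≡0 = w≡0
  ... | no w≢0 = ⊥-elim (no-cube y w≢0 w≢0 w≢0 (cube iy i₁ i₁ i₁ i₂ i₂ i₂ iy₃))
    where
    i₁ : I (y +ᵖ w)
    i₁ = third-point (y +ᵖ w) iy iy₃ (h′ y w)
      where
      h : ∀ y w → (y + w) + ((y + w) + (y + w)) ≡ (y + y) + (y + (w + (w + w)))
      h = solve-∀
      h′ : ∀ y w → (y +ᵖ w) +ᵖ ((y +ᵖ w) +ᵖ (y +ᵖ w)) ≡ (y +ᵖ y) +ᵖ (y +ᵖ (w +ᵖ (w +ᵖ w)))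
      h′ (a ∷ b ∷ c ∷ []) (a′ ∷ b′ ∷ c′ ∷ []) = pointwise (h a a′) (h b b′) (h c c′)
    i₂ : I (y +ᵖ (w +ᵖ w))
    i₂ = midpoint (y +ᵖ (w +ᵖ w)) i₁ iy₃ (h′ y w)
      where
      h : ∀ y w → (y + (w + w)) + (y + (w + w)) ≡ (y + w) + (y + (w + (w + w)))
      h = solve-∀
      h′ : ∀ y w → (y +ᵖ (w +ᵖ w)) +ᵖ (y +ᵖ (w +ᵖ w)) ≡ (y +ᵖ w) +ᵖ (y +ᵖ (w +ᵖ (w +ᵖ w)))
      h′ (a ∷ b ∷ c ∷ []) (a′ ∷ b′ ∷ c′ ∷ []) = pointwise (h a a′) (h b b′) (h c c′)

  res₃-inj : ∀ {x y} → I x → I y → res₃ x ≡ res₃ y → x ≡ y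
  res₃-inj {x} {y} ix iy eq with res₃-≡ x y eq
  ... | w , x≡ = trans x≡′ (trans (cong (λ w → y +ᵖ (w +ᵖ (w +ᵖ w))) (no-triple w iy (subst I x≡′ ix))) (+ᵖ-identityʳ y))
    where
    h : ∀ w → w * + 3 ≡ w + (w + w)
    h = solve-∀
    triple : ∀ w → V.map (_* + 3) w ≡ w +ᵖ (w +ᵖ w)
    triple (a ∷ b ∷ c ∷ []) = pointwise (h a) (h b) (h c)
    x≡′ : x ≡ y +ᵖ (w +ᵖ (w +ᵖ w))
    x≡′ = trans x≡ (cong (y +ᵖ_) (triple w))

  Unique-res₃ : ∀ {xs} → All I xs → Unique xs → Unique (map res₃ xs)
  Unique-res₃ [] [] = []
  Unique-res₃ (ix ∷ is) (x∉ ∷ u) =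
    Allₚ.map⁺ (All.zipWith (λ (iy , x≢y) eq → x≢y (res₃-inj ix iy eq)) (is , x∉)) ∷ Unique-res₃ is u

  -- Otherwise w₃, w₁, w₂, w₄ is a parallelogram, and with u it spans a sum of three segments.
  no-parallelogram : ∀ {u} → u ≢ 0ᵖ → ∀ {w₁ w₂ w₃ w₄} → I w₁ × I (w₁ +ᵖ u) → I w₂ × I (w₂ +ᵖ u) →
                     I w₃ × I (w₃ +ᵖ u) → I w₄ × I (w₄ +ᵖ u) → w₁ +ᵖ w₂ ≡ w₃ +ᵖ w₄ → w₁ ≡ w₃ ⊎ w₁ ≡ w₄
  no-parallelogram {u} u≢0 {w₁} {w₂} {w₃} {w₄} (i₁ , j₁) (i₂ , j₂) (i₃ , j₃) (i₄ , j₄) eq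
    with w₁ ≟ᵖ w₃ | w₁ ≟ᵖ w₄
  ... | yes e | _     = inj₁ e
  ... | no _  | yes e = inj₂ e
  ... | no w₁≢w₃ | no w₁≢w₄ = ⊥-elim (no-cube w₃ (λ e → w₁≢w₃ (difference-zero e)) (λ e → w₁≢w₄ (swap e)) u≢0
      (cube i₃ (at x-eq i₁) (at y-eq i₂) j₃ (at xy-eq i₄) (at (with-u x-eq) j₁) (at (with-u y-eq) j₂)
        (at (trans (cong (w₃ +ᵖ_) (sym (+ᵖ-assoc x y u))) (with-u xy-eq)) j₄)))
    where
    x = w₁ -ᵖ w₃
    y = w₂ -ᵖ w₃
    at : ∀ {a b} → b ≡ a → I a → I b
    at refl h = h
    x-eq : w₃ +ᵖ x ≡ w₁
    x-eq = add-difference w₁ w₃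
    y-eq : w₃ +ᵖ y ≡ w₂
    y-eq = add-difference w₂ w₃
    xy-eq : w₃ +ᵖ (x +ᵖ y) ≡ w₄
    xy-eq = trans (h w₁ w₂ w₃) (trans (cong (_-ᵖ w₃) eq) (add-subtract w₄ w₃))
      where
      h₁ : ∀ a b c → c + ((a - c) + (b - c)) ≡ (a + b) - c
      h₁ = solve-∀
      h : ∀ a b c → c +ᵖ ((a -ᵖ c) +ᵖ (b -ᵖ c)) ≡ (a +ᵖ b) -ᵖ c
      h (a ∷ b ∷ c ∷ []) (a′ ∷ b′ ∷ c′ ∷ []) (a″ ∷ b″ ∷ c″ ∷ []) = pointwise (h₁ a a′ a″) (h₁ b b′ b″) (h₁ c c′ c″)
    with-u : ∀ {a b} → w₃ +ᵖ a ≡ b → w₃ +ᵖ (a +ᵖ u) ≡ b +ᵖ u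
    with-u {a} e = trans (sym (+ᵖ-assoc w₃ a u)) (cong (_+ᵖ u) e)
    swap : y ≡ 0ᵖ → w₁ ≡ w₄
    swap e = +ᵖ-cancelʳ w₃ (trans (cong (w₁ +ᵖ_) (sym (difference-zero e))) (trans eq (+ᵖ-comm w₃ w₄)))

-- Distinctness of sums

Labelled : Set
Labelled = Side × Pt

-- The notion of a Sidon set, restricted to compatible pairs. Labels belong to the identity of a
-- summand, so a left zero and a right zero remain different.
Sidon : (Labelled → Set) → Set
Sidon M = ∀ {e f e′ f′} → M e → M f → M e′ → M f′ →
  T (compatible (proj₁ e) (proj₁ f)) → T (compatible (proj₁ e′) (proj₁ f′)) →
  proj₂ e +ᵖ proj₂ f ≡ proj₂ e′ +ᵖ proj₂ f′ → (e ≡ e′ × f ≡ f′) ⊎ (e ≡ f′ × f ≡ e′)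

module _ {M : Labelled → Set} (sidon : Sidon M) where

  private
    Old : List Labelled → Pt → Set
    Old old s = Σ Labelled λ e → Σ Labelled λ f → M e × M f × e ∈ old × f ∈ old ×
                T (compatible (proj₁ e) (proj₁ f)) × s ≡ proj₂ e +ᵖ proj₂ f

    New : Labelled → List Labelled → List Labelled → Pt → Set
    New x old ys s = Σ Labelled λ f → M f × f ∈ x ∷ old × f ∉ ys ×
                     T (compatible (proj₁ x) (proj₁ f)) × s ≡ proj₂ x +ᵖ proj₂ f

  -- Every sum in `seen` either joins two old points or joins `x` to a point already passed, that
  -- is, outside the remaining `ys`. The Sidon condition separates the next sum from both sorts.
  addSums-Unique : ∀ {x old} ys {seen} → M x → x ∉ old → All M ys → (∀ {y} → y ∈ ys → y ∈ x ∷ old) → Unique ys →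
    All (λ s → Old old s ⊎ New x old ys s) seen → Unique seen →
    All (λ s → Old old s ⊎ New x old [] s) (addSums _+ᵖ_ (proj₁ x) (proj₂ x) ys seen) ×
    Unique (addSums _+ᵖ_ (proj₁ x) (proj₂ x) ys seen)
  addSums-Unique [] mx x∉ [] ys⊆ uys known u = known , u
  addSums-Unique {k , x} {old} ((l , y) ∷ ys) {seen} mx x∉ (my ∷ mys) ys⊆ (y∉ ∷ uys) known u
    with compatible k l in eq
  ... | false = addSums-Unique ys mx x∉ mys (ys⊆ ∘ there) uys (All.map weaken known) u
    where
    weaken : ∀ {s} → Old old s ⊎ New (k , x) old ((l , y) ∷ ys) s → Old old s ⊎ New (k , x) old ys s
    weaken (inj₁ o) = inj₁ o
    weaken (inj₂ (f , mf , f∈ , f∉ , rest)) = inj₂ (f , mf , f∈ , f∉ ∘ there , rest)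
  ... | true = addSums-Unique ys mx x∉ mys (ys⊆ ∘ there) uys
      (inj₂ ((l , y) , my , ys⊆ (here refl) , (λ y∈ → All.lookup y∉ y∈ refl) , c , refl) ∷ All.map weaken known)
      (All.map fresh known ∷ u)
    where
    c : T (compatible k l)
    c = T-true eq
    weaken : ∀ {s} → Old old s ⊎ New (k , x) old ((l , y) ∷ ys) s → Old old s ⊎ New (k , x) old ys s
    weaken (inj₁ o) = inj₁ o
    weaken (inj₂ (f , mf , f∈ , f∉ , rest)) = inj₂ (f , mf , f∈ , f∉ ∘ there , rest)
    fresh : ∀ {s} → Old old s ⊎ New (k , x) old ((l , y) ∷ ys) s → x +ᵖ y ≢ s
    fresh (inj₁ (e , f , me , mf , e∈ , f∈ , cef , refl)) eq with sidon mx my me mf c cef eq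
    ... | inj₁ (x≡e , _) = x∉ (subst (_∈ old) (sym x≡e) e∈)
    ... | inj₂ (x≡f , _) = x∉ (subst (_∈ old) (sym x≡f) f∈)
    fresh (inj₂ (f , mf , f∈ , f∉ , cf , refl)) eq with sidon mx my mx mf c cf eq
    ... | inj₁ (_ , y≡f)   = f∉ (here (sym y≡f))
    ... | inj₂ (x≡f , y≡x) = f∉ (here (trans (sym x≡f) (sym y≡x)))

  sums-Unique : ∀ new {old seen} → All M new → All M old → Unique new → (∀ {e} → e ∈ new → e ∉ old) → Unique old →
    All (Old old) seen → Unique seen → Unique (sums _+ᵖ_ new old seen)
  sums-Unique [] mn mo un disj uo known u = u
  sums-Unique ((k , x) ∷ new) {old} {seen} (mx ∷ mn) mo (x∉ ∷ un) disj uo known u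
    with addSums-Unique ((k , x) ∷ old) {seen} mx (disj (here refl)) (mx ∷ mo) (λ y∈ → y∈)
           (Allₚ.¬Any⇒All¬ old (disj (here refl)) ∷ uo) (All.map inj₁ known) u
  ... | known′ , u′ = sums-Unique new mn (mx ∷ mo) un disj′ (Allₚ.¬Any⇒All¬ old (disj (here refl)) ∷ uo) (All.map merge known′) u′
    where
    disj′ : ∀ {e} → e ∈ new → e ∉ (k , x) ∷ old
    disj′ e∈ (here e≡x) = All.lookup x∉ e∈ (sym e≡x)
    disj′ e∈ (there e∈old) = disj (there e∈) e∈old
    merge : ∀ {s} → Old old s ⊎ New (k , x) old [] s → Old ((k , x) ∷ old) s
    merge (inj₁ (e , f , me , mf , e∈ , f∈ , rest)) = e , f , me , mf , there e∈ , there f∈ , rest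
    merge (inj₂ (f , mf , f∈ , _ , rest)) = (k , x) , f , mx , mf , here refl , f∈ , rest

  sums-Unique₀ : ∀ {es} → All M es → Unique es → Unique (sums _+ᵖ_ es [] [])
  sums-Unique₀ {es} ms u = sums-Unique es ms [] u (λ _ ()) [] [] []

residues : List Labelled → List (Side × V₃)
residues = map (map₂ res₃)

residues-Unique : ∀ {I M} → Thin I → Sidon M →
  (∀ {k x l y} → M (k , x) → M (l , y) → T (compatible k l) → I (x +ᵖ y)) →
  ∀ {es} → All M es → Unique es → Unique (sums _+₃_ (residues es) [] [])
residues-Unique {I} {M} thin sidon closed {es} ms u =
  subst Unique (sums-natural {_∙_ = _+ᵖ_} {_∙′_ = _+₃_} res₃ res₃ res₃-+ es [] [])
    (ThinProperties.Unique-res₃ thin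
      (sums-All {M = λ k x → M (k , x)} (λ {k} {x} {l} {y} → closed {k} {x} {l} {y}) ms [] [])
      (sums-Unique₀ sidon ms u))

not-elemᵛ : ∀ x xs → x ∉ xs → T (not (elemᵛ x xs))
not-elemᵛ x xs x∉ with elemᵛ x xs in eq
... | false = tt
... | true  = x∉ (elemᵛ-sound x xs (T-true eq))

T-∧-intro : ∀ {x y} → T x → T y → T (x ∧ y)
T-∧-intro {true} _ t = t

-- The points 0, `u`, `v` and `u + v` all lie in `I`, where reduction modulo 3 is injective, so the
-- inequalities survive reduction.
independent-res₃ : ∀ {I} → Thin I → ∀ {u v} → I 0ᵖ → I u → I v → I (u +ᵖ v) →
  u ≢ 0ᵖ → v ≢ 0ᵖ → u ≢ v → u +ᵖ v ≢ 0ᵖ → T (independent (res₃ u) (res₃ v))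
independent-res₃ thin {u} {v} i₀ iu iv iuv u≢0 v≢0 u≢v uv≢0 = T-∧-intro
    (not-elemᵛ (res₃ u) (zeroᵛ ∷ res₃ v ∷ []) λ
      { (here e) → u≢0 (res₃-inj iu i₀ e) ; (there (here e)) → u≢v (res₃-inj iu iv e) })
    (not-elemᵛ zeroᵛ (res₃ v ∷ (res₃ u +₃ res₃ v) ∷ []) λ
      { (here e) → v≢0 (sym (res₃-inj i₀ iv e)) ; (there (here e)) → uv≢0 (sym (res₃-inj i₀ iuv (trans e (sym (res₃-+ u v))))) })
  where open ThinProperties thin

open import Data.List.Membership.DecPropositional _≟ᵖ_ using (_∈?_)

-- Two point sets with a common edge

Unique-resp-↭ : ∀ {xs ys : List Pt} → xs ↭ ys → Unique xs → Unique ys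
Unique-resp-↭ p = ↭ₛₚ.Unique-resp-↭ (setoid Pt) (↭⇒↭ₛ p)

∈-front : ∀ {x : Pt} {xs} → x ∈ xs → ∃ λ ys → xs ↭ x ∷ ys
∈-front {x} x∈ with ∈ₚ.∈-∃++ x∈
... | ys , zs , refl = ys ++ zs , ↭ₚ.shift x ys zs

translate-back : ∀ a xs → map (a +ᵖ_) (map (_-ᵖ a) xs) ≡ xs
translate-back a []       = refl
translate-back a (x ∷ xs) = cong₂ _∷_ (add-difference x a) (translate-back a xs)

-ᵖ-injective : ∀ a {x y} → x -ᵖ a ≡ y -ᵖ a → x ≡ y
-ᵖ-injective a {x} {y} eq = trans (sym (difference-add x a)) (trans (cong (_+ᵖ a) eq) (difference-add y a))

split : ∀ xs ys → ∃ λ cs → ∃ λ xs′ → ∃ λ ys′ → xs ↭ cs ++ xs′ × ys ↭ cs ++ ys′ × (∀ {z} → z ∈ xs′ → z ∉ ys′)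
split [] ys = [] , [] , ys , ↭-refl , ↭-refl , λ ()
split (x ∷ xs) ys with x ∈? ys
... | yes x∈ with ∈-front x∈
...   | ys₁ , p with split xs ys₁
...     | cs , xs′ , ys′ , q , r , disj = x ∷ cs , xs′ , ys′ , prep x q , ↭-trans p (prep x r) , disj
split (x ∷ xs) ys | no x∉ with split xs ys
... | cs , xs′ , ys′ , q , r , disj = cs , x ∷ xs′ , ys′
  , ↭-trans (prep x q) (↭-sym (↭ₚ.shift x cs xs′)) , r
  , λ { (here refl) z∈ → x∉ (↭ₚ.∈-resp-↭ (↭-sym r) (∈ₚ.∈-++⁺ʳ cs z∈)) ; (there x∈) z∈ → disj x∈ z∈ }

tag : Side → Pt → Labelled
tag k x = k , x

-- The situation after P and Q have been translated so that a common edge becomes [0, u].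
module Common {I : Pt → Set} (thin : Thin I) {A B : Pt → Set} (sum : ∀ {x y} → A x → B y → I (x +ᵖ y))
  (A0 : A 0ᵖ) (B0 : B 0ᵖ) {u : Pt} (Au : A u) (Bu : B u) (u≢0 : u ≢ 0ᵖ) where

  open ThinProperties thin

  Inside : Side → Pt → Set
  Inside left  x = A x
  Inside right x = B x
  Inside both  x = A x × B x

  -- As 0 and `u` belong to both sets, `x + 0` and `x + u` are both sums. These are the two layers
  -- that `no-parallelogram` asks for.
  thick : ∀ k {x} → Inside k x → I x × I (x +ᵖ u)
  thick left  {x} ax       = subst I (+ᵖ-identityʳ x) (sum ax B0) , sum ax Bu
  thick right {x} bx       = subst I (+ᵖ-identityˡ x) (sum A0 bx) , subst I (+ᵖ-comm u x) (sum Au bx)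
  thick both      (ax , _) = thick left ax

  Inside-sum : ∀ k {x} l {y} → Inside k x → Inside l y → T (compatible k l) → I (x +ᵖ y)
  Inside-sum left  right ax by _ = sum ax by
  Inside-sum right {x} left {y} bx ay _ = subst I (+ᵖ-comm y x) (sum ay bx)
  Inside-sum left  both  ax (_ , by) _ = sum ax by
  Inside-sum right {x} both {y} bx (ay , _) _ = subst I (+ᵖ-comm y x) (sum ay bx)
  Inside-sum both  left {y} (_ , bx) ay _ = subst I (+ᵖ-comm y _) (sum ay bx)
  Inside-sum both  right (ax , _) by _ = sum ax by
  Inside-sum both  both  (ax , _) (_ , by) _ = sum ax by

  module _ {es : List Labelled} (inside : All (λ (k , x) → Inside k x) es) (distinct : Unique (map proj₂ es)) where

    private
      label : ∀ {es : List Labelled} → Unique (map proj₂ es) → ∀ {e f} → e ∈ es → f ∈ es → proj₂ e ≡ proj₂ f → e ≡ f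
      label (x∉ ∷ u) (here refl) (here refl) eq = refl
      label (x∉ ∷ u) (here refl) (there f∈)  eq = ⊥-elim (All.lookup x∉ (∈ₚ.∈-map⁺ proj₂ f∈) eq)
      label (x∉ ∷ u) (there e∈)  (here refl) eq = ⊥-elim (All.lookup x∉ (∈ₚ.∈-map⁺ proj₂ e∈) (sym eq))
      label (x∉ ∷ u) (there e∈)  (there f∈)  eq = label u e∈ f∈ eq

      -- A coincidence of two sums is a parallelogram, so it must be degenerate. This identifies
      -- only the points; `distinct` lifts the equality to labels.
      sidon : Sidon (_∈ es)
      sidon {k , x} {l , y} {k′ , x′} {l′ , y′} e∈ f∈ e′∈ f′∈ _ _ eq
        with no-parallelogram u≢0 (thick k (All.lookup inside e∈)) (thick l (All.lookup inside f∈))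
               (thick k′ (All.lookup inside e′∈)) (thick l′ (All.lookup inside f′∈)) eq
      ... | inj₁ x≡x′ = inj₁ (label distinct e∈ e′∈ x≡x′ ,
              label distinct f∈ f′∈ (+ᵖ-cancelˡ x (trans eq (cong (_+ᵖ y′) (sym x≡x′)))))
      ... | inj₂ x≡y′ = inj₂ (label distinct e∈ f′∈ x≡y′ ,
              label distinct f∈ e′∈ (+ᵖ-cancelʳ x (trans (+ᵖ-comm y x) (trans eq (cong (x′ +ᵖ_) (sym x≡y′))))))

    residue-sums-Unique : Unique (sums _+₃_ (residues es) [] [])
    residue-sums-Unique = residues-Unique thin sidon
      (λ {k} {x} {l} {y} e∈ f∈ → Inside-sum k l (All.lookup inside e∈) (All.lookup inside f∈))
      (All.tabulate λ e∈ → e∈) (Uniqueₚ.map⁻ distinct)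

  independent-from : ∀ k {v} → Inside k v → v ≢ 0ᵖ → u ≢ v → T (independent (res₃ u) (res₃ v))
  independent-from k {v} iv v≢0 u≢v = independent-res₃ thin i₀ iu (proj₁ (thick k iv))
      (subst I (+ᵖ-comm v u) (proj₂ (thick k iv))) u≢0 v≢0 u≢v u+v≢0
    where
    i₀ : I 0ᵖ
    i₀ = proj₁ (thick left A0)
    iu : I u
    iu = proj₁ (thick left Au)
    u+v≢0 : u +ᵖ v ≢ 0ᵖ
    u+v≢0 eq with no-parallelogram u≢0 (thick left Au) (thick k iv) (thick left A0) (thick left A0)
                    (trans eq (sym (+ᵖ-identityˡ 0ᵖ)))
    ... | inj₁ e = u≢0 e
    ... | inj₂ e = u≢0 e

  labelled : List Pt → List Pt → List Pt → List Labelled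
  labelled cs xs ys = (both , 0ᵖ) ∷ (both , u) ∷ map (tag both) cs ++ (map (tag left) xs ++ map (tag right) ys)

  unlabel : ∀ cs xs ys → map proj₂ (labelled cs xs ys) ≡ 0ᵖ ∷ u ∷ cs ++ (xs ++ ys)
  unlabel cs xs ys = cong (λ l → 0ᵖ ∷ u ∷ l) (begin
      map proj₂ (map (tag both) cs ++ (map (tag left) xs ++ map (tag right) ys)) ≡⟨ Listₚ.map-++ proj₂ (map (tag both) cs) _ ⟩
      _ ++ map proj₂ (map (tag left) xs ++ map (tag right) ys) ≡⟨ cong₂ _++_ (forget both cs) (Listₚ.map-++ proj₂ (map (tag left) xs) (map (tag right) ys)) ⟩
      cs ++ (map proj₂ (map (tag left) xs) ++ map proj₂ (map (tag right) ys)) ≡⟨ cong (cs ++_) (cong₂ _++_ (forget left xs) (forget right ys)) ⟩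
      cs ++ (xs ++ ys) ∎)
    where
    open ≡-Reasoning
    forget : ∀ k xs → map proj₂ (map (tag k) xs) ≡ xs
    forget k xs = trans (sym (Listₚ.map-∘ xs)) (Listₚ.map-id xs)

  module _ {cs xs ys : List Pt} (Acs : All A cs) (Bcs : All B cs) (Axs : All A xs) (Bys : All B ys)
           (uA : Unique (0ᵖ ∷ u ∷ cs ++ xs)) (uB : Unique (0ᵖ ∷ u ∷ cs ++ ys)) (disj : ∀ {z} → z ∈ xs → z ∉ ys) where

    private
      inside : All (λ (k , x) → Inside k x) (labelled cs xs ys)
      inside = (A0 , B0) ∷ (Au , Bu) ∷ Allₚ.++⁺ (Allₚ.map⁺ (All.zip (Acs , Bcs))) (Allₚ.++⁺ (Allₚ.map⁺ Axs) (Allₚ.map⁺ Bys))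

      suffix : ∀ (zs : List Pt) {ws} → Unique (zs ++ ws) → Unique ws
      suffix []       u = u
      suffix (z ∷ zs) (_ ∷ u) = suffix zs u

      cross : ∀ (zs : List Pt) {ws} → Unique (zs ++ ws) → ∀ {z} → z ∈ zs → z ∉ ws
      cross (z ∷ zs) (z∉ ∷ _) (here refl) z∈ = All.lookup z∉ (∈ₚ.∈-++⁺ʳ zs z∈) refl
      cross (z ∷ zs) (_ ∷ u)  (there z∈zs) z∈ = cross zs u z∈zs z∈

      distinct : Unique (map proj₂ (labelled cs xs ys))
      distinct = subst Unique (sym (trans (unlabel cs xs ys) (sym (Listₚ.++-assoc (0ᵖ ∷ u ∷ cs) xs ys))))
        (Uniqueₚ.++⁺ uA (suffix (0ᵖ ∷ u ∷ cs) uB) λ { {z} (z∈ , z∈ys) → case ∈ₚ.∈-++⁻ (0ᵖ ∷ u ∷ cs) z∈ of λ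
          { (inj₁ z∈cs) → cross (0ᵖ ∷ u ∷ cs) uB z∈cs z∈ys ; (inj₂ z∈xs) → disj z∈xs z∈ys } })

    Unique-residues : Unique (sums _+₃_ (residues (labelled cs xs ys)) [] [])
    Unique-residues = residue-sums-Unique inside distinct

  -- The residues modulo 3 leave no room for two, three or four common points.
  same-completion : ∀ cs xs ys → All A cs → All B cs → All A xs → All B ys →
         Unique (0ᵖ ∷ u ∷ cs ++ xs) → Unique (0ᵖ ∷ u ∷ cs ++ ys) → (∀ {z} → z ∈ xs → z ∉ ys) →
         length (cs ++ xs) ≡ 3 → length (cs ++ ys) ≡ 3 → xs ≡ [] × ys ≡ []
  same-completion [] (x₁ ∷ x₂ ∷ x₃ ∷ []) (y₁ ∷ y₂ ∷ y₃ ∷ []) Ac Bc Ax@(ax₁ ∷ _) By uA@((_ ∷ 0≢x₁ ∷ _) ∷ (u≢x₁ ∷ _) ∷ _) uB disj refl refl =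
    ⊥-elim (no-two-common (res₃ u) (res₃ x₁) (residues ((left , x₂) ∷ (left , x₃) ∷ (right , y₁) ∷ (right , y₂) ∷ (right , y₃) ∷ []))
      (independent-from left ax₁ (0≢x₁ ∘ sym) u≢x₁) refl (Unique-residues Ac Bc Ax By uA uB disj))
  same-completion (c ∷ []) (x₁ ∷ x₂ ∷ []) (y₁ ∷ y₂ ∷ []) Ac@(ac ∷ _) Bc Ax By uA@((_ ∷ 0≢c ∷ _) ∷ (u≢c ∷ _) ∷ _) uB disj refl refl =
    ⊥-elim (no-three-common (res₃ u) (res₃ c) (residues ((left , x₁) ∷ (left , x₂) ∷ (right , y₁) ∷ (right , y₂) ∷ []))
      (independent-from left ac (0≢c ∘ sym) u≢c) refl (Unique-residues Ac Bc Ax By uA uB disj))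
  same-completion (c ∷ d ∷ []) (x ∷ []) (y ∷ []) Ac@(ac ∷ _) Bc Ax By uA@((_ ∷ 0≢c ∷ _) ∷ (u≢c ∷ _) ∷ _) uB disj refl refl =
    ⊥-elim (no-four-common (res₃ u) (res₃ c) (residues ((both , d) ∷ (left , x) ∷ (right , y) ∷ []))
      (independent-from left ac (0≢c ∘ sym) u≢c) refl (Unique-residues Ac Bc Ax By uA uB disj))
  same-completion (c ∷ d ∷ e ∷ []) [] [] Ac Bc Ax By uA uB disj refl refl = refl , refl

-- Finding the common edge and aligning the two sets

interleave : List Pt → List Pt → List Labelled
interleave (x ∷ xs) (y ∷ ys) = (left , x) ∷ (right , y) ∷ interleave xs ys
-- Reached only with both lists exhausted when they are equally long, as they are in the search
-- below.
interleave _        _        = []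

All-interleave : ∀ {P : Labelled → Set} {xs ys} → All (λ x → P (left , x)) xs → All (λ y → P (right , y)) ys →
                 All P (interleave xs ys)
All-interleave [] _ = []
All-interleave (_ ∷ _) [] = []
All-interleave (p ∷ ps) (q ∷ qs) = p ∷ q ∷ All-interleave ps qs

Unique-interleave : ∀ {xs ys} → Unique xs → Unique ys → Unique (interleave xs ys)
Unique-interleave [] _ = []
Unique-interleave (_ ∷ _) [] = []
Unique-interleave {x ∷ xs} {y ∷ ys} (x∉ ∷ ux) (y∉ ∷ uy) =
    ((λ ()) ∷ All-interleave {λ e → (left , x) ≢ e} (All.map (λ { x≢ refl → x≢ refl }) x∉) (All.tabulate λ _ ()))
  ∷ All-interleave {λ e → (right , y) ≢ e} (All.tabulate λ _ ()) (All.map (λ { y≢ refl → y≢ refl }) y∉)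
  ∷ Unique-interleave ux uy

translates-back : ∀ c zs {ds} → (∀ {x} → x ∈ zs → x ∈ ds) → All (λ x → c +ᵖ x ∈ ds) (map (_-ᵖ c) zs)
translates-back c []       ⊆ = []
translates-back c (z ∷ zs) {ds} ⊆ =
  subst (_∈ ds) (sym (add-difference z c)) (⊆ (here refl)) ∷ translates-back c zs (⊆ ∘ there)

NoCoincidence : List Pt → List Pt → Set
NoCoincidence as bs = ∀ {a a′ b b′} → a ∈ as → a′ ∈ as → b ∈ bs → b′ ∈ bs → a +ᵖ b ≡ a′ +ᵖ b′ → a ≡ a′

coincidence? : ∀ as bs → (∃ λ a → ∃ λ a′ → ∃ λ b → ∃ λ b′ →
  a ∈ as × a′ ∈ as × b ∈ bs × b′ ∈ bs × a ≢ a′ × a +ᵖ b ≡ a′ +ᵖ b′) ⊎ NoCoincidence as bs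
coincidence? as bs with Any.any? (λ a → Any.any? (λ a′ → Any.any? (λ b → Any.any? (λ b′ →
    ¬? (a ≟ᵖ a′) ×-dec ((a +ᵖ b) ≟ᵖ (a′ +ᵖ b′))) bs) bs) as) as
... | yes any with find any
...   | a , a∈ , any₁ with find any₁
...     | a′ , a′∈ , any₂ with find any₂
...       | b , b∈ , any₃ with find any₃
...         | b′ , b′∈ , a≢a′ , eq = inj₁ (a , a′ , b , b′ , a∈ , a′∈ , b∈ , b′∈ , a≢a′ , eq)
coincidence? as bs | no none = inj₂ λ {a} {a′} a∈ a′∈ b∈ b′∈ eq → decidable-stable (a ≟ᵖ a′) λ a≢a′ →
  none (Any.map (λ { refl → Any.map (λ { refl → Any.map (λ { refl → Any.map (λ { refl → a≢a′ , eq }) b′∈ }) b∈ }) a′∈ }) a∈)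

module _ {I : Pt → Set} (thin : Thin I) where

  -- Translation makes the first points 0. The residues of `u` and `v` are independent because
  -- `u = v` would mean `a₁ + b₀ = a₀ + b₁` and `u = - v` would mean `a₁ + b₁ = a₀ + b₀`, each a
  -- coincidence.
  coincidence-free⇒⊥ : ∀ as bs → length as ≡ 5 → length bs ≡ 5 → Unique as → Unique bs →
    (∀ {a b} → a ∈ as → b ∈ bs → I (a +ᵖ b)) → NoCoincidence as bs → ⊥
  coincidence-free⇒⊥ as@(a₀ ∷ a₁ ∷ a₂ ∷ a₃ ∷ a₄ ∷ []) bs@(b₀ ∷ b₁ ∷ b₂ ∷ b₃ ∷ b₄ ∷ []) refl refl uA uB sum none =
    no-coincidence-free (res₃ u) (res₃ v) (residues (interleave (map (_-ᵖ a₀) (a₂ ∷ a₃ ∷ a₄ ∷ [])) (map (_-ᵖ b₀) (b₂ ∷ b₃ ∷ b₄ ∷ []))))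
      (independent-res₃ thin′ (subst I′ (+ᵖ-identityʳ 0ᵖ) (closed {left} {0ᵖ} {right} {0ᵖ} 0∈a 0∈b tt))
        (subst I′ (+ᵖ-identityʳ u) (closed {left} {u} {right} {0ᵖ} u∈ 0∈b tt))
        (subst I′ (+ᵖ-identityˡ v) (closed {left} {0ᵖ} {right} {v} 0∈a v∈ tt))
        (closed {left} {u} {right} {v} u∈ v∈ tt)
        u≢0 v≢0
        (λ u≡v → u≢0 (same-left u∈ 0∈a 0∈b v∈ (trans (+ᵖ-identityʳ u) (trans u≡v (sym (+ᵖ-identityˡ v))))))
        (λ eq → u≢0 (same-left u∈ 0∈a v∈ 0∈b (trans eq (sym (+ᵖ-identityʳ 0ᵖ))))))
      refl
      -- The first points enter as `a₀ - a₀` and `b₀ - b₀`, which do not reduce to the zeros of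
      -- `disjointPrefix`.
      (subst₂ (λ z w → Unique (sums _+₃_ ((left , z) ∷ (right , w) ∷ residues rest) [] []))
        (cong res₃ (difference-self a₀)) (cong res₃ (difference-self b₀))
        (residues-Unique thin′ sidon (λ {k} {x} {l} {y} → closed {k} {x} {l} {y})
          (All-interleave {M} (translates-back a₀ as λ a∈ → a∈) (translates-back b₀ bs λ b∈ → b∈))
          (Unique-interleave (Uniqueₚ.map⁺ (-ᵖ-injective a₀) uA) (Uniqueₚ.map⁺ (-ᵖ-injective b₀) uB))))
    where
    u = a₁ -ᵖ a₀
    v = b₁ -ᵖ b₀
    rest = interleave (map (_-ᵖ a₀) (a₁ ∷ a₂ ∷ a₃ ∷ a₄ ∷ [])) (map (_-ᵖ b₀) (b₁ ∷ b₂ ∷ b₃ ∷ b₄ ∷ []))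
    I′ = shift (a₀ +ᵖ b₀) I
    thin′ = Thin-shift (a₀ +ᵖ b₀) thin
    M : Labelled → Set
    M (left  , x) = a₀ +ᵖ x ∈ as
    M (right , y) = b₀ +ᵖ y ∈ bs
    M (both  , _) = ⊥
    closed : ∀ {k x l y} → M (k , x) → M (l , y) → T (compatible k l) → I′ (x +ᵖ y)
    closed {left} {x} {right} {y} x∈ y∈ _ = subst I (sym (+ᵖ-interchange a₀ b₀ x y)) (sum x∈ y∈)
    closed {right} {x} {left} {y} x∈ y∈ _ =
      subst I (trans (+ᵖ-interchange a₀ y b₀ x) (cong ((a₀ +ᵖ b₀) +ᵖ_) (+ᵖ-comm y x))) (sum y∈ x∈)
    shuffle : ∀ {x y x′ y′} → x +ᵖ y ≡ x′ +ᵖ y′ → (a₀ +ᵖ x) +ᵖ (b₀ +ᵖ y) ≡ (a₀ +ᵖ x′) +ᵖ (b₀ +ᵖ y′)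
    shuffle {x} {y} {x′} {y′} eq = trans (+ᵖ-interchange a₀ x b₀ y)
      (trans (cong ((a₀ +ᵖ b₀) +ᵖ_) eq) (sym (+ᵖ-interchange a₀ x′ b₀ y′)))
    same-left : ∀ {x y x′ y′} → M (left , x) → M (left , x′) → M (right , y) → M (right , y′) → x +ᵖ y ≡ x′ +ᵖ y′ → x ≡ x′
    same-left x∈ x′∈ y∈ y′∈ eq = +ᵖ-cancelˡ a₀ (none x∈ x′∈ y∈ y′∈ (shuffle eq))
    both-equal : ∀ {x y x′ y′} → M (left , x) → M (left , x′) → M (right , y) → M (right , y′) → x +ᵖ y ≡ x′ +ᵖ y′ →
                 x ≡ x′ × y ≡ y′
    both-equal {x} {y} {x′} {y′} x∈ x′∈ y∈ y′∈ eq with same-left x∈ x′∈ y∈ y′∈ eq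
    ... | refl = refl , +ᵖ-cancelˡ x eq
    sidon : Sidon M
    sidon {left , x} {right , y} {left , x′} {right , y′} x∈ y∈ x′∈ y′∈ _ _ eq with both-equal x∈ x′∈ y∈ y′∈ eq
    ... | refl , refl = inj₁ (refl , refl)
    sidon {left , x} {right , y} {right , y′} {left , x′} x∈ y∈ y′∈ x′∈ _ _ eq
      with both-equal x∈ x′∈ y∈ y′∈ (trans eq (+ᵖ-comm y′ x′))
    ... | refl , refl = inj₂ (refl , refl)
    sidon {right , y} {left , x} {left , x′} {right , y′} y∈ x∈ x′∈ y′∈ _ _ eq
      with both-equal x∈ x′∈ y∈ y′∈ (trans (+ᵖ-comm x y) eq)
    ... | refl , refl = inj₂ (refl , refl)
    sidon {right , y} {left , x} {right , y′} {left , x′} y∈ x∈ y′∈ x′∈ _ _ eq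
      with both-equal x∈ x′∈ y∈ y′∈ (trans (+ᵖ-comm x y) (trans eq (+ᵖ-comm y′ x′)))
    ... | refl , refl = inj₁ (refl , refl)
    0∈a : M (left , 0ᵖ)
    0∈a = here (+ᵖ-identityʳ a₀)
    0∈b : M (right , 0ᵖ)
    0∈b = here (+ᵖ-identityʳ b₀)
    u∈ : M (left , u)
    u∈ = there (here (add-difference a₁ a₀))
    v∈ : M (right , v)
    v∈ = there (here (add-difference b₁ b₀))
    u≢0 : u ≢ 0ᵖ
    u≢0 e = All.head (AllPairs.head uA) (sym (difference-zero e))
    v≢0 : v ≢ 0ᵖ
    v≢0 e = All.head (AllPairs.head uB) (sym (difference-zero e))

  -- A coincidence `a + b = a′ + b′` gives `a′ - a = b - b′`, the common edge `u`. The base points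
  -- are therefore `a` on one side and `b′`, not `b`, on the other.
  align : ∀ as bs → length as ≡ 5 → length bs ≡ 5 → Unique as → Unique bs → (∀ {a b} → a ∈ as → b ∈ bs → I (a +ᵖ b)) →
          ∃ λ a → ∃ λ b → ∃ λ ts → as ↭ map (a +ᵖ_) ts × bs ↭ map (b +ᵖ_) ts
  align as bs |as| |bs| uA uB sum with coincidence? as bs
  ... | inj₂ none = ⊥-elim (coincidence-free⇒⊥ as bs |as| |bs| uA uB sum none)
  ... | inj₁ (a , a′ , b , b′ , a∈ , a′∈ , b∈ , b′∈ , a≢a′ , eq) = go (two-front a∈ a′∈ a≢a′) (two-front b′∈ b∈ b′≢b)
    where
    two-front : ∀ {x y : Pt} {xs} → x ∈ xs → y ∈ xs → x ≢ y → ∃ λ zs → xs ↭ x ∷ y ∷ zs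
    two-front x∈ y∈ x≢y with ∈-front x∈
    ... | ys , p with ↭ₚ.∈-resp-↭ p y∈
    ...   | here refl = ⊥-elim (x≢y refl)
    ...   | there y∈ys with ∈-front y∈ys
    ...     | zs , q = zs , ↭-trans p (prep _ q)
    b′≢b : b′ ≢ b
    b′≢b refl = a≢a′ (+ᵖ-cancelʳ b eq)
    u = a′ -ᵖ a
    u≢0 : u ≢ 0ᵖ
    u≢0 e = a≢a′ (sym (difference-zero e))
    b′+u : b′ +ᵖ u ≡ b
    b′+u = +ᵖ-cancelˡ a (begin
      a +ᵖ (b′ +ᵖ u) ≡⟨ cong (a +ᵖ_) (+ᵖ-comm b′ u) ⟩
      a +ᵖ (u +ᵖ b′) ≡⟨ +ᵖ-assoc a u b′ ⟨
      (a +ᵖ u) +ᵖ b′ ≡⟨ cong (_+ᵖ b′) (add-difference a′ a) ⟩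
      a′ +ᵖ b′ ≡⟨ eq ⟨
      a +ᵖ b ∎)
      where open ≡-Reasoning
    go : (∃ λ as₂ → as ↭ a ∷ a′ ∷ as₂) → (∃ λ bs₂ → bs ↭ b′ ∷ b ∷ bs₂) →
         ∃ λ a → ∃ λ b → ∃ λ ts → as ↭ map (a +ᵖ_) ts × bs ↭ map (b +ᵖ_) ts
    go (as₂ , pa) (bs₂ , pb) with split (map (_-ᵖ a) as₂) (map (_-ᵖ b′) bs₂)
    ... | cs , xs , ys , px , py , disj
      with C.same-completion cs xs ys (Allₚ.++⁻ˡ cs allA) (Allₚ.++⁻ˡ cs allB) (Allₚ.++⁻ʳ cs allA) (Allₚ.++⁻ʳ cs allB) uA′ uB′ disj
             (len |as| pa px) (len |bs| pb py)
      where
      A B : Pt → Set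
      A x = a +ᵖ x ∈ as
      B y = b′ +ᵖ y ∈ bs
      module C = Common (Thin-shift (a +ᵖ b′) thin) {A} {B}
        (λ {x} {y} x∈ y∈ → subst I (sym (+ᵖ-interchange a b′ x y)) (sum x∈ y∈))
        (subst (_∈ as) (sym (+ᵖ-identityʳ a)) a∈) (subst (_∈ bs) (sym (+ᵖ-identityʳ b′)) b′∈)
        {u} (subst (_∈ as) (sym (add-difference a′ a)) a′∈) (subst (_∈ bs) (sym b′+u) b∈) u≢0
      allA : All A (cs ++ xs)
      allA = ↭ₚ.All-resp-↭ px (translates-back a as₂ (↭ₚ.∈-resp-↭ (↭-sym pa) ∘ there ∘ there))
      allB : All B (cs ++ ys)
      allB = ↭ₚ.All-resp-↭ py (translates-back b′ bs₂ (↭ₚ.∈-resp-↭ (↭-sym pb) ∘ there ∘ there))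
      uA′ : Unique (0ᵖ ∷ u ∷ cs ++ xs)
      uA′ = Unique-resp-↭ (prep 0ᵖ (prep u px)) (subst (λ z → Unique (z ∷ u ∷ map (_-ᵖ a) as₂)) (difference-self a)
              (Uniqueₚ.map⁺ (-ᵖ-injective a) (Unique-resp-↭ pa uA)))
      uB′ : Unique (0ᵖ ∷ u ∷ cs ++ ys)
      uB′ = Unique-resp-↭ (prep 0ᵖ (prep u py)) (subst₂ (λ z w → Unique (z ∷ w ∷ map (_-ᵖ b′) bs₂)) (difference-self b′)
              (trans (cong (_-ᵖ b′) (sym b′+u)) (add-subtract u b′))
              (Uniqueₚ.map⁺ (-ᵖ-injective b′) (Unique-resp-↭ pb uB)))
      len : ∀ {cs x y zs c us} → length cs ≡ 5 → cs ↭ x ∷ y ∷ zs → map (_-ᵖ c) zs ↭ us → length us ≡ 3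
      len {zs = zs} {c} n p q = trans (sym (↭ₚ.↭-length q)) (trans (Listₚ.length-map (_-ᵖ c) zs)
        (ℕₚ.suc-injective (ℕₚ.suc-injective (trans (sym (↭ₚ.↭-length p)) n))))
    ... | refl , refl = a , b′ , 0ᵖ ∷ u ∷ cs
      , ↭-trans pa (back a (add-difference a′ a) px)
      , ↭-trans pb (back b′ b′+u py)
      where
      back : ∀ c {d zs} → c +ᵖ u ≡ d → map (_-ᵖ c) zs ↭ cs ++ [] → c ∷ d ∷ zs ↭ map (c +ᵖ_) (0ᵖ ∷ u ∷ cs)
      back c {zs = zs} refl p = subst (λ z → c ∷ c +ᵖ u ∷ zs ↭ z ∷ c +ᵖ u ∷ map (c +ᵖ_) cs) (sym (+ᵖ-identityʳ c))
        (prep c (prep (c +ᵖ u) (subst₂ _↭_ (translate-back c zs) (cong (map (c +ᵖ_)) (Listₚ.++-identityʳ cs)) (↭ₚ.map⁺ (c +ᵖ_) p))))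

-- Integer combinations of three vectors

at₁ at₂ : Pt → ℤ
at₁ = V.head ∘ V.tail
at₂ = V.head ∘ V.tail ∘ V.tail

comb : Pt → Pt → Pt → Pt → Pt
comb f₁ f₂ f₃ (x ∷ y ∷ z ∷ []) = (x ·ᵖ f₁) +ᵖ ((y ·ᵖ f₂) +ᵖ (z ·ᵖ f₃))

comb-+-ring : ∀ a b c x y z x′ y′ z′ → (x + x′) * a + ((y + y′) * b + (z + z′) * c)
  ≡ (x * a + (y * b + z * c)) + (x′ * a + (y′ * b + z′ * c))
comb-+-ring = solve-∀

comb-+ : ∀ f₁ f₂ f₃ c d → comb f₁ f₂ f₃ (c +ᵖ d) ≡ comb f₁ f₂ f₃ c +ᵖ comb f₁ f₂ f₃ d
comb-+ (a ∷ b ∷ c ∷ []) (a′ ∷ b′ ∷ c′ ∷ []) (a″ ∷ b″ ∷ c″ ∷ []) (x ∷ y ∷ z ∷ []) (x′ ∷ y′ ∷ z′ ∷ []) =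
  pointwise (comb-+-ring a a′ a″ x y z x′ y′ z′) (comb-+-ring b b′ b″ x y z x′ y′ z′) (comb-+-ring c c′ c″ x y z x′ y′ z′)

comb-difference-ring : ∀ a b c x y z x′ y′ z′ → (x - x′) * a + ((y - y′) * b + (z - z′) * c)
  ≡ (x * a + (y * b + z * c)) - (x′ * a + (y′ * b + z′ * c))
comb-difference-ring = solve-∀

comb-difference : ∀ f₁ f₂ f₃ c d → comb f₁ f₂ f₃ (c -ᵖ d) ≡ comb f₁ f₂ f₃ c -ᵖ comb f₁ f₂ f₃ d
comb-difference (a ∷ b ∷ c ∷ []) (a′ ∷ b′ ∷ c′ ∷ []) (a″ ∷ b″ ∷ c″ ∷ []) (x ∷ y ∷ z ∷ []) (x′ ∷ y′ ∷ z′ ∷ []) =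
  pointwise (comb-difference-ring a a′ a″ x y z x′ y′ z′) (comb-difference-ring b b′ b″ x y z x′ y′ z′) (comb-difference-ring c c′ c″ x y z x′ y′ z′)

comb-zero : ∀ f₁ f₂ f₃ → comb f₁ f₂ f₃ 0ᵖ ≡ 0ᵖ
comb-zero (_ ∷ _ ∷ _ ∷ []) (_ ∷ _ ∷ _ ∷ []) (_ ∷ _ ∷ _ ∷ []) = refl

comb-e₁ : ∀ f₁ f₂ f₃ → comb f₁ f₂ f₃ e₁ ≡ f₁
comb-e₁ (a ∷ b ∷ c ∷ []) (a′ ∷ b′ ∷ c′ ∷ []) (a″ ∷ b″ ∷ c″ ∷ []) = pointwise (h a a′ a″) (h b b′ b″) (h c c′ c″)
  where
  h : ∀ (a b c : ℤ) → + 1 * a + (+ 0 * b + + 0 * c) ≡ a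
  h = solve-∀

comb-e₂ : ∀ f₁ f₂ f₃ → comb f₁ f₂ f₃ e₂ ≡ f₂
comb-e₂ (a ∷ b ∷ c ∷ []) (a′ ∷ b′ ∷ c′ ∷ []) (a″ ∷ b″ ∷ c″ ∷ []) = pointwise (h a a′ a″) (h b b′ b″) (h c c′ c″)
  where
  h : ∀ (a b c : ℤ) → + 0 * a + (+ 1 * b + + 0 * c) ≡ b
  h = solve-∀

comb-e₃ : ∀ f₁ f₂ f₃ → comb f₁ f₂ f₃ e₃ ≡ f₃
comb-e₃ (a ∷ b ∷ c ∷ []) (a′ ∷ b′ ∷ c′ ∷ []) (a″ ∷ b″ ∷ c″ ∷ []) = pointwise (h a a′ a″) (h b b′ b″) (h c c′ c″)
  where
  h : ∀ (a b c : ℤ) → + 0 * a + (+ 0 * b + + 1 * c) ≡ c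
  h = solve-∀

comb-e₄-ring : ∀ (a b c d : ℤ) → -[1+ 0 ] * a + (-[1+ 0 ] * b + -[1+ 0 ] * c) ≡ d - (a + (b + (c + d)))
comb-e₄-ring = solve-∀

comb-e₄ : ∀ f₁ f₂ f₃ f₄ → f₁ +ᵖ (f₂ +ᵖ (f₃ +ᵖ f₄)) ≡ 0ᵖ → comb f₁ f₂ f₃ e₄ ≡ f₄
comb-e₄ f₁ f₂ f₃ f₄ balanced = trans (h f₁ f₂ f₃ f₄) (trans (cong (f₄ -ᵖ_) balanced) (trans (sym (+ᵖ-identityʳ (f₄ -ᵖ 0ᵖ))) (difference-add f₄ 0ᵖ)))
  where
  h : ∀ f₁ f₂ f₃ f₄ → comb f₁ f₂ f₃ e₄ ≡ f₄ -ᵖ (f₁ +ᵖ (f₂ +ᵖ (f₃ +ᵖ f₄)))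
  h (a ∷ b ∷ c ∷ []) (a′ ∷ b′ ∷ c′ ∷ []) (a″ ∷ b″ ∷ c″ ∷ []) (a‴ ∷ b‴ ∷ c‴ ∷ []) =
    pointwise (comb-e₄-ring a a′ a″ a‴) (comb-e₄-ring b b′ b″ b‴) (comb-e₄-ring c c′ c″ c‴)

cross : Pt → Pt → Pt
cross (a ∷ b ∷ c ∷ []) (a′ ∷ b′ ∷ c′ ∷ []) =
  (b * c′ - c * b′) ∷ (c * a′ - a * c′) ∷ (a * b′ - b * a′) ∷ []

_∙_ : Pt → Pt → ℤ
(a ∷ b ∷ c ∷ []) ∙ (x ∷ y ∷ z ∷ []) = a * x + (b * y + c * z)

∙-+-ring : ∀ a b c x y z x′ y′ z′ → a * (x + x′) + (b * (y + y′) + c * (z + z′))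
  ≡ (a * x + (b * y + c * z)) + (a * x′ + (b * y′ + c * z′))
∙-+-ring = solve-∀

∙-+ : ∀ n x y → n ∙ (x +ᵖ y) ≡ n ∙ x + n ∙ y
∙-+ (a ∷ b ∷ c ∷ []) (x ∷ y ∷ z ∷ []) (x′ ∷ y′ ∷ z′ ∷ []) = ∙-+-ring a b c x y z x′ y′ z′

det : Pt → Pt → Pt → ℤ
det f₁ f₂ f₃ = f₁ ∙ cross f₂ f₃

-- Cramer's rule: the coordinates with respect to f₁, f₂, f₃, multiplied by the determinant.
coordinates : Pt → Pt → Pt → Pt → Pt
coordinates f₁ f₂ f₃ z = (cross f₂ f₃ ∙ z) ∷ (cross f₃ f₁ ∙ z) ∷ (cross f₁ f₂ ∙ z) ∷ []

transpose-ring : ∀ m₁ m₂ m₃ n₁ n₂ n₃ p₁ p₂ p₃ a b c x y z →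
  (m₁ * x + (m₂ * y + m₃ * z)) * a +
  ((n₁ * x + (n₂ * y + n₃ * z)) * b + (p₁ * x + (p₂ * y + p₃ * z)) * c)
  ≡ (a * m₁ + (b * n₁ + c * p₁)) * x +
    ((a * m₂ + (b * n₂ + c * p₂)) * y + (a * m₃ + (b * n₃ + c * p₃)) * z)
transpose-ring = solve-∀

∙-transpose : ∀ m n p z a b c → (m ∙ z) * a + ((n ∙ z) * b + (p ∙ z) * c) ≡ comb m n p (a ∷ b ∷ c ∷ []) ∙ z
∙-transpose (m₁ ∷ m₂ ∷ m₃ ∷ []) (n₁ ∷ n₂ ∷ n₃ ∷ []) (p₁ ∷ p₂ ∷ p₃ ∷ []) (x ∷ y ∷ z ∷ []) a b c =
  transpose-ring m₁ m₂ m₃ n₁ n₂ n₃ p₁ p₂ p₃ a b c x y z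

-- First of the nine entries of `M adj M = det M`, where `M` has columns `f₁`, `f₂`, `f₃` and the
-- rows of `adj M` are the cross products.
adjugate₁₁ : ∀ (a b c a′ b′ c′ a″ b″ c″ : ℤ) → a * (b′ * c″ - c′ * b″) + (a′ * (b″ * c - c″ * b) + a″ * (b * c′ - c * b′))
  ≡ a * (b′ * c″ - c′ * b″) + (b * (c′ * a″ - a′ * c″) + c * (a′ * b″ - b′ * a″))
adjugate₁₁ = solve-∀

adjugate₁₂ : ∀ (a b c a′ b′ c′ a″ b″ c″ : ℤ) → a * (c′ * a″ - a′ * c″) + (a′ * (c″ * a - a″ * c) + a″ * (c * a′ - a * c′))
  ≡ + 0
adjugate₁₂ = solve-∀

adjugate₁₃ : ∀ (a b c a′ b′ c′ a″ b″ c″ : ℤ) → a * (a′ * b″ - b′ * a″) + (a′ * (a″ * b - b″ * a) + a″ * (a * b′ - b * a′))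
  ≡ + 0
adjugate₁₃ = solve-∀

adjugate₂₁ : ∀ (a b c a′ b′ c′ a″ b″ c″ : ℤ) → b * (b′ * c″ - c′ * b″) + (b′ * (b″ * c - c″ * b) + b″ * (b * c′ - c * b′))
  ≡ + 0
adjugate₂₁ = solve-∀

adjugate₂₂ : ∀ (a b c a′ b′ c′ a″ b″ c″ : ℤ) → b * (c′ * a″ - a′ * c″) + (b′ * (c″ * a - a″ * c) + b″ * (c * a′ - a * c′))
  ≡ a * (b′ * c″ - c′ * b″) + (b * (c′ * a″ - a′ * c″) + c * (a′ * b″ - b′ * a″))
adjugate₂₂ = solve-∀

adjugate₂₃ : ∀ (a b c a′ b′ c′ a″ b″ c″ : ℤ) → b * (a′ * b″ - b′ * a″) + (b′ * (a″ * b - b″ * a) + b″ * (a * b′ - b * a′))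
  ≡ + 0
adjugate₂₃ = solve-∀

adjugate₃₁ : ∀ (a b c a′ b′ c′ a″ b″ c″ : ℤ) → c * (b′ * c″ - c′ * b″) + (c′ * (b″ * c - c″ * b) + c″ * (b * c′ - c * b′))
  ≡ + 0
adjugate₃₁ = solve-∀

adjugate₃₂ : ∀ (a b c a′ b′ c′ a″ b″ c″ : ℤ) → c * (c′ * a″ - a′ * c″) + (c′ * (c″ * a - a″ * c) + c″ * (c * a′ - a * c′))
  ≡ + 0
adjugate₃₂ = solve-∀

adjugate₃₃ : ∀ (a b c a′ b′ c′ a″ b″ c″ : ℤ) → c * (a′ * b″ - b′ * a″) + (c′ * (a″ * b - b″ * a) + c″ * (a * b′ - b * a′))
  ≡ a * (b′ * c″ - c′ * b″) + (b * (c′ * a″ - a′ * c″) + c * (a′ * b″ - b′ * a″))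
adjugate₃₃ = solve-∀

ext : ∀ {x y : Pt} → V.head x ≡ V.head y → at₁ x ≡ at₁ y →
      at₂ x ≡ at₂ y → x ≡ y
ext {_ ∷ _ ∷ _ ∷ []} {_ ∷ _ ∷ _ ∷ []} refl refl refl = refl

adjugate₁ : ∀ f₁ f₂ f₃ → comb (cross f₂ f₃) (cross f₃ f₁) (cross f₁ f₂) (V.head f₁ ∷ V.head f₂ ∷ V.head f₃ ∷ []) ≡ det f₁ f₂ f₃ ∷ + 0 ∷ + 0 ∷ []
adjugate₁ f₁ f₂ f₃ = ext (h₁ f₁ f₂ f₃) (h₂ f₁ f₂ f₃) (h₃ f₁ f₂ f₃)
  where
  h₁ : ∀ f₁ f₂ f₃ → V.head (comb (cross f₂ f₃) (cross f₃ f₁) (cross f₁ f₂) (V.head f₁ ∷ V.head f₂ ∷ V.head f₃ ∷ [])) ≡ det f₁ f₂ f₃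
  h₁ (a ∷ b ∷ c ∷ []) (a′ ∷ b′ ∷ c′ ∷ []) (a″ ∷ b″ ∷ c″ ∷ []) = adjugate₁₁ a b c a′ b′ c′ a″ b″ c″
  h₂ : ∀ f₁ f₂ f₃ → at₁ (comb (cross f₂ f₃) (cross f₃ f₁) (cross f₁ f₂) (V.head f₁ ∷ V.head f₂ ∷ V.head f₃ ∷ [])) ≡ + 0
  h₂ (a ∷ b ∷ c ∷ []) (a′ ∷ b′ ∷ c′ ∷ []) (a″ ∷ b″ ∷ c″ ∷ []) = adjugate₁₂ a b c a′ b′ c′ a″ b″ c″
  h₃ : ∀ f₁ f₂ f₃ → at₂ (comb (cross f₂ f₃) (cross f₃ f₁) (cross f₁ f₂) (V.head f₁ ∷ V.head f₂ ∷ V.head f₃ ∷ [])) ≡ + 0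
  h₃ (a ∷ b ∷ c ∷ []) (a′ ∷ b′ ∷ c′ ∷ []) (a″ ∷ b″ ∷ c″ ∷ []) = adjugate₁₃ a b c a′ b′ c′ a″ b″ c″

adjugate₂ : ∀ f₁ f₂ f₃ → comb (cross f₂ f₃) (cross f₃ f₁) (cross f₁ f₂) (at₁ f₁ ∷ at₁ f₂ ∷ at₁ f₃ ∷ []) ≡ + 0 ∷ det f₁ f₂ f₃ ∷ + 0 ∷ []
adjugate₂ f₁ f₂ f₃ = ext (h₁ f₁ f₂ f₃) (h₂ f₁ f₂ f₃) (h₃ f₁ f₂ f₃)
  where
  h₁ : ∀ f₁ f₂ f₃ → V.head (comb (cross f₂ f₃) (cross f₃ f₁) (cross f₁ f₂) (at₁ f₁ ∷ at₁ f₂ ∷ at₁ f₃ ∷ [])) ≡ + 0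
  h₁ (a ∷ b ∷ c ∷ []) (a′ ∷ b′ ∷ c′ ∷ []) (a″ ∷ b″ ∷ c″ ∷ []) = adjugate₂₁ a b c a′ b′ c′ a″ b″ c″
  h₂ : ∀ f₁ f₂ f₃ → at₁ (comb (cross f₂ f₃) (cross f₃ f₁) (cross f₁ f₂) (at₁ f₁ ∷ at₁ f₂ ∷ at₁ f₃ ∷ [])) ≡ det f₁ f₂ f₃
  h₂ (a ∷ b ∷ c ∷ []) (a′ ∷ b′ ∷ c′ ∷ []) (a″ ∷ b″ ∷ c″ ∷ []) = adjugate₂₂ a b c a′ b′ c′ a″ b″ c″
  h₃ : ∀ f₁ f₂ f₃ → at₂ (comb (cross f₂ f₃) (cross f₃ f₁) (cross f₁ f₂) (at₁ f₁ ∷ at₁ f₂ ∷ at₁ f₃ ∷ [])) ≡ + 0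
  h₃ (a ∷ b ∷ c ∷ []) (a′ ∷ b′ ∷ c′ ∷ []) (a″ ∷ b″ ∷ c″ ∷ []) = adjugate₂₃ a b c a′ b′ c′ a″ b″ c″

adjugate₃ : ∀ f₁ f₂ f₃ → comb (cross f₂ f₃) (cross f₃ f₁) (cross f₁ f₂) (at₂ f₁ ∷ at₂ f₂ ∷ at₂ f₃ ∷ []) ≡ + 0 ∷ + 0 ∷ det f₁ f₂ f₃ ∷ []
adjugate₃ f₁ f₂ f₃ = ext (h₁ f₁ f₂ f₃) (h₂ f₁ f₂ f₃) (h₃ f₁ f₂ f₃)
  where
  h₁ : ∀ f₁ f₂ f₃ → V.head (comb (cross f₂ f₃) (cross f₃ f₁) (cross f₁ f₂) (at₂ f₁ ∷ at₂ f₂ ∷ at₂ f₃ ∷ [])) ≡ + 0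
  h₁ (a ∷ b ∷ c ∷ []) (a′ ∷ b′ ∷ c′ ∷ []) (a″ ∷ b″ ∷ c″ ∷ []) = adjugate₃₁ a b c a′ b′ c′ a″ b″ c″
  h₂ : ∀ f₁ f₂ f₃ → at₁ (comb (cross f₂ f₃) (cross f₃ f₁) (cross f₁ f₂) (at₂ f₁ ∷ at₂ f₂ ∷ at₂ f₃ ∷ [])) ≡ + 0
  h₂ (a ∷ b ∷ c ∷ []) (a′ ∷ b′ ∷ c′ ∷ []) (a″ ∷ b″ ∷ c″ ∷ []) = adjugate₃₂ a b c a′ b′ c′ a″ b″ c″
  h₃ : ∀ f₁ f₂ f₃ → at₂ (comb (cross f₂ f₃) (cross f₃ f₁) (cross f₁ f₂) (at₂ f₁ ∷ at₂ f₂ ∷ at₂ f₃ ∷ [])) ≡ det f₁ f₂ f₃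
  h₃ (a ∷ b ∷ c ∷ []) (a′ ∷ b′ ∷ c′ ∷ []) (a″ ∷ b″ ∷ c″ ∷ []) = adjugate₃₃ a b c a′ b′ c′ a″ b″ c″

axis₁ : ∀ d z → (d ∷ + 0 ∷ + 0 ∷ []) ∙ z ≡ V.head (d ·ᵖ z)
axis₁ d (x ∷ y ∷ z ∷ []) = ring d x y z
  where
  ring : ∀ d x y z → d * x + (+ 0 * y + + 0 * z) ≡ d * x
  ring = solve-∀

comb₁ : ∀ f₁ f₂ f₃ x y z → V.head (comb f₁ f₂ f₃ (x ∷ y ∷ z ∷ [])) ≡
  x * V.head f₁ + (y * V.head f₂ + z * V.head f₃)
comb₁ (_ ∷ _ ∷ _ ∷ []) (_ ∷ _ ∷ _ ∷ []) (_ ∷ _ ∷ _ ∷ []) x y z = refl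

axis₂ : ∀ d z → (+ 0 ∷ d ∷ + 0 ∷ []) ∙ z ≡ at₁ (d ·ᵖ z)
axis₂ d (x ∷ y ∷ z ∷ []) = ring d x y z
  where
  ring : ∀ d x y z → + 0 * x + (d * y + + 0 * z) ≡ d * y
  ring = solve-∀

comb₂ : ∀ f₁ f₂ f₃ x y z → at₁ (comb f₁ f₂ f₃ (x ∷ y ∷ z ∷ [])) ≡
  x * at₁ f₁ + (y * at₁ f₂ + z * at₁ f₃)
comb₂ (_ ∷ _ ∷ _ ∷ []) (_ ∷ _ ∷ _ ∷ []) (_ ∷ _ ∷ _ ∷ []) x y z = refl

axis₃ : ∀ d z → (+ 0 ∷ + 0 ∷ d ∷ []) ∙ z ≡ at₂ (d ·ᵖ z)
axis₃ d (x ∷ y ∷ z ∷ []) = ring d x y z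
  where
  ring : ∀ d x y z → + 0 * x + (+ 0 * y + d * z) ≡ d * z
  ring = solve-∀

comb₃ : ∀ f₁ f₂ f₃ x y z → at₂ (comb f₁ f₂ f₃ (x ∷ y ∷ z ∷ [])) ≡
  x * at₂ f₁ + (y * at₂ f₂ + z * at₂ f₃)
comb₃ (_ ∷ _ ∷ _ ∷ []) (_ ∷ _ ∷ _ ∷ []) (_ ∷ _ ∷ _ ∷ []) x y z = refl

cramer : ∀ f₁ f₂ f₃ z → comb f₁ f₂ f₃ (coordinates f₁ f₂ f₃ z) ≡ det f₁ f₂ f₃ ·ᵖ z
cramer f₁ f₂ f₃ z = ext
    (trans (comb₁ f₁ f₂ f₃ (cross f₂ f₃ ∙ z) (cross f₃ f₁ ∙ z) (cross f₁ f₂ ∙ z))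
      (row (V.head f₁) (V.head f₂) (V.head f₃) (adjugate₁ f₁ f₂ f₃) (axis₁ (det f₁ f₂ f₃) z)))
    (trans (comb₂ f₁ f₂ f₃ (cross f₂ f₃ ∙ z) (cross f₃ f₁ ∙ z) (cross f₁ f₂ ∙ z))
      (row (at₁ f₁) (at₁ f₂) (at₁ f₃) (adjugate₂ f₁ f₂ f₃) (axis₂ (det f₁ f₂ f₃) z)))
    (trans (comb₃ f₁ f₂ f₃ (cross f₂ f₃ ∙ z) (cross f₃ f₁ ∙ z) (cross f₁ f₂ ∙ z))
      (row (at₂ f₁) (at₂ f₂) (at₂ f₃) (adjugate₃ f₁ f₂ f₃) (axis₃ (det f₁ f₂ f₃) z)))
  where
  row : ∀ p q r {v d} → comb (cross f₂ f₃) (cross f₃ f₁) (cross f₁ f₂) (p ∷ q ∷ r ∷ []) ≡ v → v ∙ z ≡ d →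
        (cross f₂ f₃ ∙ z) * p + ((cross f₃ f₁ ∙ z) * q + (cross f₁ f₂ ∙ z) * r) ≡ d
  row p q r refl eq = trans (∙-transpose (cross f₂ f₃) (cross f₃ f₁) (cross f₁ f₂) z p q r) eq

∙-comb-ring : ∀ a b c p q r p′ q′ r′ p″ q″ r″ x y z →
  a * (x * p + (y * p′ + z * p″)) +
    (b * (x * q + (y * q′ + z * q″)) + c * (x * r + (y * r′ + z * r″)))
  ≡ x * (a * p + (b * q + c * r)) +
    (y * (a * p′ + (b * q′ + c * r′)) + z * (a * p″ + (b * q″ + c * r″)))
∙-comb-ring = solve-∀

∙-comb : ∀ n f₁ f₂ f₃ x y z → n ∙ comb f₁ f₂ f₃ (x ∷ y ∷ z ∷ []) ≡ x * (n ∙ f₁) + (y * (n ∙ f₂) + z * (n ∙ f₃))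
∙-comb (a ∷ b ∷ c ∷ []) (p ∷ q ∷ r ∷ []) (p′ ∷ q′ ∷ r′ ∷ []) (p″ ∷ q″ ∷ r″ ∷ []) x y z =
  ∙-comb-ring a b c p q r p′ q′ r′ p″ q″ r″ x y z

cross-∙ˡ-ring : ∀ a b c a′ b′ c′ → (b * c′ - c * b′) * a + ((c * a′ - a * c′) * b + (a * b′ - b * a′) * c) ≡ + 0
cross-∙ˡ-ring = solve-∀

cross-∙ˡ : ∀ x y → cross x y ∙ x ≡ + 0
cross-∙ˡ (a ∷ b ∷ c ∷ []) (a′ ∷ b′ ∷ c′ ∷ []) = cross-∙ˡ-ring a b c a′ b′ c′

cross-∙ʳ-ring : ∀ a b c a′ b′ c′ → (b * c′ - c * b′) * a′ + ((c * a′ - a * c′) * b′ + (a * b′ - b * a′) * c′) ≡ + 0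
cross-∙ʳ-ring = solve-∀

cross-∙ʳ : ∀ x y → cross x y ∙ y ≡ + 0
cross-∙ʳ (a ∷ b ∷ c ∷ []) (a′ ∷ b′ ∷ c′ ∷ []) = cross-∙ʳ-ring a b c a′ b′ c′

∙-comm : ∀ x y → x ∙ y ≡ y ∙ x
∙-comm (a ∷ b ∷ c ∷ []) (x ∷ y ∷ z ∷ []) = cong₂ _+_ (ℤₚ.*-comm a x) (cong₂ _+_ (ℤₚ.*-comm b y) (ℤₚ.*-comm c z))

cross-cycle-ring : ∀ a b c a′ b′ c′ a″ b″ c″ →
  (b * c′ - c * b′) * a″ + ((c * a′ - a * c′) * b″ + (a * b′ - b * a′) * c″)
  ≡ (b′ * c″ - c′ * b″) * a + ((c′ * a″ - a′ * c″) * b + (a′ * b″ - b′ * a″) * c)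
cross-cycle-ring = solve-∀

cross-cycle : ∀ x y z → cross x y ∙ z ≡ cross y z ∙ x
cross-cycle (a ∷ b ∷ c ∷ []) (a′ ∷ b′ ∷ c′ ∷ []) (a″ ∷ b″ ∷ c″ ∷ []) = cross-cycle-ring a b c a′ b′ c′ a″ b″ c″

coordinates₁ : ∀ f₁ f₂ f₃ → coordinates f₁ f₂ f₃ f₁ ≡ det f₁ f₂ f₃ ∷ + 0 ∷ + 0 ∷ []
coordinates₁ f₁ f₂ f₃ = pointwise (∙-comm (cross f₂ f₃) f₁) (cross-∙ʳ f₃ f₁) (cross-∙ˡ f₁ f₂)

coordinates₂ : ∀ f₁ f₂ f₃ → coordinates f₁ f₂ f₃ f₂ ≡ + 0 ∷ det f₁ f₂ f₃ ∷ + 0 ∷ []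
coordinates₂ f₁ f₂ f₃ = pointwise (cross-∙ˡ f₂ f₃)
  (trans (cross-cycle f₃ f₁ f₂) (trans (cross-cycle f₁ f₂ f₃) (∙-comm (cross f₂ f₃) f₁))) (cross-∙ʳ f₁ f₂)

coordinates₃ : ∀ f₁ f₂ f₃ → coordinates f₁ f₂ f₃ f₃ ≡ + 0 ∷ + 0 ∷ det f₁ f₂ f₃ ∷ []
coordinates₃ f₁ f₂ f₃ = pointwise (cross-∙ʳ f₂ f₃) (cross-∙ˡ f₃ f₁)
  (trans (cross-cycle f₁ f₂ f₃) (∙-comm (cross f₂ f₃) f₁))

-- The opposite product `adj M M = det M`, from which injectivity of `comb` follows when the
-- determinant is nonzero.
coordinates-comb : ∀ f₁ f₂ f₃ c → coordinates f₁ f₂ f₃ (comb f₁ f₂ f₃ c) ≡ det f₁ f₂ f₃ ·ᵖ c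
coordinates-comb f₁ f₂ f₃ c = ext
    (expand (cross f₂ f₃) c (cong V.head c₁) (cong V.head c₂) (cong V.head c₃) (axis₁ (det f₁ f₂ f₃) c))
    (expand (cross f₃ f₁) c (cong at₁ c₁) (cong at₁ c₂) (cong at₁ c₃) (axis₂ (det f₁ f₂ f₃) c))
    (expand (cross f₁ f₂) c (cong at₂ c₁) (cong at₂ c₂) (cong at₂ c₃) (axis₃ (det f₁ f₂ f₃) c))
  where
  c₁ = coordinates₁ f₁ f₂ f₃
  c₂ = coordinates₂ f₁ f₂ f₃
  c₃ = coordinates₃ f₁ f₂ f₃
  expand : ∀ n c {d e g h} → n ∙ f₁ ≡ d → n ∙ f₂ ≡ e → n ∙ f₃ ≡ g → (d ∷ e ∷ g ∷ []) ∙ c ≡ h →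
           n ∙ comb f₁ f₂ f₃ c ≡ h
  expand n (x ∷ y ∷ z ∷ []) refl refl refl eq = trans (∙-comb n f₁ f₂ f₃ x y z) (trans
    (∙-comm (x ∷ y ∷ z ∷ []) (n ∙ f₁ ∷ n ∙ f₂ ∷ n ∙ f₃ ∷ [])) eq)

·ᵖ-cancelˡ : ∀ d .{{_ : ℤ.NonZero d}} {x y} → d ·ᵖ x ≡ d ·ᵖ y → x ≡ y
·ᵖ-cancelˡ d {a ∷ b ∷ c ∷ []} {a′ ∷ b′ ∷ c′ ∷ []} eq = pointwise
  (ℤₚ.*-cancelˡ-≡ d a a′ (cong V.head eq))
  (ℤₚ.*-cancelˡ-≡ d b b′ (cong at₁ eq))
  (ℤₚ.*-cancelˡ-≡ d c c′ (cong at₂ eq))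

comb-injective : ∀ f₁ f₂ f₃ .{{_ : ℤ.NonZero (det f₁ f₂ f₃)}} {c d} → comb f₁ f₂ f₃ c ≡ comb f₁ f₂ f₃ d → c ≡ d
comb-injective f₁ f₂ f₃ {c} {d} eq = ·ᵖ-cancelˡ (det f₁ f₂ f₃)
  (trans (sym (coordinates-comb f₁ f₂ f₃ c)) (trans (cong (coordinates f₁ f₂ f₃) eq) (coordinates-comb f₁ f₂ f₃ d)))

-- Parity of the determinant

parity-neg : ∀ x → parity (- x) ≡ parity x
parity-neg x = xor-zero (parity x) (parity (- x)) (trans (sym (parity-+ x (- x))) (cong parity (ℤₚ.+-inverseʳ x)))
  where
  xor-zero : ∀ a b → a xor b ≡ false → b ≡ a
  xor-zero false false _ = refl
  xor-zero true  true  _ = refl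

parity-minor : ∀ a b c d → parity (a * b - c * d) ≡ (parity a ∧ parity b) xor (parity c ∧ parity d)
parity-minor a b c d = trans (parity-+ (a * b) (- (c * d)))
  (cong₂ _xor_ (parity-* a b) (trans (parity-neg (c * d)) (parity-* c d)))

parity-det : ∀ f₁ f₂ f₃ → parity (det f₁ f₂ f₃) ≡ det₂ (res₂ f₁) (res₂ f₂) (res₂ f₃)
parity-det (a ∷ b ∷ c ∷ []) (a′ ∷ b′ ∷ c′ ∷ []) (a″ ∷ b″ ∷ c″ ∷ []) =
  trans (parity-+ (a * m₁) (b * m₂ + c * m₃)) (cong₂ _xor_ (term a b′ c″ c′ b″)
    (trans (parity-+ (b * m₂) (c * m₃)) (cong₂ _xor_ (term b c′ a″ a′ c″) (term c a′ b″ b′ a″))))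
  where
  m₁ = b′ * c″ - c′ * b″
  m₂ = c′ * a″ - a′ * c″
  m₃ = a′ * b″ - b′ * a″
  term : ∀ x a b c d → parity (x * (a * b - c * d)) ≡ parity x ∧ ((parity a ∧ parity b) xor (parity c ∧ parity d))
  term x a b c d = trans (parity-* x _) (cong (parity x ∧_) (parity-minor a b c d))

odd⇒nonZero : ∀ d → parity d ≡ true → ℤ.NonZero d
odd⇒nonZero (+ suc n)  _ = _
odd⇒nonZero -[1+ n ]   _ = _

-- Tetrahedra with barycentre 0

-- The tetrahedron is given by the four facet inequalities ℓ i z ≤ k + 1.
record Facets (f : Fin 4 → Pt) : Set where
  field
    k : ℕ
    ℓ : Fin 4 → Pt → ℤ
    additive : ∀ i x y → ℓ i (x +ᵖ y) ≡ ℓ i x + ℓ i y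
    vertex≤  : ∀ i j → ℓ i (f j) ℤ.≤ + suc k
    ℓ-total  : ∀ z → ℓ (# 0) z + (ℓ (# 1) z + (ℓ (# 2) z + ℓ (# 3) z)) ≡ + 0
    ℓ-combo  : ∀ z → (ℓ (# 0) z ·ᵖ f (# 0)) +ᵖ ((ℓ (# 1) z ·ᵖ f (# 1)) +ᵖ ((ℓ (# 2) z ·ᵖ f (# 2)) +ᵖ (ℓ (# 3) z ·ᵖ f (# 3))))
                 ≡ (- (+ 4 * + suc k)) ·ᵖ z

-- The facets of `K₁`: each functional equals 1 on the three vertices of its facet and -3 on the
-- opposite vertex.
facetWeight : Fin 4 → Pt
facetWeight zero                   = -[1+ 2 ] ∷ + 1 ∷ + 1 ∷ []
facetWeight (suc zero)             = + 1 ∷ -[1+ 2 ] ∷ + 1 ∷ []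
facetWeight (suc (suc zero))       = + 1 ∷ + 1 ∷ -[1+ 2 ] ∷ []
facetWeight (suc (suc (suc zero))) = + 1 ∷ + 1 ∷ + 1 ∷ []

facets-total-ring : ∀ (d x y z : ℤ) →
  d * (-[1+ 2 ] * x + (+ 1 * y + + 1 * z)) + (d * (+ 1 * x + (-[1+ 2 ] * y + + 1 * z)) +
  (d * (+ 1 * x + (+ 1 * y + -[1+ 2 ] * z)) + d * (+ 1 * x + (+ 1 * y + + 1 * z)))) ≡ + 0
facets-total-ring = solve-∀

facets-combo-ring : ∀ (d x y z a b c e : ℤ) →
  d * (-[1+ 2 ] * x + (+ 1 * y + + 1 * z)) * a + (d * (+ 1 * x + (-[1+ 2 ] * y + + 1 * z)) * b +
  (d * (+ 1 * x + (+ 1 * y + -[1+ 2 ] * z)) * c + d * (+ 1 * x + (+ 1 * y + + 1 * z)) * e))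
  ≡ d * (x + (y + z)) * (a + (b + (c + e))) + (- (+ 4 * d)) * (x * a + (y * b + z * c))
facets-combo-ring = solve-∀

facets-combo : ∀ (d x y z : ℤ) f₁ f₂ f₃ f₄ →
  ((d * (facetWeight (# 0) ∙ (x ∷ y ∷ z ∷ []))) ·ᵖ f₁) +ᵖ (((d * (facetWeight (# 1) ∙ (x ∷ y ∷ z ∷ []))) ·ᵖ f₂) +ᵖ
  (((d * (facetWeight (# 2) ∙ (x ∷ y ∷ z ∷ []))) ·ᵖ f₃) +ᵖ ((d * (facetWeight (# 3) ∙ (x ∷ y ∷ z ∷ []))) ·ᵖ f₄)))
  ≡ ((d * (x + (y + z))) ·ᵖ (f₁ +ᵖ (f₂ +ᵖ (f₃ +ᵖ f₄)))) +ᵖ ((- (+ 4 * d)) ·ᵖ comb f₁ f₂ f₃ (x ∷ y ∷ z ∷ []))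
facets-combo d x y z (a ∷ b ∷ c ∷ []) (a′ ∷ b′ ∷ c′ ∷ []) (a″ ∷ b″ ∷ c″ ∷ []) (a‴ ∷ b‴ ∷ c‴ ∷ []) = cong₂ _∷_
  (facets-combo-ring d x y z a a′ a″ a‴) (cong₂ _∷_ (facets-combo-ring d x y z b b′ b″ b‴)
    (cong (_∷ []) (facets-combo-ring d x y z c c′ c″ c‴)))

coordinates-+ : ∀ f₁ f₂ f₃ x y → coordinates f₁ f₂ f₃ (x +ᵖ y) ≡ coordinates f₁ f₂ f₃ x +ᵖ coordinates f₁ f₂ f₃ y
coordinates-+ f₁ f₂ f₃ x y = pointwise (∙-+ (cross f₂ f₃) x y) (∙-+ (cross f₃ f₁) x y) (∙-+ (cross f₁ f₂) x y)

·ᵖ-zeroʳ : ∀ n → n ·ᵖ 0ᵖ ≡ 0ᵖ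
·ᵖ-zeroʳ n = pointwise (ℤₚ.*-zeroʳ n) (ℤₚ.*-zeroʳ n) (ℤₚ.*-zeroʳ n)

·ᵖ-assoc : ∀ m n x → (m * n) ·ᵖ x ≡ m ·ᵖ (n ·ᵖ x)
·ᵖ-assoc m n (a ∷ b ∷ c ∷ []) = pointwise (ℤₚ.*-assoc m n a) (ℤₚ.*-assoc m n b) (ℤₚ.*-assoc m n c)

square-positive : ∀ d .{{_ : ℤ.NonZero d}} → ∃ λ k → d * d ≡ + suc k
square-positive (+ suc n)  = _ , refl
square-positive -[1+ n ]   = _ , refl

axis-value₁ : ∀ (d a b c : ℤ) → d * (a * d + (b * + 0 + c * + 0)) ≡ a * (d * d)
axis-value₁ = solve-∀

axis-value₂ : ∀ (d a b c : ℤ) → d * (a * + 0 + (b * d + c * + 0)) ≡ b * (d * d)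
axis-value₂ = solve-∀

axis-value₃ : ∀ (d a b c : ℤ) → d * (a * + 0 + (b * + 0 + c * d)) ≡ c * (d * d)
axis-value₃ = solve-∀

diagonal-value : ∀ (d a b c : ℤ) → d * (a * (- d) + (b * (- d) + c * (- d))) ≡ (- (a + (b + c))) * (d * d)
diagonal-value = solve-∀

solve-fourth : ∀ (d w : ℤ) → d + (+ 0 + (+ 0 + w)) ≡ + 0 → w ≡ - d
solve-fourth d w eq = trans (cancel d w) (trans (cong (_- d) eq) (ℤₚ.+-identityˡ (- d)))
  where
  cancel : ∀ d w → w ≡ (d + (+ 0 + (+ 0 + w))) - d
  cancel = solve-∀

module _ (f₁ f₂ f₃ f₄ : Pt) (balanced : f₁ +ᵖ (f₂ +ᵖ (f₃ +ᵖ f₄)) ≡ 0ᵖ) .{{nonZero : ℤ.NonZero (det f₁ f₂ f₃)}} where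

  private
    d = det f₁ f₂ f₃
    k = proj₁ (square-positive d)
    dd : d * d ≡ + suc k
    dd = proj₂ (square-positive d)
    X = coordinates f₁ f₂ f₃

  coordinates₄ : X f₄ ≡ - d ∷ - d ∷ - d ∷ []
  coordinates₄ = ext
      (solve-fourth d (cross f₂ f₃ ∙ f₄) (trans (cong V.head sum) (zeros (cross f₂ f₃))))
      (solve-fourth d (cross f₃ f₁ ∙ f₄) (trans (swap₁ d (cross f₃ f₁ ∙ f₄)) (trans (cong at₁ sum) (zeros (cross f₃ f₁)))))
      (solve-fourth d (cross f₁ f₂ ∙ f₄) (trans (swap₂ d (cross f₁ f₂ ∙ f₄)) (trans (cong at₂ sum) (zeros (cross f₁ f₂)))))
    where
    sum : (d ∷ + 0 ∷ + 0 ∷ []) +ᵖ ((+ 0 ∷ d ∷ + 0 ∷ []) +ᵖ ((+ 0 ∷ + 0 ∷ d ∷ []) +ᵖ X f₄)) ≡ X 0ᵖ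
    sum = begin
      (d ∷ + 0 ∷ + 0 ∷ []) +ᵖ ((+ 0 ∷ d ∷ + 0 ∷ []) +ᵖ ((+ 0 ∷ + 0 ∷ d ∷ []) +ᵖ X f₄))
        ≡⟨ cong₂ _+ᵖ_ (coordinates₁ f₁ f₂ f₃) (cong₂ _+ᵖ_ (coordinates₂ f₁ f₂ f₃) (cong (_+ᵖ X f₄) (coordinates₃ f₁ f₂ f₃))) ⟨
      X f₁ +ᵖ (X f₂ +ᵖ (X f₃ +ᵖ X f₄))
        ≡⟨ cong (X f₁ +ᵖ_) (trans (cong (X f₂ +ᵖ_) (sym (coordinates-+ f₁ f₂ f₃ f₃ f₄))) (sym (coordinates-+ f₁ f₂ f₃ f₂ (f₃ +ᵖ f₄)))) ⟩
      X f₁ +ᵖ X (f₂ +ᵖ (f₃ +ᵖ f₄)) ≡⟨ coordinates-+ f₁ f₂ f₃ f₁ (f₂ +ᵖ (f₃ +ᵖ f₄)) ⟨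
      X (f₁ +ᵖ (f₂ +ᵖ (f₃ +ᵖ f₄))) ≡⟨ cong X balanced ⟩
      X 0ᵖ ∎
      where open ≡-Reasoning
    zeros : ∀ n → n ∙ 0ᵖ ≡ + 0
    zeros (a ∷ b ∷ c ∷ []) = cong₂ _+_ (ℤₚ.*-zeroʳ a) (cong₂ _+_ (ℤₚ.*-zeroʳ b) (ℤₚ.*-zeroʳ c))
    swap₁ : ∀ (d w : ℤ) → d + (+ 0 + (+ 0 + w)) ≡ + 0 + (d + (+ 0 + w))
    swap₁ = solve-∀
    swap₂ : ∀ (d w : ℤ) → d + (+ 0 + (+ 0 + w)) ≡ + 0 + (+ 0 + (d + w))
    swap₂ = solve-∀

  four : Fin 4 → Pt
  four zero                   = f₁
  four (suc zero)             = f₂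
  four (suc (suc zero))       = f₃
  four (suc (suc (suc zero))) = f₄

  facets : Facets four
  facets = record
    { k = k
    ; ℓ = ℓ
    ; additive = additive
    ; vertex≤ = λ i j → subst (ℤ._≤ + suc k) (sym (trans (value i j) (cong (coefficient i j *_) dd))) (bound (coefficient≤1 i j))
    ; ℓ-total = λ z → total (X z)
    ; ℓ-combo = combo′
    }
    where
    ℓ : Fin 4 → Pt → ℤ
    -- `X z` is the true coordinate vector times `d`. The second factor `d` makes the facet bound
    -- `d * d`, which is positive whatever the sign of the determinant.
    ℓ i z = d * (facetWeight i ∙ X z)

    additive : ∀ i x y → ℓ i (x +ᵖ y) ≡ ℓ i x + ℓ i y
    additive i x y = trans (cong (λ v → d * (facetWeight i ∙ v)) (coordinates-+ f₁ f₂ f₃ x y))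
      (trans (cong (d *_) (∙-+ (facetWeight i) (X x) (X y))) (ℤₚ.*-distribˡ-+ d (facetWeight i ∙ X x) (facetWeight i ∙ X y)))

    total : ∀ v → d * (facetWeight (# 0) ∙ v) + (d * (facetWeight (# 1) ∙ v) +
            (d * (facetWeight (# 2) ∙ v) + d * (facetWeight (# 3) ∙ v))) ≡ + 0
    total (x ∷ y ∷ z ∷ []) = facets-total-ring d x y z

    combo′ : ∀ z → (ℓ (# 0) z ·ᵖ f₁) +ᵖ ((ℓ (# 1) z ·ᵖ f₂) +ᵖ ((ℓ (# 2) z ·ᵖ f₃) +ᵖ (ℓ (# 3) z ·ᵖ f₄)))
                 ≡ (- (+ 4 * + suc k)) ·ᵖ z
    combo′ z = begin
      (ℓ (# 0) z ·ᵖ f₁) +ᵖ ((ℓ (# 1) z ·ᵖ f₂) +ᵖ ((ℓ (# 2) z ·ᵖ f₃) +ᵖ (ℓ (# 3) z ·ᵖ f₄)))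
        ≡⟨ facets-combo d (cross f₂ f₃ ∙ z) (cross f₃ f₁ ∙ z) (cross f₁ f₂ ∙ z) f₁ f₂ f₃ f₄ ⟩
      ((d * s) ·ᵖ (f₁ +ᵖ (f₂ +ᵖ (f₃ +ᵖ f₄)))) +ᵖ ((- (+ 4 * d)) ·ᵖ comb f₁ f₂ f₃ (X z))
        ≡⟨ cong₂ _+ᵖ_ (trans (cong ((d * s) ·ᵖ_) balanced) (·ᵖ-zeroʳ (d * s))) (cong ((- (+ 4 * d)) ·ᵖ_) (cramer f₁ f₂ f₃ z)) ⟩
      0ᵖ +ᵖ ((- (+ 4 * d)) ·ᵖ (d ·ᵖ z))
        ≡⟨ +ᵖ-identityˡ _ ⟩
      (- (+ 4 * d)) ·ᵖ (d ·ᵖ z)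
        ≡⟨ ·ᵖ-assoc (- (+ 4 * d)) d z ⟨
      ((- (+ 4 * d)) * d) ·ᵖ z
        ≡⟨ cong (_·ᵖ z) (trans (regroup d) (cong (λ e → - (+ 4 * e)) dd)) ⟩
      (- (+ 4 * + suc k)) ·ᵖ z ∎
      where
      open ≡-Reasoning
      s = (cross f₂ f₃ ∙ z) + ((cross f₃ f₁ ∙ z) + (cross f₁ f₂ ∙ z))
      regroup : ∀ d → (- (+ 4 * d)) * d ≡ - (+ 4 * (d * d))
      regroup = solve-∀

    coefficient : Fin 4 → Fin 4 → ℤ
    coefficient i zero                   = V.head (facetWeight i)
    coefficient i (suc zero)             = at₁ (facetWeight i)
    coefficient i (suc (suc zero))       = at₂ (facetWeight i)
    coefficient i (suc (suc (suc zero))) = - (V.head (facetWeight i) + (at₁ (facetWeight i) + at₂ (facetWeight i)))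

    value : ∀ i j → ℓ i (four j) ≡ coefficient i j * (d * d)
    value i zero = trans (cong (λ v → d * (facetWeight i ∙ v)) (coordinates₁ f₁ f₂ f₃)) (h (facetWeight i))
      where
      h : ∀ w → d * (w ∙ (d ∷ + 0 ∷ + 0 ∷ [])) ≡ V.head w * (d * d)
      h (a ∷ b ∷ c ∷ []) = axis-value₁ d a b c
    value i (suc zero) = trans (cong (λ v → d * (facetWeight i ∙ v)) (coordinates₂ f₁ f₂ f₃)) (h (facetWeight i))
      where
      h : ∀ w → d * (w ∙ (+ 0 ∷ d ∷ + 0 ∷ [])) ≡ at₁ w * (d * d)
      h (a ∷ b ∷ c ∷ []) = axis-value₂ d a b c
    value i (suc (suc zero)) = trans (cong (λ v → d * (facetWeight i ∙ v)) (coordinates₃ f₁ f₂ f₃)) (h (facetWeight i))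
      where
      h : ∀ w → d * (w ∙ (+ 0 ∷ + 0 ∷ d ∷ [])) ≡ at₂ w * (d * d)
      h (a ∷ b ∷ c ∷ []) = axis-value₃ d a b c
    value i (suc (suc (suc zero))) = trans (cong (λ v → d * (facetWeight i ∙ v)) coordinates₄) (h (facetWeight i))
      where
      h : ∀ w → d * (w ∙ (- d ∷ - d ∷ - d ∷ [])) ≡ (- (V.head w + (at₁ w + at₂ w))) * (d * d)
      h (a ∷ b ∷ c ∷ []) = diagonal-value d a b c

    coefficient≤1 : ∀ i j → coefficient i j ℤ.≤ + 1
    coefficient≤1 i j = toWitness {a? = all? λ i → all? λ j → coefficient i j ℤ.≤? + 1} tt i j

    bound : ∀ {c} → c ℤ.≤ + 1 → c * + suc k ℤ.≤ + suc k
    bound {c} c≤1 = subst (c * + suc k ℤ.≤_) (ℤₚ.*-identityˡ (+ suc k)) (ℤₚ.*-monoʳ-≤-nonNeg (+ suc k) c≤1)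

barycentric-ring : ∀ (e s t u v a b c d : ℤ) →
  (e - s) * a + ((e - t) * b + ((e - u) * c + ((e - v) * d + + 0)))
  ≡ e * (a + (b + (c + d))) - (s * a + (t * b + (u * c + v * d)))
barycentric-ring = solve-∀

barycentric-vector : ∀ (e s t u v : ℤ) g₁ g₂ g₃ g₄ →
  ((e - s) ·ᵖ g₁) +ᵖ (((e - t) ·ᵖ g₂) +ᵖ (((e - u) ·ᵖ g₃) +ᵖ (((e - v) ·ᵖ g₄) +ᵖ 0ᵖ)))
  ≡ (e ·ᵖ (g₁ +ᵖ (g₂ +ᵖ (g₃ +ᵖ g₄)))) -ᵖ ((s ·ᵖ g₁) +ᵖ ((t ·ᵖ g₂) +ᵖ ((u ·ᵖ g₃) +ᵖ (v ·ᵖ g₄))))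
barycentric-vector e s t u v (a ∷ b ∷ c ∷ []) (a′ ∷ b′ ∷ c′ ∷ []) (a″ ∷ b″ ∷ c″ ∷ []) (a‴ ∷ b‴ ∷ c‴ ∷ []) = cong₂ _∷_
  (barycentric-ring e s t u v a a′ a″ a‴) (cong₂ _∷_ (barycentric-ring e s t u v b b′ b″ b‴)
    (cong (_∷ []) (barycentric-ring e s t u v c c′ c″ c‴)))

barycentric-weight : ∀ (e s t u v : ℤ) →
  (e - s) + ((e - t) + ((e - u) + ((e - v) + + 0))) ≡ + 4 * e - (s + (t + (u + v)))
barycentric-weight = solve-∀

0-negated : ∀ n z → 0ᵖ -ᵖ ((- n) ·ᵖ z) ≡ n ·ᵖ z
0-negated n (a ∷ b ∷ c ∷ []) = pointwise (h n a) (h n b) (h n c)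
  where
  h : ∀ n a → + 0 - (- n) * a ≡ n * a
  h = solve-∀

-- With `E = e + 1`, the barycentric weights are `E - t i`: nonnegative by the facet bounds, of
-- total `4 E` because the `t i` cancel, with combination `4 E z` because the `g i` sum to 0.
barycentric : ∀ {K} → Convex K → ∀ e (t : Fin 4 → ℤ) (g : Fin 4 → Pt) z → (∀ i → t i ℤ.≤ + suc e) →
  t (# 0) + (t (# 1) + (t (# 2) + t (# 3))) ≡ + 0 →
  g (# 0) +ᵖ (g (# 1) +ᵖ (g (# 2) +ᵖ g (# 3))) ≡ 0ᵖ →
  (t (# 0) ·ᵖ g (# 0)) +ᵖ ((t (# 1) ·ᵖ g (# 1)) +ᵖ ((t (# 2) ·ᵖ g (# 2)) +ᵖ (t (# 3) ·ᵖ g (# 3)))) ≡ (- (+ 4 * + suc e)) ·ᵖ z →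
  (∀ i → K (g i)) → K z
barycentric {K} convex e t g z t≤ total balanced combo≡ inK =
  -- The successor of this number is `4 E`, as `Convex` expects one less than the total weight.
  convex (e ℕ.+ 3 ℕ.* suc e) ((n (# 0) , g (# 0)) ∷ (n (# 1) , g (# 1)) ∷ (n (# 2) , g (# 2)) ∷ (n (# 3) , g (# 3)) ∷ []) z
    (inK (# 0) ∷ inK (# 1) ∷ inK (# 2) ∷ inK (# 3) ∷ []) (ℤₚ.+-injective weight) (begin
      ((+ n (# 0)) ·ᵖ g (# 0)) +ᵖ (((+ n (# 1)) ·ᵖ g (# 1)) +ᵖ (((+ n (# 2)) ·ᵖ g (# 2)) +ᵖ (((+ n (# 3)) ·ᵖ g (# 3)) +ᵖ 0ᵖ)))
        ≡⟨ cong₂ _+ᵖ_ (cong (_·ᵖ g (# 0)) (n≡ (# 0))) (cong₂ _+ᵖ_ (cong (_·ᵖ g (# 1)) (n≡ (# 1))) (cong₂ _+ᵖ_ (cong (_·ᵖ g (# 2)) (n≡ (# 2))) (cong (λ m → (m ·ᵖ g (# 3)) +ᵖ 0ᵖ) (n≡ (# 3))))) ⟩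
      ((E - t (# 0)) ·ᵖ g (# 0)) +ᵖ (((E - t (# 1)) ·ᵖ g (# 1)) +ᵖ (((E - t (# 2)) ·ᵖ g (# 2)) +ᵖ (((E - t (# 3)) ·ᵖ g (# 3)) +ᵖ 0ᵖ)))
        ≡⟨ barycentric-vector E (t (# 0)) (t (# 1)) (t (# 2)) (t (# 3)) (g (# 0)) (g (# 1)) (g (# 2)) (g (# 3)) ⟩
      (E ·ᵖ (g (# 0) +ᵖ (g (# 1) +ᵖ (g (# 2) +ᵖ g (# 3))))) -ᵖ _
        ≡⟨ cong₂ _-ᵖ_ (trans (cong (E ·ᵖ_) balanced) (·ᵖ-zeroʳ E)) combo≡ ⟩
      0ᵖ -ᵖ ((- (+ 4 * E)) ·ᵖ z)
        ≡⟨ 0-negated (+ 4 * E) z ⟩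
      (+ 4 * E) ·ᵖ z ∎)
  where
  open ≡-Reasoning
  E = + suc e
  n : Fin 4 → ℕ
  n i = ∣ E - t i ∣
  n≡ : ∀ i → + n i ≡ E - t i
  n≡ i = ℤₚ.0≤i⇒+∣i∣≡i (ℤₚ.i≤j⇒0≤j-i (t≤ i))
  weight : + (n (# 0) ℕ.+ (n (# 1) ℕ.+ (n (# 2) ℕ.+ (n (# 3) ℕ.+ 0)))) ≡ + suc (e ℕ.+ 3 ℕ.* suc e)
  weight = begin
    + n (# 0) + (+ n (# 1) + (+ n (# 2) + (+ n (# 3) + + 0)))
      ≡⟨ cong₂ _+_ (n≡ (# 0)) (cong₂ _+_ (n≡ (# 1)) (cong₂ _+_ (n≡ (# 2)) (cong (_+ + 0) (n≡ (# 3))))) ⟩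
    (E - t (# 0)) + ((E - t (# 1)) + ((E - t (# 2)) + ((E - t (# 3)) + + 0)))
      ≡⟨ barycentric-weight E (t (# 0)) (t (# 1)) (t (# 2)) (t (# 3)) ⟩
    + 4 * E - (t (# 0) + (t (# 1) + (t (# 2) + t (# 3))))
      ≡⟨ cong (λ s → + 4 * E - s) total ⟩
    + 4 * E - + 0
      ≡⟨ ℤₚ.+-identityʳ (+ 4 * E) ⟩
    + 4 * E ∎

-- Halving and injectivity modulo 2

double-scale : ∀ w → V.map (_* + 2) w ≡ w +ᵖ w
double-scale (a ∷ b ∷ c ∷ []) = pointwise (h a) (h b) (h c)
  where
  h : ∀ w → w * + 2 ≡ w + w
  h = solve-∀

res₂-double : ∀ x y → res₂ x ≡ res₂ y → ∃ λ w → x ≡ y +ᵖ (w +ᵖ w)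
res₂-double x y eq with res₂-≡ x y eq
... | w , x≡ = w , trans x≡ (cong (y +ᵖ_) (double-scale w))

quadruple-step-ring : ∀ (y w : ℤ) → ((y + y) + (w + (w + w))) + ((y + y) + (w + (w + w)))
  ≡ ((y + (w + w)) + y) + ((y + (w + w)) + (y + (w + w)))
quadruple-step-ring = solve-∀

-- For `x = y + 2 w` this exhibits `2 y + 3 w` as the midpoint of `x + y` and `2 x`, which puts a
-- segment of length three over `2 y`.
quadruple-step : ∀ y w → ((y +ᵖ y) +ᵖ (w +ᵖ (w +ᵖ w))) +ᵖ ((y +ᵖ y) +ᵖ (w +ᵖ (w +ᵖ w)))
  ≡ ((y +ᵖ (w +ᵖ w)) +ᵖ y) +ᵖ ((y +ᵖ (w +ᵖ w)) +ᵖ (y +ᵖ (w +ᵖ w)))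
quadruple-step (a ∷ b ∷ c ∷ []) (a′ ∷ b′ ∷ c′ ∷ []) =
  pointwise (quadruple-step-ring a a′) (quadruple-step-ring b b′) (quadruple-step-ring c c′)

module _ {I : Pt → Set} (thin : Thin I) {M : Pt → Set} (sum : ∀ {x y} → M x → M y → I (x +ᵖ y)) where

  open ThinProperties thin

  -- If x = y + 2 w, then 2 x = 2 y + 4 w.
  res₂-inj : ∀ {x y} → M x → M y → res₂ x ≡ res₂ y → x ≡ y
  res₂-inj {x} {y} mx my eq with res₂-double x y eq
  ... | w , refl = trans (cong (λ w → y +ᵖ (w +ᵖ w)) w≡0) (trans (cong (y +ᵖ_) (+ᵖ-identityˡ 0ᵖ)) (+ᵖ-identityʳ y))
    where
    w≡0 : w ≡ 0ᵖ
    w≡0 = no-triple w (sum my my)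
      (midpoint ((y +ᵖ y) +ᵖ (w +ᵖ (w +ᵖ w))) (sum mx my) (sum mx mx) (quadruple-step y w))

  Unique-res₂ : ∀ {xs} → All M xs → Unique xs → Unique (map res₂ xs)
  Unique-res₂ [] [] = []
  Unique-res₂ (mx ∷ ms) (x∉ ∷ u) =
    Allₚ.map⁺ (All.zipWith (λ (my , x≢y) eq → x≢y (res₂-inj mx my eq)) (ms , x∉)) ∷ Unique-res₂ ms u

residue-subtract : ∀ x y z → x +₃ y ≡ z → x ≡ z +₃ (y +₃ y)
residue-subtract x y z refl = ==ᵛ-sound x _ (allᵛ-sound (law x) (allᵛ-sound (λ x → allᵛ (law x)) (T-true laws) x) y)
  where
  law : V₃ → V₃ → Bool
  law x y = x ==ᵛ ((x +₃ y) +₃ (y +₃ y))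
  laws : allᵛ (λ x → allᵛ (law x)) ≡ true
  laws = refl

+ᵖ-swapˡ : ∀ x y z → x +ᵖ (y +ᵖ z) ≡ y +ᵖ (x +ᵖ z)
+ᵖ-swapˡ x y z = trans (sym (+ᵖ-assoc x y z)) (trans (cong (_+ᵖ z) (+ᵖ-comm x y)) (+ᵖ-assoc y x z))

double-combo-ring : ∀ (s t u v a b c d : ℤ) →
  s * (a + a) + (t * (b + b) + (u * (c + c) + v * (d + d)))
  ≡ (s * a + (t * b + (u * c + v * d))) + (s * a + (t * b + (u * c + v * d)))
double-combo-ring = solve-∀

double-combo : ∀ (s t u v : ℤ) g₁ g₂ g₃ g₄ →
  (s ·ᵖ (g₁ +ᵖ g₁)) +ᵖ ((t ·ᵖ (g₂ +ᵖ g₂)) +ᵖ ((u ·ᵖ (g₃ +ᵖ g₃)) +ᵖ (v ·ᵖ (g₄ +ᵖ g₄))))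
  ≡ ((s ·ᵖ g₁) +ᵖ ((t ·ᵖ g₂) +ᵖ ((u ·ᵖ g₃) +ᵖ (v ·ᵖ g₄)))) +ᵖ ((s ·ᵖ g₁) +ᵖ ((t ·ᵖ g₂) +ᵖ ((u ·ᵖ g₃) +ᵖ (v ·ᵖ g₄))))
double-combo s t u v (a ∷ b ∷ c ∷ []) (a′ ∷ b′ ∷ c′ ∷ []) (a″ ∷ b″ ∷ c″ ∷ []) (a‴ ∷ b‴ ∷ c‴ ∷ []) = cong₂ _∷_
  (double-combo-ring s t u v a a′ a″ a‴) (cong₂ _∷_ (double-combo-ring s t u v b b′ b″ b‴)
    (cong (_∷ []) (double-combo-ring s t u v c c′ c″ c‴)))

double-sum-ring : ∀ (a b c d : ℤ) → (a + a) + ((b + b) + ((c + c) + (d + d))) ≡ (a + (b + (c + d))) + (a + (b + (c + d)))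
double-sum-ring = solve-∀

double-sum : ∀ g₁ g₂ g₃ g₄ → (g₁ +ᵖ g₁) +ᵖ ((g₂ +ᵖ g₂) +ᵖ ((g₃ +ᵖ g₃) +ᵖ (g₄ +ᵖ g₄))) ≡
  (g₁ +ᵖ (g₂ +ᵖ (g₃ +ᵖ g₄))) +ᵖ (g₁ +ᵖ (g₂ +ᵖ (g₃ +ᵖ g₄)))
double-sum (a ∷ b ∷ c ∷ []) (a′ ∷ b′ ∷ c′ ∷ []) (a″ ∷ b″ ∷ c″ ∷ []) (a‴ ∷ b‴ ∷ c‴ ∷ []) =
  pointwise (double-sum-ring a a′ a″ a‴) (double-sum-ring b b′ b″ b‴) (double-sum-ring c c′ c″ c‴)

double-multiple : ∀ d z → ((- (+ 4 * d)) ·ᵖ z) +ᵖ ((- (+ 4 * d)) ·ᵖ z) ≡ (- (+ 4 * (d + d))) ·ᵖ z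
double-multiple d (a ∷ b ∷ c ∷ []) = pointwise (h d a) (h d b) (h d c)
  where
  h : ∀ (d a : ℤ) → (- (+ 4 * d)) * a + (- (+ 4 * d)) * a ≡ (- (+ 4 * (d + d))) * a
  h = solve-∀

-- Integrality rounds the mean of `N + 1` and `N` down to `N`. The descent terminates because of
-- this off-by-one.
halve : ∀ a N → a + a ℤ.≤ + suc N + + N → a ℤ.≤ + N
halve a N h with a ℤ.≤? + N
... | yes a≤N = a≤N
... | no a≰N = ⊥-elim (ℤₚ.<⇒≱ (ℤₚ.<-≤-trans (ℤₚ.+-monoʳ-< (+ suc N) (ℤ.+<+ (ℕₚ.n<1+n N)))
                               (ℤₚ.+-mono-≤ N<a N<a)) h)
  where
  N<a : + suc N ℤ.≤ a
  N<a = ℤₚ.i<j⇒suc[i]≤j (ℤₚ.≰⇒> a≰N)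

below : ∀ {d N} → ¬ (+ suc N ℤ.≤ d) → d ℤ.≤ + N
below {d} {N} h with d ℤ.≤? + N
... | yes d≤N = d≤N
... | no d≰N = ⊥-elim (h (ℤₚ.i<j⇒suc[i]≤j (ℤₚ.≰⇒> d≰N)))

≤-abs : ∀ i → i ℤ.≤ + ∣ i ∣
≤-abs (+ n)    = ℤₚ.≤-refl
≤-abs -[1+ n ] = ℤ.-≤+

half-sum-ring : ∀ (r w : ℤ) → (r + (w + w)) + r ≡ (r + w) + (r + w)
half-sum-ring = solve-∀

half-sum : ∀ r w → (r +ᵖ (w +ᵖ w)) +ᵖ r ≡ (r +ᵖ w) +ᵖ (r +ᵖ w)
half-sum (a ∷ b ∷ c ∷ []) (a′ ∷ b′ ∷ c′ ∷ []) = pointwise (half-sum-ring a a′) (half-sum-ring b b′) (half-sum-ring c c′)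

half-difference-ring : ∀ (y r s : ℤ) → (y - r) + (y - r) ≡ (((y + y) - r) + s) - (r + s)
half-difference-ring = solve-∀

half-difference : ∀ y r s → (y -ᵖ r) +ᵖ (y -ᵖ r) ≡ (((y +ᵖ y) -ᵖ r) +ᵖ s) -ᵖ (r +ᵖ s)
half-difference (a ∷ b ∷ c ∷ []) (a′ ∷ b′ ∷ c′ ∷ []) (a″ ∷ b″ ∷ c″ ∷ []) =
  pointwise (half-difference-ring a a′ a″) (half-difference-ring b b′ b″) (half-difference-ring c c′ c″)

-ᵖ-zero : ∀ x → x -ᵖ 0ᵖ ≡ x
-ᵖ-zero x = trans (sym (+ᵖ-identityʳ (x -ᵖ 0ᵖ))) (difference-add x 0ᵖ)

-- The tetrahedron around 0 and the lattice its vertices generate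

star : Pt → Pt → Pt → Pt → List Pt
star f₁ f₂ f₃ f₄ = 0ᵖ ∷ f₁ ∷ f₂ ∷ f₃ ∷ f₄ ∷ []

-- `I` stands for the lattice points of `P + Q` and `J` for those of `P`, both translated so that
-- the star is exactly `J`.
module _ {I J : Pt → Set} (thin : Thin I) (convexJ : Convex J) {f₁ f₂ f₃ f₄ : Pt}
  (distinct : Unique (star f₁ f₂ f₃ f₄))
  (F⊆J : ∀ {x} → x ∈ star f₁ f₂ f₃ f₄ → J x) (J⊆F : ∀ {x} → J x → x ∈ star f₁ f₂ f₃ f₄)
  (sum : ∀ {x y} → x ∈ star f₁ f₂ f₃ f₄ → y ∈ star f₁ f₂ f₃ f₄ → I (x +ᵖ y))
  (even : res₂ (f₁ +ᵖ (f₂ +ᵖ (f₃ +ᵖ f₄))) ≡ zero₂) where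

  open Thin thin
  open ThinProperties thin

  private
    F : List Pt
    F = star f₁ f₂ f₃ f₄
    0∈ : 0ᵖ ∈ F
    0∈ = here refl
    ∈₁ : f₁ ∈ F
    ∈₁ = there (here refl)
    ∈₂ : f₂ ∈ F
    ∈₂ = there (there (here refl))
    ∈₃ : f₃ ∈ F
    ∈₃ = there (there (there (here refl)))
    ∈₄ : f₄ ∈ F
    ∈₄ = there (there (there (there (here refl))))

    F⊆I : ∀ {x} → x ∈ F → I x
    F⊆I {x} x∈ = subst I (+ᵖ-identityʳ x) (sum x∈ 0∈)

    nonzero₁ : f₁ ≢ 0ᵖ
    nonzero₁ e = All.lookup (AllPairs.head distinct) (here refl) (sym e)
    nonzero₂ : f₂ ≢ 0ᵖ
    nonzero₂ e = All.lookup (AllPairs.head distinct) (there (here refl)) (sym e)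
    nonzero₃ : f₃ ≢ 0ᵖ
    nonzero₃ e = All.lookup (AllPairs.head distinct) (there (there (here refl))) (sym e)
    nonzero₄ : f₄ ≢ 0ᵖ
    nonzero₄ e = All.lookup (AllPairs.head distinct) (there (there (there (here refl)))) (sym e)

    f₁≢f₂ : f₁ ≢ f₂
    f₁≢f₂ = All.head (AllPairs.head (AllPairs.tail distinct))

    open Common thin {_∈ F} {_∈ F} sum 0∈ 0∈ {f₁} ∈₁ ∈₁ nonzero₁

    residue-sums : List V₃
    residue-sums = simplexSums (res₃ f₁) (res₃ f₂) (res₃ f₃) (res₃ f₄)

    residue-sums-distinct : Unique residue-sums
    residue-sums-distinct = residue-sums-Unique
      {(both , 0ᵖ) ∷ (both , f₁) ∷ (both , f₂) ∷ (both , f₃) ∷ (both , f₄) ∷ []}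
      ((0∈ , 0∈) ∷ (∈₁ , ∈₁) ∷ (∈₂ , ∈₂) ∷ (∈₃ , ∈₃) ∷ (∈₄ , ∈₄) ∷ []) distinct

    independent₁₂ = independent-from both (∈₂ , ∈₂) nonzero₂ f₁≢f₂

    m : Pt
    m = proj₁ (res₂-double (f₁ +ᵖ (f₂ +ᵖ (f₃ +ᵖ f₄))) 0ᵖ even)

    m+m : f₁ +ᵖ (f₂ +ᵖ (f₃ +ᵖ f₄)) ≡ m +ᵖ m
    m+m = trans (proj₂ (res₂-double (f₁ +ᵖ (f₂ +ᵖ (f₃ +ᵖ f₄))) 0ᵖ even)) (+ᵖ-identityˡ (m +ᵖ m))

    m∈I : I m
    m∈I = midpoint m (sum ∈₁ ∈₂) (sum ∈₃ ∈₄) (trans (sym m+m) (sym (+ᵖ-assoc f₁ f₂ (f₃ +ᵖ f₄))))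

    quadruple : ∀ x → x ≡ (x +₃ x) +₃ (x +₃ x)
    quadruple x = ==ᵛ-sound x _ (allᵛ-sound (λ x → x ==ᵛ ((x +₃ x) +₃ (x +₃ x))) tt x)

    -- Modulo 3, `m = 4 m`, and `4 m` is twice the sum of the four vertices.
    residue-m : res₃ m ≡ centre (res₃ f₁) (res₃ f₂) (res₃ f₃) (res₃ f₄)
    residue-m = trans (quadruple (res₃ m)) (cong (λ s → s +₃ s) (begin
      res₃ m +₃ res₃ m ≡⟨ res₃-+ m m ⟨
      res₃ (m +ᵖ m) ≡⟨ cong res₃ m+m ⟨
      res₃ (f₁ +ᵖ (f₂ +ᵖ (f₃ +ᵖ f₄))) ≡⟨ res₃-+ f₁ (f₂ +ᵖ (f₃ +ᵖ f₄)) ⟩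
      res₃ f₁ +₃ res₃ (f₂ +ᵖ (f₃ +ᵖ f₄)) ≡⟨ cong (res₃ f₁ +₃_) (trans (res₃-+ f₂ (f₃ +ᵖ f₄)) (cong (res₃ f₂ +₃_) (res₃-+ f₃ f₄))) ⟩
      res₃ f₁ +₃ (res₃ f₂ +₃ (res₃ f₃ +₃ res₃ f₄)) ∎))
      where open ≡-Reasoning

    -- Seven corners of the box spanned by `b`, `c`, `d` at 0 are sums of at most two points of the
    -- star. The eighth would be `a`, again a point of the star.
    no-box : ∀ {a b c d} → a ∈ F → b ∈ F → c ∈ F → d ∈ F → b ≢ 0ᵖ → c ≢ 0ᵖ → d ≢ 0ᵖ → b +ᵖ (c +ᵖ d) ≢ a
    no-box {a} {b} {c} {d} a∈ b∈ c∈ d∈ b≢0 c≢0 d≢0 eq = no-cube 0ᵖ b≢0 c≢0 d≢0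
      (cube (F⊆I 0∈) (sum 0∈ b∈) (sum 0∈ c∈) (sum 0∈ d∈) (at (sum b∈ c∈)) (at (sum b∈ d∈)) (at (sum c∈ d∈))
        (at (subst I (sym eq) (F⊆I a∈))))
      where
      at : ∀ {x} → I x → I (0ᵖ +ᵖ x)
      at {x} = subst I (sym (+ᵖ-identityˡ x))

    drop : ∀ {a s} → a +ᵖ s ≡ m +ᵖ m → m ≡ a → s ≡ a
    drop {a} eq refl = +ᵖ-cancelˡ a eq

  balanced : f₁ +ᵖ (f₂ +ᵖ (f₃ +ᵖ f₄)) ≡ 0ᵖ
  balanced = trans m+m (trans (cong₂ _+ᵖ_ m≡0 m≡0) (+ᵖ-identityˡ 0ᵖ))
    where
    identify : ∀ {xs} → All (_∈ F) xs → res₃ m ∈ map res₃ xs → m ∈ xs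
    identify (x∈ ∷ xs) (here e)  = here (res₃-inj m∈I (F⊆I x∈) e)
    identify (x∈ ∷ xs) (there p) = there (identify xs p)
    m∈F : m ∈ F
    m∈F = identify (0∈ ∷ ∈₁ ∷ ∈₂ ∷ ∈₃ ∷ ∈₄ ∷ []) (subst (_∈ map res₃ F) (sym residue-m)
      (centre-residue (res₃ f₁) (res₃ f₂) (res₃ f₃) (res₃ f₄) independent₁₂ residue-sums-distinct))
    cases : m ∈ F → m ≡ 0ᵖ
    cases (here e) = e
    -- If the half sum `m` equals `f₁`, subtracting `f₁` from `2 m` leaves `f₂ + f₃ + f₄ = f₁`. The
    -- other vertices are treated alike after a permutation.
    cases (there (here e)) = ⊥-elim (no-box ∈₁ ∈₂ ∈₃ ∈₄ nonzero₂ nonzero₃ nonzero₄ (drop m+m e))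
    cases (there (there (here e))) = ⊥-elim (no-box ∈₂ ∈₁ ∈₃ ∈₄ nonzero₁ nonzero₃ nonzero₄
      (drop (trans (+ᵖ-swapˡ f₂ f₁ (f₃ +ᵖ f₄)) m+m) e))
    cases (there (there (there (here e)))) = ⊥-elim (no-box ∈₃ ∈₁ ∈₂ ∈₄ nonzero₁ nonzero₂ nonzero₄
      (drop (trans (+ᵖ-swapˡ f₃ f₁ (f₂ +ᵖ f₄)) (trans (cong (f₁ +ᵖ_) (+ᵖ-swapˡ f₃ f₂ f₄)) m+m)) e))
    cases (there (there (there (there (here e))))) = ⊥-elim (no-box ∈₄ ∈₁ ∈₂ ∈₃ nonzero₁ nonzero₂ nonzero₃
      (drop (trans (+ᵖ-swapˡ f₄ f₁ (f₂ +ᵖ f₃)) (trans (cong (f₁ +ᵖ_)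
        (trans (+ᵖ-swapˡ f₄ f₂ f₃) (cong (f₂ +ᵖ_) (+ᵖ-comm f₄ f₃)))) m+m)) e))
    m≡0 : m ≡ 0ᵖ
    m≡0 = cases m∈F

  private
    planar = plane (res₂ f₁) (res₂ f₂) (res₂ f₃) (res₂ f₄)
      (Unique-res₂ thin {_∈ F} sum (∈₄ ∷ ∈₃ ∷ ∈₂ ∷ ∈₁ ∷ 0∈ ∷ []) (Unique-resp-↭ (↭-sym (↭ₚ.↭-reverse F)) distinct))
      (begin
        res₂ f₁ +₂ (res₂ f₂ +₂ (res₂ f₃ +₂ res₂ f₄)) ≡⟨ cong (res₂ f₁ +₂_) (trans (res₂-+ f₂ (f₃ +ᵖ f₄)) (cong (res₂ f₂ +₂_) (res₂-+ f₃ f₄))) ⟨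
        res₂ f₁ +₂ res₂ (f₂ +ᵖ (f₃ +ᵖ f₄)) ≡⟨ res₂-+ f₁ (f₂ +ᵖ (f₃ +ᵖ f₄)) ⟨
        res₂ (f₁ +ᵖ (f₂ +ᵖ (f₃ +ᵖ f₄))) ≡⟨ even ⟩
        zero₂ ∎)
      where open ≡-Reasoning

  -- The vertices form a basis modulo 2, so the determinant is odd.
  det-nonZero : ℤ.NonZero (det f₁ f₂ f₃)
  det-nonZero = odd⇒nonZero (det f₁ f₂ f₃) (trans (parity-det f₁ f₂ f₃) (proj₁ planar))

  Generated : Pt → Set
  Generated z = ∃ λ c → z ≡ comb f₁ f₂ f₃ c

  private
    Generated-+ : ∀ {x y} → Generated x → Generated y → Generated (x +ᵖ y)
    Generated-+ (c , refl) (d , refl) = c +ᵖ d , sym (comb-+ f₁ f₂ f₃ c d)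

    Generated-difference : ∀ {x y} → Generated x → Generated y → Generated (x -ᵖ y)
    Generated-difference (c , refl) (d , refl) = c -ᵖ d , sym (comb-difference f₁ f₂ f₃ c d)

    generated-f : ∀ {x} → x ∈ F → Generated x
    generated-f (here refl) = 0ᵖ , sym (comb-zero f₁ f₂ f₃)
    generated-f (there (here refl)) = e₁ , sym (comb-e₁ f₁ f₂ f₃)
    generated-f (there (there (here refl))) = e₂ , sym (comb-e₂ f₁ f₂ f₃)
    generated-f (there (there (there (here refl)))) = e₃ , sym (comb-e₃ f₁ f₂ f₃)
    generated-f (there (there (there (there (here refl))))) = e₄ , sym (comb-e₄ f₁ f₂ f₃ f₄ balanced)

    vertices : Fin 4 → Pt
    vertices = four f₁ f₂ f₃ f₄ balanced {{det-nonZero}}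

    abstract
      tetrahedron : Facets vertices
      tetrahedron = facets f₁ f₂ f₃ f₄ balanced {{det-nonZero}}

    open Facets tetrahedron

    Δ : ℤ
    Δ = + suc k

    Bounded : ℤ → Pt → Set
    Bounded n z = ∀ i → ℓ i z ℤ.≤ n

    vertex∈ : ∀ i → vertices i ∈ F
    vertex∈ zero                   = ∈₁
    vertex∈ (suc zero)             = ∈₂
    vertex∈ (suc (suc zero))       = ∈₃
    vertex∈ (suc (suc (suc zero))) = ∈₄

    Bounded⇒J : ∀ {z} → Bounded Δ z → J z
    Bounded⇒J {z} b = barycentric convexJ k (λ i → ℓ i z) vertices z b (ℓ-total z) balanced (ℓ-combo z)
      (λ i → F⊆J (vertex∈ i))

    -- The doubled tetrahedron has the vertices `2 fᵢ`, which are sums of two star points, so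
    -- convexity of `I` covers all its lattice points.
    Bounded⇒I : ∀ {z} → Bounded (Δ + Δ) z → I z
    Bounded⇒I {z} b = barycentric convex (k ℕ.+ suc k) (λ i → ℓ i z) (λ i → vertices i +ᵖ vertices i) z b (ℓ-total z)
      (trans (double-sum f₁ f₂ f₃ f₄) (trans (cong₂ _+ᵖ_ balanced balanced) (+ᵖ-identityˡ 0ᵖ)))
      (trans (double-combo (ℓ (# 0) z) (ℓ (# 1) z) (ℓ (# 2) z) (ℓ (# 3) z) f₁ f₂ f₃ f₄)
        (trans (cong₂ _+ᵖ_ (ℓ-combo z) (ℓ-combo z)) (double-multiple Δ z)))
      (λ i → sum (vertex∈ i) (vertex∈ i))

    ℓ-zero : ∀ i → ℓ i 0ᵖ ≡ + 0
    ℓ-zero i = self-double (ℓ i 0ᵖ) (trans (sym (additive i 0ᵖ 0ᵖ)) (cong (ℓ i) (+ᵖ-identityˡ 0ᵖ)))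
      where
      cancel : ∀ (x : ℤ) → (x + x) - x ≡ x
      cancel = solve-∀
      self-double : ∀ x → x + x ≡ x → x ≡ + 0
      self-double x eq = trans (sym (cancel x)) (trans (cong (_- x) eq) (ℤₚ.+-inverseʳ x))

    Bounded-F : ∀ {x} → x ∈ F → Bounded Δ x
    Bounded-F (here refl) i = subst (ℤ._≤ Δ) (sym (ℓ-zero i)) (ℤ.+≤+ ℕ.z≤n)
    Bounded-F (there (here refl)) i = vertex≤ i (# 0)
    Bounded-F (there (there (here refl))) i = vertex≤ i (# 1)
    Bounded-F (there (there (there (here refl)))) i = vertex≤ i (# 2)
    Bounded-F (there (there (there (there (here refl))))) i = vertex≤ i (# 3)

    Bounded-+ : ∀ {m n x y} → Bounded m x → Bounded n y → Bounded (m + n) (x +ᵖ y)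
    Bounded-+ {m} {n} {x} {y} bx by i = subst (ℤ._≤ m + n) (sym (additive i x y)) (ℤₚ.+-mono-≤ (bx i) (by i))

    Bounded-half : ∀ {N x y z} → Bounded (+ suc N) x → Bounded (+ N) y → x +ᵖ y ≡ z +ᵖ z → Bounded (+ N) z
    Bounded-half {N} {x} {y} {z} bx by eq i = halve (ℓ i z) N
      (subst (ℤ._≤ + suc N + + N) (trans (cong (ℓ i) eq) (additive i z z)) (Bounded-+ {x = x} {y} bx by i))

    Bounded-weaken : ∀ {m n z} → m ℤ.≤ n → Bounded m z → Bounded n z
    Bounded-weaken m≤n b i = ℤₚ.≤-trans (b i) m≤n

    -- Within `I` a residue modulo 3 determines the point, so `z` equals the sum of two star points
    -- whose residue it shares.
    Generated-residue : ∀ {z} → I z → res₃ z ∈ residue-sums → Generated z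
    Generated-residue {z} iz z∈ with ∈ₚ.∈-map⁻ res₃ (subst (res₃ z ∈_)
        (sym (sums-natural {_∙_ = _+ᵖ_} {_∙′_ = _+₃_} res₃ res₃ res₃-+ (simplex 0ᵖ f₁ f₂ f₃ f₄) [] [])) z∈)
    ... | y , y∈ , eq with All.lookup
          (sums-All {_∙_ = _+ᵖ_} {P = λ s → I s × Generated s} {M = λ _ x → x ∈ F}
            (λ x∈ y∈ _ → sum x∈ y∈ , Generated-+ (generated-f x∈) (generated-f y∈))
            {simplex 0ᵖ f₁ f₂ f₃ f₄} {[]} {[]} (0∈ ∷ ∈₁ ∷ ∈₂ ∷ ∈₃ ∷ ∈₄ ∷ []) [] []) y∈
    ... | iy , gy = subst Generated (sym (res₃-inj iz iy eq)) gy

    residue₄ : res₃ f₄ ≡ opposite (res₃ f₁) (res₃ f₂) (res₃ f₃)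
    residue₄ = trans (residue-subtract (res₃ f₄) s zeroᵛ (begin
        res₃ f₄ +₃ s ≡⟨ cong (res₃ f₄ +₃_) (trans (res₃-+ f₁ (f₂ +ᵖ f₃)) (cong (res₃ f₁ +₃_) (res₃-+ f₂ f₃))) ⟨
        res₃ f₄ +₃ res₃ (f₁ +ᵖ (f₂ +ᵖ f₃)) ≡⟨ res₃-+ f₄ (f₁ +ᵖ (f₂ +ᵖ f₃)) ⟨
        res₃ (f₄ +ᵖ (f₁ +ᵖ (f₂ +ᵖ f₃))) ≡⟨ cong res₃ (trans (+ᵖ-comm f₄ _) (trans (+ᵖ-assoc f₁ _ f₄) (trans (cong (f₁ +ᵖ_) (+ᵖ-assoc f₂ f₃ f₄)) balanced))) ⟩
        zeroᵛ ∎)) (zero-+₃ (s +₃ s))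
      where
      open ≡-Reasoning
      s = res₃ f₁ +₃ (res₃ f₂ +₃ res₃ f₃)
      zero-+₃ : ∀ x → zeroᵛ +₃ x ≡ x
      zero-+₃ (_ ∷ _ ∷ _ ∷ []) = refl

    meets-residues : ∀ y → MeetsAll (res₃ f₁) (res₃ f₂) (res₃ f₃) y
    meets-residues y = meets-balanced (res₃ f₁) (res₃ f₂) (res₃ f₃) y independent₁₂
      (subst (λ x → Unique (simplexSums (res₃ f₁) (res₃ f₂) (res₃ f₃) x)) residue₄ residue-sums-distinct)

    -- What the descent needs of a representative `fᵢ + fⱼ`. By balance its negative is the sum of
    -- the other two vertices, hence also in `I`.
    record Pair (ρ : Pt) : Set where
      field
        ρ∈I : I ρ
        opposite∈I : ∃ λ ρ̄ → I ρ̄ × ρ +ᵖ ρ̄ ≡ 0ᵖ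
        generated : Generated ρ
        bounded : Bounded (Δ + Δ) ρ
        meet : ∀ y → Meets residue-sums y (res₃ ρ)

    pair : ∀ {a b c d} → a ∈ F → b ∈ F → c ∈ F → d ∈ F → (a +ᵖ b) +ᵖ (c +ᵖ d) ≡ 0ᵖ →
           (∀ y → Meets (balancedSums (res₃ f₁) (res₃ f₂) (res₃ f₃)) y (res₃ a +₃ res₃ b)) → Pair (a +ᵖ b)
    pair {a} {b} {c} {d} a∈ b∈ c∈ d∈ eq meet = record
      { ρ∈I = sum a∈ b∈
      ; opposite∈I = c +ᵖ d , sum c∈ d∈ , eq
      ; generated = Generated-+ (generated-f a∈) (generated-f b∈)
      ; bounded = Bounded-+ {x = a} {b} (Bounded-F a∈) (Bounded-F b∈)
      ; meet = λ y → subst₂ (λ x p → Meets (simplexSums (res₃ f₁) (res₃ f₂) (res₃ f₃) x) y p)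
                 (sym residue₄) (sym (res₃-+ a b)) (meet y) }

    -- The points `y`, `y - ρ` and `z = 2 y - ρ` all lie in `I`: the first is the midpoint of `z`
    -- and `ρ`, the second that of `z` and `- ρ`. One of them has the residue of a pair sum, and any
    -- one being generated makes `z` generated.
    Generated-pair : ∀ {ρ z y} → Pair ρ → I z → z +ᵖ ρ ≡ y +ᵖ y → Generated z
    Generated-pair {ρ} {z} {y} p iz eq = cases (meet (res₃ y))
      where
      open Pair p
      z≡ : z ≡ (y +ᵖ y) -ᵖ ρ
      z≡ = trans (sym (add-subtract z ρ)) (cong (_-ᵖ ρ) (trans (+ᵖ-comm ρ z) eq))
      from-y : Generated y → Generated z
      from-y gy = subst Generated (sym z≡) (Generated-difference (Generated-+ gy gy) generated)
      x = y -ᵖ ρ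
      ix : I x
      ix with opposite∈I
      ... | ρ̄ , iρ̄ , cancel = midpoint x iz iρ̄ (begin
        x +ᵖ x ≡⟨ half-difference y ρ ρ̄ ⟩
        (((y +ᵖ y) -ᵖ ρ) +ᵖ ρ̄) -ᵖ (ρ +ᵖ ρ̄) ≡⟨ cong₂ (λ a b → (a +ᵖ ρ̄) -ᵖ b) (sym z≡) cancel ⟩
        (z +ᵖ ρ̄) -ᵖ 0ᵖ ≡⟨ -ᵖ-zero (z +ᵖ ρ̄) ⟩
        z +ᵖ ρ̄ ∎)
        where open ≡-Reasoning
      cases : Meets residue-sums (res₃ y) (res₃ ρ) → Generated z
      cases (inj₁ y∈) = from-y (Generated-residue (midpoint y iz ρ∈I (sym eq)) y∈)
      cases (inj₂ (inj₁ x∈)) = from-y (subst Generated (difference-add y ρ) (Generated-+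
        (Generated-residue ix (subst (_∈ residue-sums) (sym (residue-subtract (res₃ x) (res₃ ρ) (res₃ y)
          (trans (sym (res₃-+ x ρ)) (cong res₃ (difference-add y ρ))))) x∈)) generated))
      cases (inj₂ (inj₂ z∈)) = Generated-residue iz (subst (_∈ residue-sums)
        (sym (residue-subtract (res₃ z) (res₃ ρ) (res₃ y +₃ res₃ y)
          (trans (sym (res₃-+ z ρ)) (trans (cong res₃ eq) (res₃-+ y y))))) z∈)

    Class : Pt → Set
    Class z = (∃ λ ρ → ρ ∈ F × res₂ z ≡ res₂ ρ) ⊎ (∃ λ ρ → Pair ρ × res₂ z ≡ res₂ ρ)

    classify : ∀ z → Class z
    classify z = go (proj₂ planar (res₂ z))
      where
      go : res₂ z ∈ classes (res₂ f₁) (res₂ f₂) (res₂ f₃) (res₂ f₄) → Class z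
      go (here e) = inj₁ (0ᵖ , 0∈ , e)
      go (there (here e)) = inj₁ (f₁ , ∈₁ , e)
      go (there (there (here e))) = inj₁ (f₂ , ∈₂ , e)
      go (there (there (there (here e)))) = inj₁ (f₃ , ∈₃ , e)
      go (there (there (there (there (here e))))) = inj₁ (f₄ , ∈₄ , e)
      go (there (there (there (there (there (here e)))))) = inj₂ (f₁ +ᵖ f₂
        , pair ∈₁ ∈₂ ∈₃ ∈₄ (trans (+ᵖ-assoc f₁ f₂ (f₃ +ᵖ f₄)) balanced) (λ y → proj₁ (meets-residues y))
        , trans e (sym (res₂-+ f₁ f₂)))
      go (there (there (there (there (there (there (here e))))))) = inj₂ (f₁ +ᵖ f₃
        , pair ∈₁ ∈₃ ∈₂ ∈₄ (trans (+ᵖ-assoc f₁ f₃ (f₂ +ᵖ f₄)) (trans (cong (f₁ +ᵖ_) (+ᵖ-swapˡ f₃ f₂ f₄)) balanced))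
            (λ y → proj₁ (proj₂ (meets-residues y)))
        , trans e (sym (res₂-+ f₁ f₃)))
      go (there (there (there (there (there (there (there (here e)))))))) = inj₂ (f₂ +ᵖ f₃
        , pair ∈₂ ∈₃ ∈₁ ∈₄ (trans (+ᵖ-assoc f₂ f₃ (f₁ +ᵖ f₄)) (trans (cong (f₂ +ᵖ_) (+ᵖ-swapˡ f₃ f₁ f₄))
            (trans (+ᵖ-swapˡ f₂ f₁ (f₃ +ᵖ f₄)) balanced))) (λ y → proj₂ (proj₂ (meets-residues y)))
        , trans e (sym (res₂-+ f₂ f₃)))

    from-half : ∀ {z ρ y} → z +ᵖ ρ ≡ y +ᵖ y → Generated ρ → Generated y → Generated z
    from-half {z} {ρ} {y} eq gρ gy = subst Generated
      (trans (cong (_-ᵖ ρ) (trans (sym eq) (+ᵖ-comm z ρ))) (add-subtract z ρ)) (Generated-difference (Generated-+ gy gy) gρ)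

    -- Halving z + ρ brings z into the tetrahedron, unless it gets stuck in the doubled tetrahedron.
    descend : ∀ N z → Bounded (+ N) z → Generated z
    descend zero z b = generated-f (J⊆F (Bounded⇒J (Bounded-weaken {z = z} (ℤ.+≤+ ℕ.z≤n) b)))
    descend (suc N) z b = inside (+ suc N ℤ.≤? Δ)
      where
      smaller : ∀ {ρ w} → z ≡ ρ +ᵖ (w +ᵖ w) → Bounded (+ N) ρ → Generated ρ → Generated z
      smaller {ρ} {w} refl bρ gρ = from-half (half-sum ρ w) gρ
        (descend N (ρ +ᵖ w) (Bounded-half {x = z} {ρ} {ρ +ᵖ w} b bρ (half-sum ρ w)))
      stuck : ∀ {ρ w} → z ≡ ρ +ᵖ (w +ᵖ w) → Pair ρ → Dec (+ suc N ℤ.≤ Δ + Δ) → Generated z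
      stuck {ρ} {w} refl p (yes N≤2Δ) = Generated-pair p (Bounded⇒I (Bounded-weaken {z = z} N≤2Δ b)) (half-sum ρ w)
      -- Here `2 Δ ≤ N`, so `ρ` satisfies the smaller bound `N` and halving makes progress again.
      stuck {ρ} eq p (no N≰2Δ) = smaller eq (Bounded-weaken {z = ρ} (below N≰2Δ) (Pair.bounded p)) (Pair.generated p)
      step : + suc N ℤ.≰ Δ → Class z → Generated z
      step N≰Δ (inj₁ (ρ , ρ∈ , e)) = smaller (proj₂ (res₂-double z ρ e))
        (Bounded-weaken {z = ρ} (below N≰Δ) (Bounded-F ρ∈)) (generated-f ρ∈)
      step N≰Δ (inj₂ (ρ , p , e)) = stuck (proj₂ (res₂-double z ρ e)) p (+ suc N ℤ.≤? Δ + Δ)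
      inside : Dec (+ suc N ℤ.≤ Δ) → Generated z
      inside (yes N≤Δ) = generated-f (J⊆F (Bounded⇒J (Bounded-weaken {z = z} N≤Δ b)))
      inside (no N≰Δ)  = step N≰Δ (classify z)

  generated : ∀ z → Generated z
  -- The sum of the absolute values bounds all four functionals at once and avoids a maximum.
  generated z = descend (n (# 0) ℕ.+ (n (# 1) ℕ.+ (n (# 2) ℕ.+ n (# 3)))) z bounded
    where
    n : Fin 4 → ℕ
    n i = ∣ ℓ i z ∣
    within : ∀ i {m} → n i ℕ.≤ m → ℓ i z ℤ.≤ + m
    within i h = ℤₚ.≤-trans (≤-abs (ℓ i z)) (ℤ.+≤+ h)
    bounded : Bounded (+ (n (# 0) ℕ.+ (n (# 1) ℕ.+ (n (# 2) ℕ.+ n (# 3))))) z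
    bounded zero = within (# 0) (ℕₚ.m≤m+n _ _)
    bounded (suc zero) = within (# 1) (ℕₚ.≤-trans (ℕₚ.m≤m+n _ _) (ℕₚ.m≤n+m _ (n (# 0))))
    bounded (suc (suc zero)) = within (# 2) (ℕₚ.≤-trans (ℕₚ.≤-trans (ℕₚ.m≤m+n _ _) (ℕₚ.m≤n+m _ (n (# 1)))) (ℕₚ.m≤n+m _ (n (# 0))))
    bounded (suc (suc (suc zero))) = within (# 3) (ℕₚ.≤-trans (ℕₚ.≤-trans (ℕₚ.m≤n+m _ (n (# 2))) (ℕₚ.m≤n+m _ (n (# 1)))) (ℕₚ.m≤n+m _ (n (# 0))))

-- The lattice point outside the plane modulo 2

+₂-swap : ∀ x y z → x +₂ (y +₂ z) ≡ y +₂ (x +₂ z)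
+₂-swap x y z = ==₂-sound _ _ (all₂-sound (law x y) (all₂-sound (λ y → all₂ (law x y))
  (all₂-sound (λ x → all₂ λ y → all₂ (law x y)) (T-true laws) x) y) z)
  where
  law : V₂ → V₂ → V₂ → Bool
  law x y z = (x +₂ (y +₂ z)) ==₂ (y +₂ (x +₂ z))
  laws : all₂ (λ x → all₂ λ y → all₂ (law x y)) ≡ true
  laws = refl

total₂-↭ : ∀ {xs ys} → xs ↭ ys → total₂ xs ≡ total₂ ys
total₂-↭ _↭_.refl = refl
total₂-↭ (prep x p) = cong (x +₂_) (total₂-↭ p)
total₂-↭ (_↭_.swap x y p) = trans (+₂-swap x y _) (cong (λ s → y +₂ (x +₂ s)) (total₂-↭ p))
total₂-↭ (_↭_.trans p q) = trans (total₂-↭ p) (total₂-↭ q)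

+₂-cancelˡ : ∀ x y → x +₂ y ≡ x → y ≡ zero₂
+₂-cancelˡ x y eq = ==₂-sound y zero₂ (T-⇒ {(x +₂ y) ==₂ x} (all₂-sound (law x) (all₂-sound (λ x → all₂ (law x)) tt x) y)
    (subst (λ s → T (s ==₂ x)) (sym eq) (all₂-sound (λ x → x ==₂ x) tt x)))
  where
  law : V₂ → V₂ → Bool
  law x y = not ((x +₂ y) ==₂ x) ∨ (y ==₂ zero₂)

+₂-self : ∀ x → x +₂ x ≡ zero₂
+₂-self x = ==₂-sound _ _ (all₂-sound (λ x → (x +₂ x) ==₂ zero₂) tt x)

+₂-zeroʳ : ∀ x → x +₂ zero₂ ≡ x
+₂-zeroʳ x = ==₂-sound _ _ (all₂-sound (λ x → (x +₂ zero₂) ==₂ x) tt x)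

four-translates-ring : ∀ (a b c d t : ℤ) → (a + (b + (c + d))) + ((t + t) + (t + t))
  ≡ (a + t) + ((b + t) + ((c + t) + (d + t)))
four-translates-ring = solve-∀

four-translates : ∀ a b c d t → (a +ᵖ (b +ᵖ (c +ᵖ d))) +ᵖ ((t +ᵖ t) +ᵖ (t +ᵖ t)) ≡ (a +ᵖ t) +ᵖ ((b +ᵖ t) +ᵖ ((c +ᵖ t) +ᵖ (d +ᵖ t)))
four-translates (a ∷ b ∷ c ∷ []) (a′ ∷ b′ ∷ c′ ∷ []) (a″ ∷ b″ ∷ c″ ∷ []) (a‴ ∷ b‴ ∷ c‴ ∷ []) (x ∷ y ∷ z ∷ []) =
  pointwise (four-translates-ring a a′ a″ a‴ x) (four-translates-ring b b′ b″ b‴ y) (four-translates-ring c c′ c″ c‴ z)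

four-differences : ∀ a b c d t → ((a -ᵖ t) +ᵖ ((b -ᵖ t) +ᵖ ((c -ᵖ t) +ᵖ (d -ᵖ t)))) +ᵖ ((t +ᵖ t) +ᵖ (t +ᵖ t)) ≡ a +ᵖ (b +ᵖ (c +ᵖ (d +ᵖ 0ᵖ)))
four-differences a b c d t = trans (four-translates (a -ᵖ t) (b -ᵖ t) (c -ᵖ t) (d -ᵖ t) t)
  (cong₂ _+ᵖ_ (difference-add a t) (cong₂ _+ᵖ_ (difference-add b t) (cong₂ _+ᵖ_ (difference-add c t)
    (trans (difference-add d t) (sym (+ᵖ-identityʳ d))))))

-- Subtracting `t` from each of four points changes their sum by `4 t`, which is even. The
-- hypothesis says that the four residues cancel.
even-differences : ∀ t a b c d → total₂ (map res₂ (t ∷ a ∷ b ∷ c ∷ d ∷ [])) ≡ res₂ t →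
  res₂ ((a -ᵖ t) +ᵖ ((b -ᵖ t) +ᵖ ((c -ᵖ t) +ᵖ (d -ᵖ t)))) ≡ zero₂
even-differences t a b c d total = begin
  res₂ s ≡⟨ +₂-zeroʳ (res₂ s) ⟨
  res₂ s +₂ zero₂ ≡⟨ cong (res₂ s +₂_) (trans (res₂-+ (t +ᵖ t) (t +ᵖ t)) (+₂-self (res₂ (t +ᵖ t)))) ⟨
  res₂ s +₂ res₂ ((t +ᵖ t) +ᵖ (t +ᵖ t)) ≡⟨ res₂-+ s ((t +ᵖ t) +ᵖ (t +ᵖ t)) ⟨
  res₂ (s +ᵖ ((t +ᵖ t) +ᵖ (t +ᵖ t))) ≡⟨ cong res₂ (four-differences a b c d t) ⟩
  res₂ (a +ᵖ (b +ᵖ (c +ᵖ (d +ᵖ 0ᵖ)))) ≡⟨ trans (res₂-+ a _) (cong (res₂ a +₂_) (trans (res₂-+ b _) (cong (res₂ b +₂_)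
                                                      (trans (res₂-+ c _) (cong (res₂ c +₂_) (res₂-+ d 0ᵖ)))))) ⟩
  total₂ (map res₂ (a ∷ b ∷ c ∷ d ∷ [])) ≡⟨ +₂-cancelˡ (res₂ t) _ total ⟩
  zero₂ ∎
  where
  open ≡-Reasoning
  s = (a -ᵖ t) +ᵖ ((b -ᵖ t) +ᵖ ((c -ᵖ t) +ᵖ (d -ᵖ t)))

rebase : ∀ a t xs → map (a +ᵖ_) xs ≡ map ((a +ᵖ t) +ᵖ_) (map (_-ᵖ t) xs)
rebase a t []       = refl
rebase a t (x ∷ xs) = cong₂ _∷_ (sym (trans (+ᵖ-assoc a t (x -ᵖ t)) (cong (a +ᵖ_) (add-difference x t)))) (rebase a t xs)

-- Quantified over the translation `a`, so that one choice of centre and vertices serves both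
-- aligned sets.
Tetrad : List Pt → Set
Tetrad ts = ∃ λ t → ∃ λ f₁ → ∃ λ f₂ → ∃ λ f₃ → ∃ λ f₄ → (∀ a → map (a +ᵖ_) ts ↭ map ((a +ᵖ t) +ᵖ_) (star f₁ f₂ f₃ f₄)) ×
  res₂ (f₁ +ᵖ (f₂ +ᵖ (f₃ +ᵖ f₄))) ≡ zero₂

-- The centre `t` is the point whose residue modulo 2 is the total of all five; the other four then
-- have total 0.
tetrad : ∀ {I} → Thin I → ∀ ts → length ts ≡ 5 → Unique ts → (∀ {x y} → x ∈ ts → y ∈ ts → I (x +ᵖ y)) → Tetrad ts
tetrad {I} thin ts@(t₀ ∷ t₁ ∷ t₂ ∷ t₃ ∷ t₄ ∷ []) refl u sum
  with ∈ₚ.∈-map⁻ res₂ (total-inside (res₂ t₀) (res₂ t₁) (res₂ t₂) (res₂ t₃) (res₂ t₄)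
         (Unique-res₂ thin {_∈ ts} sum (All.tabulate λ t∈ → t∈) u))
... | t , t∈ , total with ∈-front t∈
... | us , p = go us p (ℕₚ.suc-injective (trans (sym (↭ₚ.↭-length p)) refl))
  where
  go : ∀ us → ts ↭ t ∷ us → length us ≡ 4 → Tetrad ts
  go (a ∷ b ∷ c ∷ d ∷ []) p refl = t , a -ᵖ t , b -ᵖ t , c -ᵖ t , d -ᵖ t
    , (λ x → ↭-trans (↭ₚ.map⁺ (x +ᵖ_) p) (↭-reflexive (trans (rebase x t (t ∷ a ∷ b ∷ c ∷ d ∷ []))
        (cong (λ z → map ((x +ᵖ t) +ᵖ_) (z ∷ map (_-ᵖ t) (a ∷ b ∷ c ∷ d ∷ []))) (difference-self t)))))
    , even-differences t a b c d (trans (sym (total₂-↭ (↭ₚ.map⁺ res₂ p))) total)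

-- Matrices

apply : Mat → Pt → Pt
apply U p = V.map (λ row → dotℤ row p) U

fromColumns : Pt → Pt → Pt → Mat
fromColumns (a ∷ b ∷ c ∷ []) (a′ ∷ b′ ∷ c′ ∷ []) (a″ ∷ b″ ∷ c″ ∷ []) =
  (a ∷ a′ ∷ a″ ∷ []) ∷ (b ∷ b′ ∷ b″ ∷ []) ∷ (c ∷ c′ ∷ c″ ∷ []) ∷ []

apply-row-ring : ∀ (a b c x y z : ℤ) → a * x + (b * y + (c * z + + 0)) ≡ x * a + (y * b + z * c)
apply-row-ring = solve-∀

apply-fromColumns : ∀ f₁ f₂ f₃ c → apply (fromColumns f₁ f₂ f₃) c ≡ comb f₁ f₂ f₃ c
apply-fromColumns (a ∷ b ∷ c ∷ []) (a′ ∷ b′ ∷ c′ ∷ []) (a″ ∷ b″ ∷ c″ ∷ []) (x ∷ y ∷ z ∷ []) =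
  pointwise (apply-row-ring a a′ a″ x y z) (apply-row-ring b b′ b″ x y z) (apply-row-ring c c′ c″ x y z)

identity-by-columns : ∀ U f₁ f₂ f₃ → apply U f₁ ≡ e₁ → apply U f₂ ≡ e₂ → apply U f₃ ≡ e₃ → U *ᴹ fromColumns f₁ f₂ f₃ ≡ Iᴹ
identity-by-columns (r₁ ∷ r₂ ∷ r₃ ∷ []) f₁@(_ ∷ _ ∷ _ ∷ []) f₂@(_ ∷ _ ∷ _ ∷ []) f₃@(_ ∷ _ ∷ _ ∷ []) h₁ h₂ h₃ =
  pointwise {A = Pt} (pointwise (cong V.head h₁) (cong V.head h₂) (cong V.head h₃))
    (pointwise (cong at₁ h₁) (cong at₁ h₂) (cong at₁ h₃)) (pointwise (cong at₂ h₁) (cong at₂ h₂) (cong at₂ h₃))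

comb-·-ring : ∀ (n a b c x y z : ℤ) → (n * x) * a + ((n * y) * b + (n * z) * c) ≡ n * (x * a + (y * b + z * c))
comb-·-ring = solve-∀

comb-· : ∀ f₁ f₂ f₃ n c → comb f₁ f₂ f₃ (n ·ᵖ c) ≡ n ·ᵖ comb f₁ f₂ f₃ c
comb-· (a ∷ b ∷ c ∷ []) (a′ ∷ b′ ∷ c′ ∷ []) (a″ ∷ b″ ∷ c″ ∷ []) n (x ∷ y ∷ z ∷ []) =
  pointwise (comb-·-ring n a a′ a″ x y z) (comb-·-ring n b b′ b″ x y z) (comb-·-ring n c c′ c″ x y z)

comb-comb : ∀ f₁ f₂ f₃ c₁ c₂ c₃ x → comb f₁ f₂ f₃ (comb c₁ c₂ c₃ x) ≡ comb (comb f₁ f₂ f₃ c₁) (comb f₁ f₂ f₃ c₂) (comb f₁ f₂ f₃ c₃) x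
comb-comb f₁ f₂ f₃ c₁ c₂ c₃ (x ∷ y ∷ z ∷ []) =
  trans (comb-+ f₁ f₂ f₃ (x ·ᵖ c₁) ((y ·ᵖ c₂) +ᵖ (z ·ᵖ c₃))) (cong₂ _+ᵖ_ (comb-· f₁ f₂ f₃ x c₁)
    (trans (comb-+ f₁ f₂ f₃ (y ·ᵖ c₂) (z ·ᵖ c₃)) (cong₂ _+ᵖ_ (comb-· f₁ f₂ f₃ y c₂) (comb-· f₁ f₂ f₃ z c₃))))

comb-basis : ∀ x → comb e₁ e₂ e₃ x ≡ x
comb-basis (x ∷ y ∷ z ∷ []) = pointwise (h₁ x y z) (h₂ x y z) (h₃ x y z)
  where
  h₁ : ∀ (x y z : ℤ) → x * + 1 + (y * + 0 + z * + 0) ≡ x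
  h₁ = solve-∀
  h₂ : ∀ (x y z : ℤ) → x * + 0 + (y * + 1 + z * + 0) ≡ y
  h₂ = solve-∀
  h₃ : ∀ (x y z : ℤ) → x * + 0 + (y * + 0 + z * + 1) ≡ z
  h₃ = solve-∀

dot-/1 : ∀ {n} (u v : Vec ℤ n) → V.foldr _ ℚ._+_ 0ℚ (V.zipWith ℚ._*_ (V.map (λ z → z ℚ./ 1) u) (V.map (λ z → z ℚ./ 1) v)) ≡
         V.foldr _ _+_ (+ 0) (V.zipWith _*_ u v) ℚ./ 1
dot-/1 []      []      = refl
dot-/1 (a ∷ u) (b ∷ v) = trans (cong₂ ℚ._+_ (sym (/1-* a b)) (dot-/1 u v)) (sym (/1-+ (a * b) _))

actQ-toQ : ∀ U p → actQ U (toQ p) ≡ toQ (apply U p)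
actQ-toQ (r₁ ∷ r₂ ∷ r₃ ∷ []) p = pointwise (dot-/1 r₁ p) (dot-/1 r₂ p) (dot-/1 r₃ p)

dotℚ-+ : ∀ u x y → dotℚ u (x +q y) ≡ dotℚ u x ℚ.+ dotℚ u y
dotℚ-+ (a ∷ b ∷ c ∷ []) (x ∷ y ∷ z ∷ []) (x′ ∷ y′ ∷ z′ ∷ []) =
  step a x x′ (step b y y′ (step c z z′ refl))
  where
  interchange : ∀ p q r s → (p ℚ.+ q) ℚ.+ (r ℚ.+ s) ≡ (p ℚ.+ r) ℚ.+ (q ℚ.+ s)
  interchange p q r s = cong V.head (+q-interchange (p ∷ p ∷ p ∷ []) (q ∷ q ∷ q ∷ []) (r ∷ r ∷ r ∷ []) (s ∷ s ∷ s ∷ []))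
  step : ∀ a x x′ {s t t′} → s ≡ t ℚ.+ t′ → a ℚ.* (x ℚ.+ x′) ℚ.+ s ≡ (a ℚ.* x ℚ.+ t) ℚ.+ (a ℚ.* x′ ℚ.+ t′)
  step a x x′ {t = t} {t′} refl = trans (cong (ℚ._+ (t ℚ.+ t′)) (ℚₚ.*-distribˡ-+ a x x′)) (interchange (a ℚ.* x) (a ℚ.* x′) t t′)

dotℚ-· : ∀ u r x → dotℚ u (r ·q x) ≡ r ℚ.* dotℚ u x
dotℚ-· (a ∷ b ∷ c ∷ []) r (x ∷ y ∷ z ∷ []) = step a x (step b y (step c z (sym (ℚₚ.*-zeroʳ r))))
  where
  swapˡ : ∀ a r x → a ℚ.* (r ℚ.* x) ≡ r ℚ.* (a ℚ.* x)
  swapˡ a r x = trans (sym (ℚₚ.*-assoc a r x)) (trans (cong (ℚ._* x) (ℚₚ.*-comm a r)) (ℚₚ.*-assoc r a x))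
  step : ∀ a x {s t} → s ≡ r ℚ.* t → a ℚ.* (r ℚ.* x) ℚ.+ s ≡ r ℚ.* (a ℚ.* x ℚ.+ t)
  step a x {t = t} refl = trans (cong (ℚ._+ r ℚ.* t) (swapˡ a r x)) (sym (ℚₚ.*-distribˡ-+ r (a ℚ.* x) t))

actQ-+ : ∀ U x y → actQ U (x +q y) ≡ actQ U x +q actQ U y
actQ-+ (r₁ ∷ r₂ ∷ r₃ ∷ []) x y = pointwise (dotℚ-+ (V.map _ r₁) x y) (dotℚ-+ (V.map _ r₂) x y) (dotℚ-+ (V.map _ r₃) x y)

actQ-· : ∀ U r x → actQ U (r ·q x) ≡ r ·q actQ U x
actQ-· (r₁ ∷ r₂ ∷ r₃ ∷ []) r x = pointwise (dotℚ-· (V.map _ r₁) r x) (dotℚ-· (V.map _ r₂) r x) (dotℚ-· (V.map _ r₃) r x)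

actQ-zero : ∀ U → actQ U 0q ≡ 0q
actQ-zero U = trans (cong (actQ U) (sym (·q-zeroˡ 0q))) (trans (actQ-· U 0ℚ 0q) (·q-zeroˡ (actQ U 0q)))

actQ-comboOf : ∀ U g ws → actQ U (comboOf g ws) ≡ comboOf (actQ U ∘ g) ws
actQ-comboOf U g []             = actQ-zero U
actQ-comboOf U g ((c , p) ∷ ws) = trans (actQ-+ U (c ·q g p) (comboOf g ws)) (cong₂ _+q_ (actQ-· U c (g p)) (actQ-comboOf U g ws))

comboOf-cong : ∀ {g h} → (∀ p → g p ≡ h p) → ∀ ws → comboOf g ws ≡ comboOf h ws
comboOf-cong eq []             = refl
comboOf-cong eq ((c , p) ∷ ws) = cong₂ (λ x y → (c ·q x) +q y) (eq p) (comboOf-cong eq ws)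

comboOf-translate : ∀ g t ws → weights ws ≡ 1ℚ → comboOf (λ p → g p +q t) ws ≡ comboOf g ws +q t
comboOf-translate g t ws one = trans (comboOf-+ g t ws) (cong (comboOf g ws +q_) (trans (cong (_·q t) one) (·q-identityˡ t)))

affine-comboOf : ∀ U s t g ws → weights ws ≡ 1ℚ →
  (actQ U (comboOf g ws) +q s) +q t ≡ comboOf (λ p → (actQ U (g p) +q s) +q t) ws
affine-comboOf U s t g ws one = sym (trans (comboOf-translate (λ p → actQ U (g p) +q s) t ws one)
  (cong (_+q t) (trans (comboOf-translate (actQ U ∘ g) s ws one) (cong (_+q s) (sym (actQ-comboOf U g ws))))))

toQ-affine : ∀ U s t p → (actQ U (toQ p) +q toQ s) +q toQ t ≡ toQ ((apply U p +ᵖ s) +ᵖ t)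
toQ-affine U s t p = sym (trans (toQ-+ (apply U p +ᵖ s) t) (cong (_+q toQ t)
  (trans (toQ-+ (apply U p) s) (cong (_+q toQ s) (sym (actQ-toQ U p))))))

-- An affine map commutes with convex combinations, so both inclusions may be checked on generators.
-- Preimages of the generators of `K` come from the right inverse `back`.
ImageEq-intro : ∀ U s t P K (back : Pt → Pt) → (∀ p → (apply U (back p) +ᵖ s) +ᵖ t ≡ p) →
  (∀ {p} → p ∈ K → InConv P (toQ (back p))) → (∀ {p} → p ∈ P → InConv K (toQ ((apply U p +ᵖ s) +ᵖ t))) → ImageEq U s t P K
ImageEq-intro U s t P K back inverse from to x = mk⇔
  (λ { (ws , ok , one , refl) → comboOf (toQ ∘ back) ws , InConv-comboOf (toQ ∘ back) ws from ok one
     , sym (trans (affine-comboOf U (toQ s) (toQ t) (toQ ∘ back) ws one)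
         (trans (comboOf-cong (λ p → trans (toQ-affine U s t (back p)) (cong toQ (inverse p))) ws) (comboOf-toQ ws))) })
  (λ { (y , (ws , ok , one , refl) , refl) → subst (InConv K)
         (trans (comboOf-cong (λ p → sym (toQ-affine U s t p)) ws)
           (trans (sym (affine-comboOf U (toQ s) (toQ t) toQ ws one))
             (cong (λ z → (actQ U z +q toQ s) +q toQ t) (comboOf-toQ ws))))
         (InConv-comboOf (λ p → toQ ((apply U p +ᵖ s) +ᵖ t)) ws to ok one) })

0∈K₁ : InConv K₁ (toQ 0ᵖ)
0∈K₁ = Convex-InConv K₁ 3 ((1 , e₁) ∷ (1 , e₂) ∷ (1 , e₃) ∷ (1 , e₄) ∷ []) 0ᵖ
  (InConv-generator (here refl) ∷ InConv-generator (there (here refl)) ∷ InConv-generator (there (there (here refl)))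
    ∷ InConv-generator (there (there (there (here refl)))) ∷ []) refl refl

-- The unimodular map onto `K₁`

module _ {f₁ f₂ f₃ f₄ c₁ c₂ c₃ : Pt} (balanced : f₁ +ᵖ (f₂ +ᵖ (f₃ +ᵖ f₄)) ≡ 0ᵖ)
  .{{nonZero : ℤ.NonZero (det f₁ f₂ f₃)}}
  (h₁ : e₁ ≡ comb f₁ f₂ f₃ c₁) (h₂ : e₂ ≡ comb f₁ f₂ f₃ c₂) (h₃ : e₃ ≡ comb f₁ f₂ f₃ c₃) where

  private
    U W : Mat
    U = fromColumns c₁ c₂ c₃
    W = fromColumns f₁ f₂ f₃

  comb-right-inverse : ∀ x → comb f₁ f₂ f₃ (comb c₁ c₂ c₃ x) ≡ x
  comb-right-inverse x = begin
    comb f₁ f₂ f₃ (comb c₁ c₂ c₃ x) ≡⟨ comb-comb f₁ f₂ f₃ c₁ c₂ c₃ x ⟩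
    comb (comb f₁ f₂ f₃ c₁) (comb f₁ f₂ f₃ c₂) (comb f₁ f₂ f₃ c₃) x ≡⟨ cong₂ (λ a b → comb a b (comb f₁ f₂ f₃ c₃) x) h₁ h₂ ⟨
    comb e₁ e₂ (comb f₁ f₂ f₃ c₃) x ≡⟨ cong (λ c → comb e₁ e₂ c x) h₃ ⟨
    comb e₁ e₂ e₃ x ≡⟨ comb-basis x ⟩
    x ∎
    where open ≡-Reasoning

  -- `U` is a right inverse of `comb f₁ f₂ f₃`, and an injective map with a right inverse is
  -- invertible. Injectivity is where the nonzero determinant enters.
  apply-comb : ∀ x → apply U (comb f₁ f₂ f₃ x) ≡ x
  apply-comb x = trans (apply-fromColumns c₁ c₂ c₃ (comb f₁ f₂ f₃ x))
    (comb-injective f₁ f₂ f₃ (comb-right-inverse (comb f₁ f₂ f₃ x)))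

  private
    apply-f : ∀ {x f} → comb f₁ f₂ f₃ x ≡ f → apply U f ≡ x
    apply-f {x} refl = apply-comb x

  unimodular : InGL3Z U
  unimodular = W
    , identity-by-columns U f₁ f₂ f₃ (apply-f {e₁} (comb-e₁ f₁ f₂ f₃)) (apply-f {e₂} (comb-e₂ f₁ f₂ f₃)) (apply-f {e₃} (comb-e₃ f₁ f₂ f₃))
    , identity-by-columns W c₁ c₂ c₃ (trans (apply-fromColumns f₁ f₂ f₃ c₁) (sym h₁))
        (trans (apply-fromColumns f₁ f₂ f₃ c₂) (sym h₂)) (trans (apply-fromColumns f₁ f₂ f₃ c₃) (sym h₃))

  -- The translation by `- U a` takes the base point `a` to 0 and `a + fᵢ` to `eᵢ`. As `U` does not
  -- depend on `a`, it serves both polytopes.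
  image : ∀ P a → (∀ {x} → x ∈ star f₁ f₂ f₃ f₄ → InConv P (toQ (a +ᵖ x))) →
    (∀ {x} → InConv P (toQ (a +ᵖ x)) → x ∈ star f₁ f₂ f₃ f₄) → ImageEq U 0ᵖ (0ᵖ -ᵖ apply U a) P K₁
  image P a F⊆P P⊆F = ImageEq-intro U 0ᵖ (0ᵖ -ᵖ apply U a) P K₁ back
      (λ p → trans (forward (comb f₁ f₂ f₃ p)) (apply-comb p)) from to
    where
    back : Pt → Pt
    back p = a +ᵖ comb f₁ f₂ f₃ p
    apply-+ : ∀ x y → apply U (x +ᵖ y) ≡ apply U x +ᵖ apply U y
    apply-+ x y = trans (apply-fromColumns c₁ c₂ c₃ (x +ᵖ y)) (trans (comb-+ c₁ c₂ c₃ x y)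
      (sym (cong₂ _+ᵖ_ (apply-fromColumns c₁ c₂ c₃ x) (apply-fromColumns c₁ c₂ c₃ y))))
    forward : ∀ x → (apply U (a +ᵖ x) +ᵖ 0ᵖ) +ᵖ (0ᵖ -ᵖ apply U a) ≡ apply U x
    forward x = begin
      (apply U (a +ᵖ x) +ᵖ 0ᵖ) +ᵖ (0ᵖ -ᵖ apply U a) ≡⟨ cong (_+ᵖ (0ᵖ -ᵖ apply U a)) (trans (+ᵖ-identityʳ _) (trans (apply-+ a x) (+ᵖ-comm (apply U a) (apply U x)))) ⟩
      (apply U x +ᵖ apply U a) +ᵖ (0ᵖ -ᵖ apply U a) ≡⟨ +ᵖ-assoc (apply U x) (apply U a) (0ᵖ -ᵖ apply U a) ⟩
      apply U x +ᵖ (apply U a +ᵖ (0ᵖ -ᵖ apply U a)) ≡⟨ cong (apply U x +ᵖ_) (add-difference 0ᵖ (apply U a)) ⟩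
      apply U x +ᵖ 0ᵖ ≡⟨ +ᵖ-identityʳ (apply U x) ⟩
      apply U x ∎
      where open ≡-Reasoning
    at : ∀ {x y} → x ≡ y → InConv P (toQ (a +ᵖ y)) → InConv P (toQ (a +ᵖ x))
    at refl h = h
    from : ∀ {p} → p ∈ K₁ → InConv P (toQ (back p))
    from (here refl)                         = at (comb-e₁ f₁ f₂ f₃) (F⊆P (there (here refl)))
    from (there (here refl))                 = at (comb-e₂ f₁ f₂ f₃) (F⊆P (there (there (here refl))))
    from (there (there (here refl)))         = at (comb-e₃ f₁ f₂ f₃) (F⊆P (there (there (there (here refl)))))
    from (there (there (there (here refl)))) = at (comb-e₄ f₁ f₂ f₃ f₄ balanced) (F⊆P (there (there (there (there (here refl))))))
    image-of : ∀ {x f} → comb f₁ f₂ f₃ x ≡ f → InConv K₁ (toQ x) → InConv K₁ (toQ (apply U f))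
    image-of {x} eq = subst (λ y → InConv K₁ (toQ y)) (sym (apply-f {x} eq))
    vertex : ∀ {x} → x ∈ star f₁ f₂ f₃ f₄ → InConv K₁ (toQ (apply U x))
    vertex (here refl) = image-of {0ᵖ} (comb-zero f₁ f₂ f₃) 0∈K₁
    vertex (there (here refl))                         = image-of {e₁} (comb-e₁ f₁ f₂ f₃) (InConv-generator {p = e₁} (here refl))
    vertex (there (there (here refl)))                 = image-of {e₂} (comb-e₂ f₁ f₂ f₃) (InConv-generator {p = e₂} (there (here refl)))
    vertex (there (there (there (here refl))))         = image-of {e₃} (comb-e₃ f₁ f₂ f₃) (InConv-generator {p = e₃} (there (there (here refl))))
    vertex (there (there (there (there (here refl))))) = image-of {e₄} (comb-e₄ f₁ f₂ f₃ f₄ balanced)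
      (InConv-generator {p = e₄} (there (there (there (here refl)))))
    to : ∀ {p} → p ∈ P → InConv K₁ (toQ ((apply U p +ᵖ 0ᵖ) +ᵖ (0ᵖ -ᵖ apply U a)))
    -- A generator of `P` may be any lattice point of the hull, including the interior one, which is
    -- why `vertex` also treats 0.
    to {p} p∈ = subst (λ y → InConv K₁ (toQ y))
      (trans (sym (forward (p -ᵖ a))) (cong (λ y → (apply U y +ᵖ 0ᵖ) +ᵖ (0ᵖ -ᵖ apply U a)) (add-difference p a)))
      (vertex (P⊆F (subst (λ y → InConv P (toQ y)) (sym (add-difference p a)) (InConv-generator p∈))))

theorem3p22 : (P Q : LPoly) →
    MinkowskiLength P 1 → MinkowskiLength Q 1 → MinkowskiLength (P ⊕ Q) 2 →
    NumLatticePts P 5 → NumLatticePts Q 5 →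
    EquivPair P Q K₁ K₁
theorem3p22 P Q _ _ length₂ (as , |as| , uA , as⇔P) (bs , |bs| , uB , bs⇔Q) =
    aligned (align thin as bs |as| |bs| uA uB (λ a∈ b∈ → InConv-⊕ᵖ (Equivalence.to (as⇔P _) a∈) (Equivalence.to (bs⇔Q _) b∈)))
  where
  thin : Thin (λ x → InConv (P ⊕ Q) (toQ x))
  thin = Thin-InConv (P ⊕ Q) length₂

  inside : ∀ {S xs c zs} → (∀ x → (x ∈ xs) ⇔ InConv S (toQ x)) → xs ↭ map (c +ᵖ_) zs → ∀ {x} → x ∈ zs → InConv S (toQ (c +ᵖ x))
  inside {c = c} xs⇔S p x∈ = Equivalence.to (xs⇔S _) (↭ₚ.∈-resp-↭ (↭-sym p) (∈ₚ.∈-map⁺ (c +ᵖ_) x∈))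

  complete : ∀ {S xs c zs} → (∀ x → (x ∈ xs) ⇔ InConv S (toQ x)) → xs ↭ map (c +ᵖ_) zs → ∀ {x} → InConv S (toQ (c +ᵖ x)) → x ∈ zs
  complete {c = c} {zs} xs⇔S p {x} h with ∈ₚ.∈-map⁻ (c +ᵖ_) (↭ₚ.∈-resp-↭ p (Equivalence.from (xs⇔S (c +ᵖ x)) h))
  ... | y , y∈ , eq = subst (_∈ zs) (sym (+ᵖ-cancelˡ c eq)) y∈

  sum : ∀ {a b zs} → as ↭ map (a +ᵖ_) zs → bs ↭ map (b +ᵖ_) zs → ∀ {x y} → x ∈ zs → y ∈ zs →
        shift (a +ᵖ b) (λ x → InConv (P ⊕ Q) (toQ x)) (x +ᵖ y)
  sum {a} {b} p q {x} {y} x∈ y∈ = subst (λ z → InConv (P ⊕ Q) (toQ z)) (+ᵖ-interchange a x b y)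
    (InConv-⊕ᵖ (inside as⇔P p x∈) (inside bs⇔Q q y∈))

  aligned : (∃ λ a → ∃ λ b → ∃ λ ts → as ↭ map (a +ᵖ_) ts × bs ↭ map (b +ᵖ_) ts) → EquivPair P Q K₁ K₁
  aligned (a , b , ts , p , q) = centred (tetrad (Thin-shift (a +ᵖ b) thin) ts
      (trans (sym (Listₚ.length-map (a +ᵖ_) ts)) (trans (sym (↭ₚ.↭-length p)) |as|))
      (Uniqueₚ.map⁻ (Unique-resp-↭ p uA)) (sum p q))
    where
    centred : Tetrad ts → EquivPair P Q K₁ K₁
    centred (t , f₁ , f₂ , f₃ , f₄ , rebased , even) =
        -- The shared translation is 0; the two base points are moved to 0 by the separate vectors
        -- that follow.
        fromColumns c₁ c₂ c₃ , unimodular balanced′ {{nonZero}} h₁ h₂ h₃ , 0ᵖ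
      , 0ᵖ -ᵖ apply (fromColumns c₁ c₂ c₃) a′ , 0ᵖ -ᵖ apply (fromColumns c₁ c₂ c₃) b′
      , image balanced′ {{nonZero}} h₁ h₂ h₃ P a′ (inside as⇔P p′) (complete as⇔P p′)
      , image balanced′ {{nonZero}} h₁ h₂ h₃ Q b′ (inside bs⇔Q q′) (complete bs⇔Q q′)
      where
      a′ = a +ᵖ t
      b′ = b +ᵖ t
      F = star f₁ f₂ f₃ f₄
      p′ : as ↭ map (a′ +ᵖ_) F
      p′ = ↭-trans p (rebased a)
      q′ : bs ↭ map (b′ +ᵖ_) F
      q′ = ↭-trans q (rebased b)
      thin′ : Thin (shift (a′ +ᵖ b′) (λ x → InConv (P ⊕ Q) (toQ x)))
      thin′ = Thin-shift (a′ +ᵖ b′) thin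
      convex′ : Convex (shift a′ (λ x → InConv P (toQ x)))
      convex′ = Convex-shift a′ (Convex-InConv P)
      distinct : Unique F
      distinct = Uniqueₚ.map⁻ (Unique-resp-↭ p′ uA)
      balanced′ = balanced thin′ convex′ distinct (inside as⇔P p′) (complete as⇔P p′) (sum p′ q′) even
      nonZero = det-nonZero thin′ convex′ distinct (inside as⇔P p′) (complete as⇔P p′) (sum p′ q′) even
      generated′ = generated thin′ convex′ distinct (inside as⇔P p′) (complete as⇔P p′) (sum p′ q′) even
      c₁ = proj₁ (generated′ e₁)
      c₂ = proj₁ (generated′ e₂)
      c₃ = proj₁ (generated′ e₃)
      h₁ = proj₂ (generated′ e₁)
      h₂ = proj₂ (generated′ e₂)
      h₃ = proj₂ (generated′ e₃)
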